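{- For any integer $n_0$ there exist an integer $n\ge n_0$ and a block design $(S;A_1,\dots,A_m)$ such that $|S|=n$, $|A_i|>0.6\sqrt{n}$ for every $i\in\{1,\dots,m\}$, and for every transversal $Q$ of $(S;A_1,\dots,A_m)$ there exists an $i\in\{1,\dots,m\}$ such that $$|Q\cap A_i|\ge \frac{\log n}{100\log\log n}.$$
   Context: Let $S$ be a finite set and $A_1,\dots,A_m$ subsets of $S$, called blocks. $(S;A_1,\dots,A_m)$ is a (pairwise balanced) block design if every pair of distinct elements of $S$ is contained in exactly one block. A transversal of the block design is a subset $Q\subseteq S$ having non-empty intersection with every block $A_i$. Here $\log$ denotes the natural logarithm. -}

module Defs where

open import Algebra.Bundles using (CommutativeRing)
open import Data.Empty using (⊥; ⊥-elim)
open import Data.Fin using (Fin)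
open import Data.Fin.Subset using (Subset; _∈_; _∩_; Nonempty)
open import Data.Integer as ℤ using (ℤ; +_; -[1+_])
import Data.Integer.Properties as ℤ
open import Data.Nat as ℕ using (ℕ; zero; suc)
import Data.Nat.Properties as ℕ
open import Data.Product using (∃; ∃!; _×_; _,_; proj₁; proj₂)
open import Data.Rational
  using (ℚ; mkℚ; 0ℚ; 1ℚ; _+_; _*_; _-_; -_; 1/_; _/_; _≤_; _<_; _≤?_; _<?_; ∣_∣;
         positive; nonNegative; nonPositive; toℚᵘ; >-nonZero)
open import Data.Rational.Properties hiding (_≤?_; _<?_; _≟_)
import Data.Rational.Unnormalised as ℚᵘ
import Data.Rational.Unnormalised.Properties as ℚᵘ
open import Data.Rational.Solver using (module +-*-Solver)
open import Data.Sum using (_⊎_; inj₁; inj₂)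
open import Relation.Binary.PropositionalEquality
  using (_≡_; _≢_; refl; sym; trans; cong; cong₂; subst; subst₂)
open import Relation.Nullary using (Dec; yes; no)
open import Relation.Nullary.Decidable using (from-yes)
open import Algebra.Properties.CommutativeSemiring.Exp
  (CommutativeRing.commutativeSemiring +-*-commutativeRing)
  using (_^_; ^-assocʳ; ^-distrib-*)

open +-*-Solver using (solve; _:=_; _:+_; _:*_; _:-_; :-_; con)

≤-by : ∀ {p q} d → 0ℚ ≤ d → p + d ≡ q → p ≤ q
≤-by {p} d 0≤d e = subst₂ _≤_ (+-identityʳ p) e (+-monoʳ-≤ p 0≤d)

<-by : ∀ {p q} d → 0ℚ < d → p + d ≡ q → p < q
<-by {p} d 0<d e = subst₂ _<_ (+-identityʳ p) e (+-monoʳ-< p 0<d)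

<⇒0<- : ∀ {p q} → p < q → 0ℚ < q - p
<⇒0<- {p} {q} p<q = subst (_< q - p) (+-inverseʳ p) (+-monoˡ-< (- p) p<q)

≤⇒0≤- : ∀ {p q} → p ≤ q → 0ℚ ≤ q - p
≤⇒0≤- {p} {q} p≤q = subst (_≤ q - p) (+-inverseʳ p) (+-monoˡ-≤ (- p) p≤q)

0<-⇒< : ∀ {p q} → 0ℚ < q - p → p < q
0<-⇒< {p} {q} h = <-by (q - p) h (solve 2 (λ p q → p :+ (q :- p) := q) refl p q)

+-pos : ∀ {p q} → 0ℚ < p → 0ℚ < q → 0ℚ < p + q
+-pos {p} {q} 0<p 0<q = <-by {0ℚ} {p + q} (p + q) (+-mono-< 0<p 0<q) (+-identityˡ _)

+-nonNeg : ∀ {p q} → 0ℚ ≤ p → 0ℚ ≤ q → 0ℚ ≤ p + q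
+-nonNeg = +-mono-≤

*-monoʳ-≤′ : ∀ {p q r} → 0ℚ ≤ r → p ≤ q → p * r ≤ q * r
*-monoʳ-≤′ {r = r} 0≤r = *-monoʳ-≤-nonNeg r {{nonNegative 0≤r}}

*-monoˡ-≤′ : ∀ {p q r} → 0ℚ ≤ r → p ≤ q → r * p ≤ r * q
*-monoˡ-≤′ {r = r} 0≤r = *-monoˡ-≤-nonNeg r {{nonNegative 0≤r}}

*-monoʳ-<′ : ∀ {p q r} → 0ℚ < r → p < q → p * r < q * r
*-monoʳ-<′ {r = r} 0<r = *-monoˡ-<-pos r {{positive 0<r}}

*-monoˡ-<′ : ∀ {p q r} → 0ℚ < r → p < q → r * p < r * q
*-monoˡ-<′ {r = r} 0<r = *-monoʳ-<-pos r {{positive 0<r}}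

*-cancelʳ-<′ : ∀ {p q} r → 0ℚ ≤ r → p * r < q * r → p < q
*-cancelʳ-<′ r 0≤r = *-cancelʳ-<-nonNeg r {{nonNegative 0≤r}}

*-nonNeg : ∀ {p q} → 0ℚ ≤ p → 0ℚ ≤ q → 0ℚ ≤ p * q
*-nonNeg {p} {q} 0≤p 0≤q = subst (_≤ p * q) (*-zeroˡ q) (*-monoʳ-≤′ 0≤q 0≤p)

*-pos : ∀ {p q} → 0ℚ < p → 0ℚ < q → 0ℚ < p * q
*-pos {p} {q} 0<p 0<q = subst (_< p * q) (*-zeroˡ q) (*-monoʳ-<′ 0<q 0<p)

*-mono-≤′ : ∀ {p q r s} → 0ℚ ≤ p → p ≤ q → 0ℚ ≤ r → r ≤ s → p * r ≤ q * s
*-mono-≤′ 0≤p p≤q 0≤r r≤s =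
  ≤-trans (*-monoʳ-≤′ 0≤r p≤q) (*-monoˡ-≤′ (≤-trans 0≤p p≤q) r≤s)

sq-nonNeg : ∀ p → 0ℚ ≤ p * p
sq-nonNeg p with ≤-total 0ℚ p
... | inj₁ 0≤p = *-nonNeg 0≤p 0≤p
... | inj₂ p≤0 = subst (0ℚ ≤_) (solve 1 (λ p → (:- p) :* (:- p) := p :* p) refl p)
                   (*-nonNeg (neg-antimono-≤ p≤0) (neg-antimono-≤ p≤0))

0<1 : 0ℚ < 1ℚ
0<1 = from-yes (0ℚ <? 1ℚ)

reciprocal : ∀ {p} → 0ℚ < p → ∃ λ r → 0ℚ < r × p * r ≡ 1ℚ
reciprocal {p} 0<p =
  (1/ p) {{nz}} , positive⁻¹ ((1/ p) {{nz}}) {{1/pos⇒pos p {{positive 0<p}}}}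
  , *-inverseʳ p {{nz}}
  where nz = >-nonZero 0<p

+1-bound : ∀ p → p < p + 1ℚ
+1-bound p = <-by 1ℚ 0<1 refl

-1-bound : ∀ p → p - 1ℚ < p
-1-bound p = <-by 1ℚ 0<1 (solve 1 (λ p → p :- con 1ℚ :+ con 1ℚ := p) refl p)

≤∣∣ : ∀ p → p ≤ ∣ p ∣
≤∣∣ p with ≤-total 0ℚ p
... | inj₁ 0≤p = ≤-reflexive (sym (0≤p⇒∣p∣≡p 0≤p))
... | inj₂ p≤0 = ≤-trans p≤0 (0≤∣p∣ p)

-≤∣∣ : ∀ p → - p ≤ ∣ p ∣
-≤∣∣ p = subst (- p ≤_) (∣-p∣≡∣p∣ p) (≤∣∣ (- p))

ub₂ : ∀ p q → ∃ λ m → p ≤ m × q ≤ m × (m ≡ p ⊎ m ≡ q)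
ub₂ p q with ≤-total p q
... | inj₁ p≤q = q , p≤q , ≤-refl , inj₂ refl
... | inj₂ q≤p = p , ≤-refl , q≤p , inj₁ refl

lb₂ : ∀ p q → ∃ λ m → m ≤ p × m ≤ q × (m ≡ p ⊎ m ≡ q)
lb₂ p q with ≤-total p q
... | inj₁ p≤q = p , ≤-refl , p≤q , inj₁ refl
... | inj₂ q≤p = q , q≤p , ≤-refl , inj₂ refl

pick : ∀ {m p q} (P : ℚ → Set) → m ≡ p ⊎ m ≡ q → P p → P q → P m
pick P (inj₁ e) x y = subst P (sym e) x
pick P (inj₂ e) x y = subst P (sym e) y

ι : ℕ → ℚ
ι n = + n / 1

toℚᵘ-ι : ∀ n → toℚᵘ (ι n) ℚᵘ.≃ ℚᵘ.mkℚᵘ (+ n) 0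
toℚᵘ-ι n = toℚᵘ-fromℚᵘ (ℚᵘ.mkℚᵘ (+ n) 0)

ι-suc : ∀ n → ι (suc n) ≡ 1ℚ + ι n
ι-suc n = toℚᵘ-injective (ℚᵘ.≃-trans (toℚᵘ-ι (suc n)) (ℚᵘ.≃-sym
  (ℚᵘ.≃-trans (toℚᵘ-homo-+ 1ℚ (ι n))
  (ℚᵘ.≃-trans (ℚᵘ.+-congʳ (toℚᵘ 1ℚ) (toℚᵘ-ι n))
  (ℚᵘ.*≡* (cong (ℤ._* + 1) (cong (ℤ._+_ (+ 1)) (ℤ.*-identityʳ (+ n)))))))))

ι-nonNeg : ∀ n → 0ℚ ≤ ι n
ι-nonNeg zero = ≤-refl
ι-nonNeg (suc n) = subst (0ℚ ≤_) (sym (ι-suc n)) (+-nonNeg (<⇒≤ 0<1) (ι-nonNeg n))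

ι-suc-pos : ∀ n → 0ℚ < ι (suc n)
ι-suc-pos n = subst (0ℚ <_) (sym (ι-suc n)) (+-mono-<-≤ 0<1 (ι-nonNeg n))

1≤ι-suc : ∀ n → 1ℚ ≤ ι (suc n)
1≤ι-suc n = ≤-by (ι n) (ι-nonNeg n) (sym (ι-suc n))

ι-mono : ∀ {m n} → m ℕ.≤ n → ι m ≤ ι n
ι-mono {n = n} ℕ.z≤n = ι-nonNeg n
ι-mono {suc m} {suc n} (ℕ.s≤s h) =
  subst₂ _≤_ (sym (ι-suc m)) (sym (ι-suc n)) (+-monoʳ-≤ 1ℚ (ι-mono h))

archimedean : ∀ q → ∃ λ n → q < ι n
archimedean q@(mkℚ n d _) = suc ℤ.∣ n ∣ , toℚᵘ-cancel-<
  (ℚᵘ.<-respʳ-≃ (ℚᵘ.≃-sym (toℚᵘ-ι (suc ℤ.∣ n ∣))) (ℚᵘ.*<* (lemma n)))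
  where
  lemma : ∀ n → n ℤ.* + 1 ℤ.< + suc ℤ.∣ n ∣ ℤ.* + suc d
  lemma (+ n) = subst (ℤ._< + suc n ℤ.* + suc d) (sym (ℤ.*-identityʳ (+ n)))
    (ℤ.+<+ (ℕ.m≤m*n (suc n) (suc d)))
  lemma -[1+ n ] = ℤ.-<+

-- q / N with N = k + 1, avoiding side conditions on the denominator.
_÷suc_ : ℚ → ℕ → ℚ
q ÷suc k = q * (+ 1 / suc k)

infixl 7 _÷suc_

1÷suc*ι : ∀ k → (+ 1 / suc k) * ι (suc k) ≡ 1ℚ
1÷suc*ι k = toℚᵘ-injective (ℚᵘ.≃-trans (toℚᵘ-homo-* (+ 1 / suc k) (ι (suc k)))
  (ℚᵘ.≃-trans (ℚᵘ.*-cong (toℚᵘ-fromℚᵘ (ℚᵘ.mkℚᵘ (+ 1) k)) (toℚᵘ-ι (suc k)))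
  (ℚᵘ.*≡* (trans (ℤ.*-identityʳ _) (trans (ℤ.*-identityˡ (+ suc k))
    (sym (trans (ℤ.*-identityˡ _) (cong (λ z → + suc z) (ℕ.*-identityʳ k)))))))))

÷suc-*ι : ∀ q k → (q ÷suc k) * ι (suc k) ≡ q
÷suc-*ι q k = trans (*-assoc q _ _) (trans (cong (q *_) (1÷suc*ι k)) (*-identityʳ q))

*ι-÷suc : ∀ q k → (q * ι (suc k)) ÷suc k ≡ q
*ι-÷suc q k = trans (*-assoc q _ _)
  (trans (cong (q *_) (trans (*-comm (ι (suc k)) (+ 1 / suc k)) (1÷suc*ι k))) (*-identityʳ q))

1÷suc-pos : ∀ k → 0ℚ < + 1 / suc k
1÷suc-pos k = positive⁻¹ (+ 1 / suc k) {{normalize-pos 1 (suc k)}}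

^-pos : ∀ {p} → 0ℚ < p → ∀ n → 0ℚ < p ^ n
^-pos 0<p zero = 0<1
^-pos 0<p (suc n) = *-pos 0<p (^-pos 0<p n)

^-nonNeg : ∀ {p} → 0ℚ ≤ p → ∀ n → 0ℚ ≤ p ^ n
^-nonNeg 0≤p zero = <⇒≤ 0<1
^-nonNeg 0≤p (suc n) = *-nonNeg 0≤p (^-nonNeg 0≤p n)

^-monoˡ : ∀ {p q} → 0ℚ ≤ p → p ≤ q → ∀ n → p ^ n ≤ q ^ n
^-monoˡ 0≤p p≤q zero = ≤-refl
^-monoˡ 0≤p p≤q (suc n) = *-mono-≤′ 0≤p p≤q (^-nonNeg 0≤p n) (^-monoˡ 0≤p p≤q n)

1^n : ∀ n → 1ℚ ^ n ≡ 1ℚ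
1^n zero = refl
1^n (suc n) = trans (*-identityˡ _) (1^n n)

^-≤1 : ∀ {p} → 0ℚ ≤ p → p ≤ 1ℚ → ∀ n → p ^ n ≤ 1ℚ
^-≤1 {p} 0≤p p≤1 n = subst (p ^ n ≤_) (1^n n) (^-monoˡ 0≤p p≤1 n)

bernoulli : ∀ {t} → 0ℚ ≤ 1ℚ + t → ∀ n → 1ℚ + ι n * t ≤ (1ℚ + t) ^ n
bernoulli {t} h zero = ≤-reflexive (solve 1 (λ t → con 1ℚ :+ con 0ℚ :* t := con 1ℚ) refl t)
bernoulli {t} h (suc n) = ≤-trans
  (≤-by (ι n * (t * t)) (*-nonNeg (ι-nonNeg n) (sq-nonNeg t))
    (trans (cong (λ z → 1ℚ + z * t + ι n * (t * t)) (ι-suc n))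
      (solve 2 (λ n t → con 1ℚ :+ (con 1ℚ :+ n) :* t :+ n :* (t :* t)
                          := (con 1ℚ :+ t) :* (con 1ℚ :+ n :* t)) refl (ι n) t)))
  (*-monoˡ-≤′ h (bernoulli h n))

-- Continuity of c ↦ c ^ n from the left.
^-shrink : ∀ {c u} k → 0ℚ < c → u < c ^ suc k → ∃ λ d → 0ℚ < d × d < c × u < d ^ suc k
^-shrink {c} {u} k 0<c u<P =
  d , *-pos 0<c 0<1-e/N
    , subst (d <_) (*-identityʳ c) (*-monoˡ-<′ 0<c
        (0<-⇒< (subst (0ℚ <_) (solve 1 (λ x → x := con 1ℚ :- (con 1ℚ :- x)) refl (e ÷suc k)) 0<e/N)))
    , ≤-<-trans u≤m (<-≤-trans m<Pf Pf≤)
  where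
  N = suc k
  P = c ^ N
  0<P = ^-pos 0<c N
  m = proj₁ (ub₂ u 0ℚ)
  u≤m = proj₁ (proj₂ (ub₂ u 0ℚ))
  m<P : m < P
  m<P = pick (_< P) (proj₂ (proj₂ (proj₂ (ub₂ u 0ℚ)))) u<P 0<P
  i = proj₁ (reciprocal 0<P)
  0<i = proj₁ (proj₂ (reciprocal 0<P))
  Pi≡1 = proj₂ (proj₂ (reciprocal 0<P))
  mi<1 : m * i < 1ℚ
  mi<1 = subst (m * i <_) Pi≡1 (*-monoʳ-<′ 0<i m<P)
  f = proj₁ (<-dense mi<1)
  mi<f = proj₁ (proj₂ (<-dense mi<1))
  f<1 = proj₂ (proj₂ (<-dense mi<1))
  0<f : 0ℚ < f
  0<f = ≤-<-trans (*-nonNeg (proj₁ (proj₂ (proj₂ (ub₂ u 0ℚ)))) (<⇒≤ 0<i)) mi<f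
  e = 1ℚ - f
  0<e = <⇒0<- f<1
  0<e/N : 0ℚ < e ÷suc k
  0<e/N = *-pos 0<e (1÷suc-pos k)
  e/N≤e : e ÷suc k ≤ e
  e/N≤e = subst₂ _≤_ (*-identityʳ _) (÷suc-*ι e k) (*-monoˡ-≤′ (<⇒≤ 0<e/N) (1≤ι-suc k))
  e<1 : e < 1ℚ
  e<1 = <-by f 0<f (solve 1 (λ f → con 1ℚ :- f :+ f := con 1ℚ) refl f)
  0<1-e/N : 0ℚ < 1ℚ - e ÷suc k
  0<1-e/N = <⇒0<- (≤-<-trans e/N≤e e<1)
  d = c * (1ℚ - e ÷suc k)
  m<Pf : m < P * f
  m<Pf = subst (_< P * f)
    (trans (solve 3 (λ P m i → P :* (m :* i) := m :* (P :* i)) refl P m i)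
      (trans (cong (m *_) Pi≡1) (*-identityʳ m)))
    (*-monoˡ-<′ 0<P mi<f)
  f≤ : f ≤ (1ℚ - e ÷suc k) ^ N
  f≤ = subst (_≤ (1ℚ - e ÷suc k) ^ N)
    (trans (solve 2 (λ n x → con 1ℚ :+ n :* (:- x) := con 1ℚ :- x :* n) refl (ι N) (e ÷suc k))
      (trans (cong (λ z → 1ℚ - z) (÷suc-*ι e k))
        (solve 1 (λ f → con 1ℚ :- (con 1ℚ :- f) := f) refl f)))
    (bernoulli (<⇒≤ 0<1-e/N) N)
  Pf≤ : P * f ≤ d ^ N
  Pf≤ = subst (P * f ≤_) (sym (^-distrib-* c (1ℚ - e ÷suc k) N)) (*-monoˡ-≤′ (<⇒≤ 0<P) f≤)

-- Two-sided located Dedekind cuts.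
record ℝ : Set₁ where
  field
    L U      : ℚ → Set
    L-inhab  : ∃ L
    U-inhab  : ∃ U
    L-closed : ∀ {q r} → q < r → L r → L q
    U-closed : ∀ {q r} → q < r → U q → U r
    L-open   : ∀ {q} → L q → ∃ λ r → q < r × L r
    U-open   : ∀ {r} → U r → ∃ λ q → q < r × U q
    disjoint : ∀ {q} → L q → U q → ⊥
    located  : ∀ {q r} → q < r → L q ⊎ U r

open ℝ

infix 4 _<ℝ_ _≤ℝ_ _≥ℝ_

_<ℝ_ : ℝ → ℝ → Set
x <ℝ y = ∃ λ q → U x q × L y q

_≤ℝ_ : ℝ → ℝ → Set
x ≤ℝ y = ∀ q → L x q → L y q

_≥ℝ_ : ℝ → ℝ → Set
x ≥ℝ y = y ≤ℝ x

L<U : ∀ (x : ℝ) {q r} → L x q → U x r → q < r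
L<U x {q} {r} lq ur with q <? r
... | yes q<r = q<r
... | no q≮r with ≤⇒<⊎≡ (≮⇒≥ q≮r)
  where
  ≤⇒<⊎≡ : ∀ {p q} → p ≤ q → p < q ⊎ p ≡ q
  ≤⇒<⊎≡ {p} {q} p≤q with p <? q
  ... | yes p<q = inj₁ p<q
  ... | no p≮q = inj₂ (≤-antisym p≤q (≮⇒≥ p≮q))
... | inj₁ r<q = ⊥-elim (disjoint x lq (U-closed x r<q ur))
... | inj₂ refl = ⊥-elim (disjoint x lq ur)

<ℝ-trans : ∀ x y z → x <ℝ y → y <ℝ z → x <ℝ z
<ℝ-trans x y z (q , uxq , lyq) (r , uyr , lzr) = r , U-closed x (L<U y lyq uyr) uxq , lzr

<ℝ-irrefl : ∀ x y → x <ℝ y → y <ℝ x → ⊥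
<ℝ-irrefl x y (q , uxq , lyq) (r , uyr , lxr) =
  <-asym (L<U y lyq uyr) (L<U x lxr uxq)

fromℚ : ℚ → ℝ
fromℚ p = record
  { L        = _< p
  ; U        = p <_
  ; L-inhab  = p - 1ℚ , -1-bound p
  ; U-inhab  = p + 1ℚ , +1-bound p
  ; L-closed = <-trans
  ; U-closed = λ q<r p<q → <-trans p<q q<r
  ; L-open   = <-dense
  ; U-open   = λ p<r → let (q , p<q , q<r) = <-dense p<r in q , q<r , p<q
  ; disjoint = <-asym
  ; located  = loc
  }
  where
  loc : ∀ {q r} → q < r → q < p ⊎ p < r
  loc {q} q<r with q <? p
  ... | yes q<p = inj₁ q<p
  ... | no q≮p = inj₂ (≤-<-trans (≮⇒≥ q≮p) q<r)

fromℕ : ℕ → ℝ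
fromℕ n = fromℚ (ι n)

0ℝ : ℝ
0ℝ = fromℚ 0ℚ

approx : ∀ (x : ℝ) {ε} → 0ℚ < ε → ∃ λ a → ∃ λ b → L x a × U x b × b < a + ε
approx x {ε} 0<ε = search n a la (subst (b <_) (+-comm (ι n * δ) a) b<)
  where
  a = proj₁ (L-inhab x)
  la = proj₂ (L-inhab x)
  b = proj₁ (U-inhab x)
  ub = proj₂ (U-inhab x)
  δ,3 = <-dense 0<ε
  δ = proj₁ δ,3
  0<δ = proj₁ (proj₂ δ,3)
  δ<ε = proj₂ (proj₂ δ,3)
  γ,3 = <-dense 0<δ
  γ = proj₁ γ,3
  0<γ = proj₁ (proj₂ γ,3)
  γ<δ = proj₂ (proj₂ γ,3)
  i = proj₁ (reciprocal 0<δ)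
  iδ = proj₂ (proj₂ (reciprocal 0<δ))
  0<i = proj₁ (proj₂ (reciprocal 0<δ))
  n = proj₁ (archimedean ((b - a) * i))
  b< : b < ι n * δ + a
  b< = subst (_< ι n * δ + a)
    (trans (cong (_+ a) (trans (solve 3 (λ h i d → h :* i :* d := h :* (d :* i)) refl (b - a) i δ)
      (trans (cong ((b - a) *_) iδ) (*-identityʳ (b - a)))))
      (solve 2 (λ a b → b :- a :+ a := b) refl a b))
    (+-monoˡ-< a (*-monoʳ-<′ 0<δ (proj₂ (archimedean ((b - a) * i)))))
  search : ∀ n a → L x a → b < a + ι n * δ → ∃ λ a → ∃ λ b → L x a × U x b × b < a + ε
  search zero a la h = ⊥-elim (<-asym (L<U x la ub)
    (subst (b <_) (solve 2 (λ a d → a :+ con 0ℚ :* d := a) refl a δ) h))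
  search (suc n) a la h with located x (+-monoʳ-< a γ<δ)
  ... | inj₂ u = a , a + δ , la , u , +-monoʳ-< a δ<ε
  ... | inj₁ l with located x (+-monoʳ-< a δ<ε)
  ...   | inj₂ u = a + γ , a + ε , l , u ,
          <-by γ 0<γ (solve 3 (λ a e g → a :+ e :+ g := a :+ g :+ e) refl a ε γ)
  ...   | inj₁ l′ = search n (a + δ) l′ (subst (b <_)
            (trans (cong (λ z → a + z * δ) (ι-suc n))
              (solve 3 (λ a n d → a :+ (con 1ℚ :+ n) :* d := (a :+ d) :+ n :* d) refl a (ι n) δ)) h)

-- contʳ and contˡ: a strict rational bound on f q persists slightly to the
-- right, respectively to the left, of q.
record Increasing (f : ℚ → ℝ) : Set where
  field
    mono   : ∀ {q r} → q < r → f q <ℝ f r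
    contʳ  : ∀ {q b} → U (f q) b → ∃ λ r → q < r × U (f r) b
    contˡ  : ∀ {q b} → L (f q) b → ∃ λ r → r < q × L (f r) b

-- The real y with f y = x: q < y iff f q < x, and y < q iff x < f q.
inverse : (f : ℚ → ℝ) → Increasing f → (x : ℝ) →
          (∃ λ q → f q <ℝ x) → (∃ λ q → x <ℝ f q) → ℝ
inverse f inc x below above = record
  { L        = λ q → f q <ℝ x
  ; U        = λ q → x <ℝ f q
  ; L-inhab  = below
  ; U-inhab  = above
  ; L-closed = λ {q} {r} q<r h → <ℝ-trans (f q) (f r) x (mono q<r) h
  ; U-closed = λ {q} {r} q<r h → <ℝ-trans x (f q) (f r) h (mono q<r)
  ; L-open   = λ (b , u , l) → let (r , q<r , u′) = contʳ u in r , q<r , b , u′ , l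
  ; U-open   = λ (b , u , l) → let (r , r<q , l′) = contˡ l in r , r<q , b , u , l′
  ; disjoint = λ {q} → <ℝ-irrefl (f q) x
  ; located  = λ {q} {r} q<r → loc q r (mono q<r)
  }
  where
  open Increasing inc
  loc : ∀ q r → f q <ℝ f r → f q <ℝ x ⊎ x <ℝ f r
  loc q r (b , u , l) with U-open (f q) u
  ... | (a , a<b , u′) with located x a<b
  ...   | inj₁ lx = inj₁ (a , u′ , lx)
  ...   | inj₂ ux = inj₂ (b , ux , l)

archimedean-suc : ∀ q → ∃ λ k → q < ι (suc k)
archimedean-suc q = let (n , h) = archimedean q in n , <-≤-trans h (ι-mono (ℕ.n≤1+n n))

0<1+÷suc : ∀ q k → ∣ q ∣ < ι (suc k) → 0ℚ < 1ℚ + q ÷suc k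
0<1+÷suc q k h = *-cancelʳ-<′ (ι (suc k)) (ι-nonNeg (suc k))
  (subst₂ _<_ (sym (*-zeroˡ (ι (suc k)))) eq
    (≤-<-trans (subst (_≤ q + ∣ q ∣) (+-inverseʳ q) (+-monoʳ-≤ q (-≤∣∣ q))) (+-monoʳ-< q h)))
  where
  eq : q + ι (suc k) ≡ (1ℚ + q ÷suc k) * ι (suc k)
  eq = trans (cong (_+ ι (suc k)) (sym (÷suc-*ι q k)))
    (solve 2 (λ t n → t :* n :+ n := (con 1ℚ :+ t) :* n) refl (q ÷suc k) (ι (suc k)))

0<1-÷suc : ∀ q k → ∣ q ∣ < ι (suc k) → 0ℚ < 1ℚ - q ÷suc k
0<1-÷suc q k h = subst (λ z → 0ℚ < 1ℚ + z) (sym (neg-distribˡ-* q (+ 1 / suc k)))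
  (0<1+÷suc (- q) k (subst (_< ι (suc k)) (sym (∣-p∣≡∣p∣ q)) h))

0≤1+ : ∀ k s → 0ℚ ≤ 1ℚ + ι (suc k) * s → 0ℚ ≤ 1ℚ + s
0≤1+ k s h with ≤-total 0ℚ s
... | inj₁ 0≤s = +-nonNeg (<⇒≤ 0<1) 0≤s
... | inj₂ s≤0 = ≤-trans h (+-monoʳ-≤ 1ℚ (subst₂ _≤_ (*-comm s (ι (suc k))) (*-identityʳ s)
  (*-monoˡ-≤-nonPos s {{nonPositive s≤0}} (1≤ι-suc k))))

exp-bounds : ∀ q k l → 0ℚ < 1ℚ + q ÷suc k → 0ℚ < 1ℚ - q ÷suc l →
             (1ℚ + q ÷suc k) ^ suc k * (1ℚ - q ÷suc l) ^ suc l ≤ 1ℚ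
exp-bounds q k l h₁ h₂ = ≤-trans
  (*-mono-≤′ (^-nonNeg (<⇒≤ h₁) M) (power s l k (1ℚ + q ÷suc k) e₁ h₁)
             (^-nonNeg (<⇒≤ h₂) N) (power (- s) k l (1ℚ - q ÷suc l) e₂ h₂))
  (subst (_≤ 1ℚ) eq (^-≤1 (*-nonNeg 0≤1+s 0≤1-s) base≤1 (N ℕ.* M)))
  where
  M = suc k
  N = suc l
  s = q ÷suc k ÷suc l
  e₁ : 1ℚ + ι N * s ≡ 1ℚ + q ÷suc k
  e₁ = cong (λ z → 1ℚ + z) (trans (*-comm (ι N) s) (÷suc-*ι (q ÷suc k) l))
  e₂ : 1ℚ + ι M * (- s) ≡ 1ℚ - q ÷suc l
  e₂ = cong (λ z → 1ℚ + z) (trans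
    (solve 4 (λ m q x y → m :* (:- (q :* x :* y)) := :- (q :* y :* (x :* m))) refl
      (ι M) q (+ 1 / M) (+ 1 / N))
    (cong -_ (trans (cong (q ÷suc l *_) (1÷suc*ι k)) (*-identityʳ (q ÷suc l)))))
  0≤1+s = 0≤1+ l s (subst (0ℚ ≤_) (sym e₁) (<⇒≤ h₁))
  0≤1-s = 0≤1+ k (- s) (subst (0ℚ ≤_) (sym e₂) (<⇒≤ h₂))
  power : ∀ s l k p → 1ℚ + ι (suc l) * s ≡ p → 0ℚ < p → p ^ suc k ≤ (1ℚ + s) ^ (suc l ℕ.* suc k)
  power s l k _ refl h = subst ((1ℚ + ι (suc l) * s) ^ suc k ≤_) (^-assocʳ (1ℚ + s) (suc l) (suc k))
    (^-monoˡ (<⇒≤ h) (bernoulli (0≤1+ l s (<⇒≤ h)) (suc l)) (suc k))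
  base≤1 : (1ℚ + s) * (1ℚ - s) ≤ 1ℚ
  base≤1 = ≤-by (s * s) (sq-nonNeg s)
    (solve 1 (λ s → (con 1ℚ :+ s) :* (con 1ℚ :- s) :+ s :* s := con 1ℚ) refl s)
  eq : ((1ℚ + s) * (1ℚ - s)) ^ (N ℕ.* M) ≡ (1ℚ + s) ^ (N ℕ.* M) * (1ℚ - s) ^ (M ℕ.* N)
  eq = trans (^-distrib-* (1ℚ + s) (1ℚ - s) (N ℕ.* M))
    (cong (λ z → (1ℚ + s) ^ (N ℕ.* M) * (1ℚ - s) ^ z) (ℕ.*-comm N M))

exp-dichotomy : ∀ t n a b → 0ℚ < 1ℚ + t → 0ℚ < 1ℚ - t → 0ℚ < b →
                a < b * (1ℚ - ι n * (t * t)) → a < (1ℚ + t) ^ n ⊎ 1ℚ < b * (1ℚ - t) ^ n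
exp-dichotomy t n a b 0<1+t 0<1-t 0<b a< with a <? (1ℚ + t) ^ n
... | yes a<P = inj₁ a<P
... | no a≮P = inj₂ (*-cancelʳ-<′ P (<⇒≤ (^-pos 0<1+t n))
    (subst₂ _<_ (sym (*-identityˡ P))
      (solve 3 (λ b P Q → b :* (P :* Q) := b :* Q :* P) refl b P Q)
      (≤-<-trans (≮⇒≥ a≮P) (<-≤-trans a< (*-monoˡ-≤′ (<⇒≤ 0<b) 1-t²≥)))))
  where
  P = (1ℚ + t) ^ n
  Q = (1ℚ - t) ^ n
  eq : (1ℚ + t) * (1ℚ - t) ≡ 1ℚ + - (t * t)
  eq = solve 1 (λ t → (con 1ℚ :+ t) :* (con 1ℚ :- t) := con 1ℚ :+ :- (t :* t)) refl t
  1-t²≥ : 1ℚ - ι n * (t * t) ≤ P * Q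
  1-t²≥ = subst₂ _≤_
    (solve 2 (λ n x → con 1ℚ :+ n :* (:- x) := con 1ℚ :- n :* x) refl (ι n) (t * t))
    (trans (cong (_^ n) (sym eq)) (^-distrib-* (1ℚ + t) (1ℚ - t) n))
    (bernoulli (subst (0ℚ ≤_) eq (*-nonNeg (<⇒≤ 0<1+t) (<⇒≤ 0<1-t))) n)

-- e^q is the common limit of the increasing sequence (1 + q/N)^N and the
-- decreasing sequence (1 - q/N)^(-N), over N > |q|.
exp-L exp-U : ℚ → ℚ → Set
exp-L q r = ∃ λ k → 0ℚ < 1ℚ + q ÷suc k × r < (1ℚ + q ÷suc k) ^ suc k
exp-U q r = ∃ λ k → 0ℚ < 1ℚ - q ÷suc k × 1ℚ < r * (1ℚ - q ÷suc k) ^ suc k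

exp-above : ∀ q k → 0ℚ < 1ℚ - q ÷suc k →
        ∃ (exp-U q)
exp-above q k h = i + 1ℚ , k , h , <-by Q 0<Q (trans (cong (_+ Q) (sym Qi))
    (solve 2 (λ Q i → Q :* i :+ Q := (i :+ con 1ℚ) :* Q) refl Q i))
  where
  Q = (1ℚ - q ÷suc k) ^ suc k
  0<Q = ^-pos h (suc k)
  i = proj₁ (reciprocal 0<Q)
  Qi = proj₂ (proj₂ (reciprocal 0<Q))
exp-open-U : ∀ q {r} k → 0ℚ < 1ℚ - q ÷suc k → 1ℚ < r * (1ℚ - q ÷suc k) ^ suc k →
         ∃ λ s → s < r × exp-U q s
exp-open-U q {r} k h u = s , s<r , k , h , subst (_< s * Q) iQ (*-monoʳ-<′ 0<Q i<s)
  where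
  Q = (1ℚ - q ÷suc k) ^ suc k
  0<Q = ^-pos h (suc k)
  i = proj₁ (reciprocal 0<Q)
  iQ : i * Q ≡ 1ℚ
  iQ = trans (*-comm i Q) (proj₂ (proj₂ (reciprocal 0<Q)))
  i<r : i < r
  i<r = *-cancelʳ-<′ Q (<⇒≤ 0<Q) (subst (_< r * Q) (sym iQ) u)
  s = proj₁ (<-dense i<r)
  i<s = proj₁ (proj₂ (<-dense i<r))
  s<r = proj₂ (proj₂ (<-dense i<r))
exp-gap : ∀ {n q t a b c} → t * n ≡ q → (b - a) * c ≡ 1ℚ → 0ℚ ≤ n → a < b →
          b * (q * q) * c < n → a < b * (1ℚ - n * (t * t))
exp-gap {n} {q} {t} {a} {b} {c} refl dc 0≤n a<b w<n =
  *-cancelʳ-<′ n 0≤n (0<-⇒< (subst (0ℚ <_)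
    (solve 4 (λ n a b t → n :* (b :- a) :- b :* ((t :* n) :* (t :* n))
      := b :* (con 1ℚ :- n :* (t :* t)) :* n :- a :* n) refl n a b t)
    (<⇒0<- bqq<)))
  where
  bqq< : b * (q * q) < n * (b - a)
  bqq< = subst (_< n * (b - a))
    (trans (solve 3 (λ x c d → x :* c :* d := x :* (d :* c)) refl (b * (q * q)) c (b - a))
      (trans (cong (λ z → b * (q * q) * z) dc) (*-identityʳ (b * (q * q)))))
    (*-monoʳ-<′ (<⇒0<- a<b) w<n)

exp-located : ∀ q {a b} → a < b → exp-L q a ⊎ exp-U q b
exp-located q {a} {b} a<b with a ≤? 0ℚ
... | yes a≤0 = near-0 (archimedean-suc ∣ q ∣)
  where
  near-0 : (∃ λ k → ∣ q ∣ < ι (suc k)) → exp-L q a ⊎ exp-U q b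
  near-0 (k , h) = inj₁ (k , 0<1+÷suc q k h , ≤-<-trans a≤0 (^-pos (0<1+÷suc q k h) (suc k)))
... | no a≰0 = choose (reciprocal (<⇒0<- a<b))
  where
  0<b : 0ℚ < b
  0<b = <-trans (≰⇒> a≰0) a<b
  decide : ∀ k c → (b - a) * c ≡ 1ℚ → ∣ q ∣ < ι (suc k) →
           b * (q * q) * c < ι (suc k) → exp-L q a ⊎ exp-U q b
  decide k c dc |q|<N w<N = answer
    (exp-dichotomy (q ÷suc k) (suc k) a b h₁ h₂ 0<b
      (exp-gap {t = q ÷suc k} (÷suc-*ι q k) dc (ι-nonNeg (suc k)) a<b w<N))
    where
    h₁ = 0<1+÷suc q k |q|<N
    h₂ = 0<1-÷suc q k |q|<N
    answer : a < (1ℚ + q ÷suc k) ^ suc k ⊎ 1ℚ < b * (1ℚ - q ÷suc k) ^ suc k →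
             exp-L q a ⊎ exp-U q b
    answer (inj₁ h) = inj₁ (k , h₁ , h)
    answer (inj₂ h) = inj₂ (k , h₂ , h)
  choose : (∃ λ c → 0ℚ < c × (b - a) * c ≡ 1ℚ) → exp-L q a ⊎ exp-U q b
  choose (c , 0<c , dc) = large w 0≤w refl (archimedean-suc (∣ q ∣ + w))
    where
    w = b * (q * q) * c
    0≤w : 0ℚ ≤ w
    0≤w = *-nonNeg (*-nonNeg (<⇒≤ 0<b) (sq-nonNeg q)) (<⇒≤ 0<c)
    large : ∀ w → 0ℚ ≤ w → w ≡ b * (q * q) * c →
            (∃ λ k → ∣ q ∣ + w < ι (suc k)) → exp-L q a ⊎ exp-U q b
    large w 0≤w e (k , h) = decide k c dc
      (≤-<-trans (≤-by w 0≤w refl) h)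
      (subst (_< ι (suc k)) e (≤-<-trans (≤-by ∣ q ∣ (0≤∣p∣ q) (+-comm w ∣ q ∣)) h))

exp : ℚ → ℝ
exp q = record
  { L        = exp-L q
  ; U        = exp-U q
  ; L-inhab  = let (k , h) = archimedean-suc ∣ q ∣
               in 0ℚ , k , 0<1+÷suc q k h , ^-pos (0<1+÷suc q k h) (suc k)
  ; U-inhab  = let (k , h) = archimedean-suc ∣ q ∣ in exp-above q k (0<1-÷suc q k h)
  ; L-closed = λ q<r (k , h , l) → k , h , <-trans q<r l
  ; U-closed = λ q<r (k , h , u) → k , h , <-trans u (*-monoʳ-<′ (^-pos h (suc k)) q<r)
  ; L-open   = λ (k , h , l) → let (r , q<r , l′) = <-dense l in r , q<r , k , h , l′
  ; U-open   = λ (k , h , u) → exp-open-U q k h u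
  ; disjoint = λ {r} (k , h , l) (m , h′ , u) →
      <-irrefl refl (<-trans u (<-≤-trans (*-monoʳ-<′ (^-pos h′ (suc m)) l)
        (exp-bounds q k m h h′)))
  ; located  = exp-located q
  }

exp-product : ∀ u v n → 0ℚ ≤ v - u - u * v →
              1ℚ + ι n * (v - u - u * v) ≤ (1ℚ + v) ^ n * (1ℚ - u) ^ n
exp-product u v n 0≤x = subst (1ℚ + ι n * (v - u - u * v) ≤_)
  (trans (cong (_^ n) (solve 2 (λ u v → con 1ℚ :+ (v :- u :- u :* v)
      := (con 1ℚ :+ v) :* (con 1ℚ :- u)) refl u v))
    (^-distrib-* (1ℚ + v) (1ℚ - u) n))
  (bernoulli (+-nonNeg (<⇒≤ 0<1) 0≤x) n)

exp-slope : ∀ {n q r t v} → t * n ≡ q → v * n ≡ r → 0ℚ ≤ n → q * r < n * (r - q) →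
            0ℚ < v - t - t * v
exp-slope {n} {t = t} {v} refl refl 0≤n h = *-cancelʳ-<′ (n * n) (*-nonNeg 0≤n 0≤n)
  (subst₂ _<_ (sym (*-zeroˡ (n * n)))
    (solve 3 (λ n u v → n :* (v :* n :- u :* n) :- (u :* n) :* (v :* n)
        := (v :- u :- u :* v) :* (n :* n)) refl n t v)
    (<⇒0<- h))

exp-mono : ∀ {q r} → q < r → exp q <ℝ exp r
exp-mono {q} {r} q<r = choose (reciprocal (<⇒0<- q<r))
  where
  with-reciprocal : ∀ k → 0ℚ < 1ℚ - q ÷suc k → 0ℚ < 1ℚ + r ÷suc k → ∀ P Q →
    Q ≡ (1ℚ - q ÷suc k) ^ suc k → P ≡ (1ℚ + r ÷suc k) ^ suc k → 0ℚ < Q → 1ℚ < P * Q →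
    (∃ λ i → 0ℚ < i × Q * i ≡ 1ℚ) → exp q <ℝ exp r
  with-reciprocal k h₁ h₂ P Q eQ eP 0<Q 1<PQ (i , 0<i , Qi) = between (<-dense i<P)
    where
    iQ : i * Q ≡ 1ℚ
    iQ = trans (*-comm i Q) Qi
    i<P : i < P
    i<P = *-cancelʳ-<′ Q (<⇒≤ 0<Q) (subst (_< P * Q) (sym iQ) 1<PQ)
    between : (∃ λ a → i < a × a < P) → exp q <ℝ exp r
    between (a , i<a , a<P) =
      a , (k , h₁ , subst (λ z → 1ℚ < a * z) eQ (subst (_< a * Q) iQ (*-monoʳ-<′ 0<Q i<a)))
        , (k , h₂ , subst (a <_) eP a<P)
  large : ∀ c w → 0ℚ ≤ w → (r - q) * c ≡ 1ℚ → w ≡ ∣ q * r ∣ * c →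
          (∃ λ k → ∣ q ∣ + ∣ r ∣ + w < ι (suc k)) → exp q <ℝ exp r
  large c w 0≤w dc w≡ (k , h) =
    with-reciprocal k h₁ h₂ ((1ℚ + v) ^ suc k) ((1ℚ - u) ^ suc k) refl refl (^-pos h₁ (suc k))
      (<-≤-trans (<-by (N * (v - u - u * v)) (*-pos (ι-suc-pos k) 0<x) refl)
        (exp-product u v (suc k) (<⇒≤ 0<x)))
      (reciprocal (^-pos h₁ (suc k)))
    where
    N = ι (suc k)
    u = q ÷suc k
    v = r ÷suc k
    w<N : w < N
    w<N = ≤-<-trans (≤-by (∣ q ∣ + ∣ r ∣) (+-nonNeg (0≤∣p∣ q) (0≤∣p∣ r)) (+-comm w (∣ q ∣ + ∣ r ∣))) h
    |q|<N : ∣ q ∣ < N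
    |q|<N = ≤-<-trans (≤-by (∣ r ∣ + w) (+-nonNeg (0≤∣p∣ r) 0≤w) (sym (+-assoc ∣ q ∣ ∣ r ∣ w))) h
    |r|<N : ∣ r ∣ < N
    |r|<N = ≤-<-trans (≤-by (∣ q ∣ + w) (+-nonNeg (0≤∣p∣ q) 0≤w)
      (solve 3 (λ q r w → r :+ (q :+ w) := q :+ r :+ w) refl ∣ q ∣ ∣ r ∣ w)) h
    h₁ = 0<1-÷suc q k |q|<N
    h₂ = 0<1+÷suc r k |r|<N
    qr< : q * r < N * (r - q)
    qr< = ≤-<-trans (≤∣∣ (q * r)) (subst (_< N * (r - q))
      (trans (cong (_* (r - q)) w≡)
        (trans (solve 3 (λ x c d → x :* c :* d := x :* (d :* c)) refl ∣ q * r ∣ c (r - q))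
          (trans (cong (λ z → ∣ q * r ∣ * z) dc) (*-identityʳ ∣ q * r ∣))))
      (*-monoʳ-<′ (<⇒0<- q<r) w<N))
    0<x : 0ℚ < v - u - u * v
    0<x = exp-slope {t = u} {v} (÷suc-*ι q k) (÷suc-*ι r k) (ι-nonNeg (suc k)) qr<
  choose : (∃ λ c → 0ℚ < c × (r - q) * c ≡ 1ℚ) → exp q <ℝ exp r
  choose (c , 0<c , dc) = large c (∣ q * r ∣ * c) (*-nonNeg (0≤∣p∣ (q * r)) (<⇒≤ 0<c)) dc refl
    (archimedean-suc (∣ q ∣ + ∣ r ∣ + ∣ q * r ∣ * c))

exp-contʳ : ∀ {q b} → U (exp q) b → ∃ λ r → q < r × U (exp r) b
exp-contʳ {q} {b} (k , h , u) =
  r , q<r , k , subst (0ℚ <_) d≡ 0<d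
    , subst (λ z → 1ℚ < b * z ^ suc k) d≡ (subst (_< b * d ^ suc k) bi (*-monoˡ-<′ 0<b i<))
  where
  Q = (1ℚ - q ÷suc k) ^ suc k
  0<Q = ^-pos h (suc k)
  0<b : 0ℚ < b
  0<b = *-cancelʳ-<′ Q (<⇒≤ 0<Q) (subst (_< b * Q) (sym (*-zeroˡ Q)) (<-trans 0<1 u))
  i = proj₁ (reciprocal 0<b)
  bi = proj₂ (proj₂ (reciprocal 0<b))
  i<Q : i < Q
  i<Q = *-cancelʳ-<′ b (<⇒≤ 0<b) (subst₂ _<_ (trans (sym bi) (*-comm b i)) (*-comm b Q) u)
  shrunk = ^-shrink k h i<Q
  d = proj₁ shrunk
  0<d = proj₁ (proj₂ shrunk)
  d<c = proj₁ (proj₂ (proj₂ shrunk))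
  i< = proj₂ (proj₂ (proj₂ shrunk))
  r = (1ℚ - d) * ι (suc k)
  d≡ : d ≡ 1ℚ - r ÷suc k
  d≡ = trans (solve 1 (λ d → d := con 1ℚ :- (con 1ℚ :- d)) refl d)
    (cong (λ z → 1ℚ - z) (sym (*ι-÷suc (1ℚ - d) k)))
  q<r : q < r
  q<r = subst (_< r) (÷suc-*ι q k) (*-monoʳ-<′ (ι-suc-pos k) t<1-d)
    where
    t<1-d : q ÷suc k < 1ℚ - d
    t<1-d = 0<-⇒< (subst (0ℚ <_)
      (solve 2 (λ t d → con 1ℚ :- t :- d := con 1ℚ :- d :- t) refl (q ÷suc k) d) (<⇒0<- d<c))

exp-contˡ : ∀ {q b} → L (exp q) b → ∃ λ r → r < q × L (exp r) b
exp-contˡ {q} {b} (k , h , l) =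
  r , r<q , k , subst (0ℚ <_) d≡ 0<d , subst (λ z → b < z ^ suc k) d≡ b<
  where
  shrunk = ^-shrink k h l
  d = proj₁ shrunk
  0<d = proj₁ (proj₂ shrunk)
  d<c = proj₁ (proj₂ (proj₂ shrunk))
  b< = proj₂ (proj₂ (proj₂ shrunk))
  r = (d - 1ℚ) * ι (suc k)
  d≡ : d ≡ 1ℚ + r ÷suc k
  d≡ = trans (solve 1 (λ d → d := con 1ℚ :+ (d :- con 1ℚ)) refl d)
    (cong (λ z → 1ℚ + z) (sym (*ι-÷suc (d - 1ℚ) k)))
  r<q : r < q
  r<q = subst (r <_) (÷suc-*ι q k) (*-monoʳ-<′ (ι-suc-pos k) d-1<t)
    where
    d-1<t : d - 1ℚ < q ÷suc k
    d-1<t = 0<-⇒< (subst (0ℚ <_)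
      (solve 2 (λ t d → con 1ℚ :+ t :- d := t :- (d :- con 1ℚ)) refl (q ÷suc k) d) (<⇒0<- d<c))

exp-increasing : Increasing exp
exp-increasing = record { mono = exp-mono ; contʳ = λ {q} {b} → exp-contʳ {q} {b}
  ; contˡ = λ {q} {b} → exp-contˡ {q} {b} }

-- Natural logarithm: q < log x iff e^q < x.
log : (x : ℝ) → 0ℝ <ℝ x → ℝ
log x 0<x = inverse exp exp-increasing x (below 0<x) above
  where
  below : 0ℝ <ℝ x → ∃ λ q → exp q <ℝ x
  below (a , 0<a , la) = - m , a , (k , 0<t , 1<) , la
    where
    i = proj₁ (reciprocal 0<a)
    ai = proj₂ (proj₂ (reciprocal 0<a))
    k,1 = archimedean i
    k = proj₁ k,1
    m = ι k
    eq : 1ℚ - (- m) ÷suc k ≡ 1ℚ + m ÷suc k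
    eq = solve 2 (λ m j → con 1ℚ :- (:- m) :* j := con 1ℚ :+ m :* j) refl m (+ 1 / suc k)
    0≤t : 0ℚ ≤ m ÷suc k
    0≤t = *-nonNeg (ι-nonNeg k) (<⇒≤ (1÷suc-pos k))
    0<1+t : 0ℚ < 1ℚ + m ÷suc k
    0<1+t = +-mono-<-≤ 0<1 0≤t
    0<t = subst (0ℚ <_) (sym eq) 0<1+t
    i< : i < (1ℚ + m ÷suc k) ^ suc k
    i< = <-≤-trans (proj₂ k,1) (≤-trans (≤-by 1ℚ (<⇒≤ 0<1)
      (trans (+-comm m 1ℚ) (cong (λ z → 1ℚ + z)
        (trans (sym (÷suc-*ι m k)) (*-comm (m ÷suc k) (ι (suc k)))))))
      (bernoulli (<⇒≤ 0<1+t) (suc k)))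
    1< : 1ℚ < a * (1ℚ - (- m) ÷suc k) ^ suc k
    1< = subst₂ _<_ ai (cong (λ z → a * z ^ suc k) (sym eq)) (*-monoˡ-<′ 0<a i<)
  above : ∃ λ q → x <ℝ exp q
  above = let (b , ub) = U-inhab x ; (n , b<n) = archimedean b in
    ι n , b , ub , 0 , +-mono-<-≤ 0<1 (*-nonNeg (ι-nonNeg n) (<⇒≤ (1÷suc-pos 0))) ,
    <-trans b<n (<-by 1ℚ 0<1 (solve 1 (λ n → n :+ con 1ℚ
      := (con 1ℚ :+ n :* con 1ℚ) :* con 1ℚ) refl (ι n)))

infix 9 √_

√_ : ℕ → ℝ
√ n = record
  { L        = λ q → q < 0ℚ ⊎ q * q < N
  ; U        = λ q → 0ℚ < q × N < q * q
  ; L-inhab  = 0ℚ - 1ℚ , inj₁ (-1-bound 0ℚ)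
  ; U-inhab  = N + 1ℚ , +-mono-≤-< 0≤N 0<1
      , <-by (N * N + N + 1ℚ) (+-mono-≤-< (+-nonNeg (*-nonNeg 0≤N 0≤N) 0≤N) 0<1)
          (solve 1 (λ n → n :+ (n :* n :+ n :+ con 1ℚ) := (n :+ con 1ℚ) :* (n :+ con 1ℚ)) refl N)
  ; L-closed = closedL
  ; U-closed = λ q<r (0<q , h) →
      <-trans 0<q q<r , <-≤-trans h (*-mono-≤′ (<⇒≤ 0<q) (<⇒≤ q<r) (<⇒≤ 0<q) (<⇒≤ q<r))
  ; L-open   = openL
  ; U-open   = openU
  ; disjoint = λ where
      (inj₁ q<0) (0<q , _) → <-asym q<0 0<q
      (inj₂ h) (_ , h′) → <-asym h h′
  ; located  = loc
  }
  where
  N = ι n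
  0≤N = ι-nonNeg n
  closedL : ∀ {q r} → q < r → r < 0ℚ ⊎ r * r < N → q < 0ℚ ⊎ q * q < N
  closedL q<r (inj₁ r<0) = inj₁ (<-trans q<r r<0)
  closedL {q} q<r (inj₂ h) with q <? 0ℚ
  ... | yes q<0 = inj₁ q<0
  ... | no q≮0 = inj₂ (≤-<-trans
        (*-mono-≤′ (≮⇒≥ q≮0) (<⇒≤ q<r) (≮⇒≥ q≮0) (<⇒≤ q<r)) h)
  increase : ∀ {q} → 0ℚ ≤ q → q * q < N → ∃ λ r → q < r × r * r < N
  increase {q} 0≤q h = step (N - q * q) (<⇒0<- h) refl
    where
    step : ∀ g → 0ℚ < g → g ≡ N - q * q → ∃ λ r → q < r × r * r < N
    step g 0<g g≡ = scaled (reciprocal 0<D)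
      where
      D = q + q + 1ℚ + g
      0<D : 0ℚ < D
      0<D = +-pos (+-mono-≤-< (+-nonNeg 0≤q 0≤q) 0<1) 0<g
      scaled : (∃ λ i → 0ℚ < i × D * i ≡ 1ℚ) → ∃ λ r → q < r × r * r < N
      scaled (i , 0<i , Di) = q + δ , <-by δ 0<δ refl
        , <-by (δ * (1ℚ - δ + g)) (*-pos 0<δ (+-pos (<⇒0<- δ<1) 0<g)) eq
        where
        δ = g * i
        0<δ = *-pos 0<g 0<i
        δ<1 : δ < 1ℚ
        δ<1 = subst (δ <_) Di (*-monoʳ-<′ 0<i g<D)
          where
          g<D : g < D
          g<D = <-by (q + q + 1ℚ) (+-mono-≤-< (+-nonNeg 0≤q 0≤q) 0<1) (+-comm g (q + q + 1ℚ))
        eq : (q + δ) * (q + δ) + δ * (1ℚ - δ + g) ≡ N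
        eq = trans (solve 3 (λ q g i → (q :+ g :* i) :* (q :+ g :* i) :+ g :* i :* (con 1ℚ :- g :* i :+ g)
              := q :* q :+ g :* ((q :+ q :+ con 1ℚ :+ g) :* i)) refl q g i)
            (trans (cong (λ z → q * q + g * z) Di)
              (trans (cong (λ z → q * q + z) (trans (*-identityʳ g) g≡))
                (solve 2 (λ x n → x :+ (n :- x) := n) refl (q * q) N)))
  openL : ∀ {q} → q < 0ℚ ⊎ q * q < N → ∃ λ r → q < r × (r < 0ℚ ⊎ r * r < N)
  openL {q} (inj₁ q<0) = let (r , q<r , r<0) = <-dense q<0 in r , q<r , inj₁ r<0
  openL {q} (inj₂ h) with q <? 0ℚ
  ... | yes q<0 = let (r , q<r , r<0) = <-dense q<0 in r , q<r , inj₁ r<0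
  ... | no q≮0 = let (r , q<r , h′) = increase (≮⇒≥ q≮0) h in r , q<r , inj₂ h′
  square : ∀ q → q ^ 2 ≡ q * q
  square q = cong (q *_) (*-identityʳ q)
  openU : ∀ {r} → 0ℚ < r × N < r * r → ∃ λ q → q < r × 0ℚ < q × N < q * q
  openU {r} (0<r , h) =
    let (d , 0<d , d<r , h′) = ^-shrink 1 0<r (subst (N <_) (sym (square r)) h)
    in d , d<r , 0<d , subst (N <_) (square d) h′
  loc : ∀ {q r} → q < r → (q < 0ℚ ⊎ q * q < N) ⊎ (0ℚ < r × N < r * r)
  loc {q} {r} q<r with q <? 0ℚ
  ... | yes q<0 = inj₁ (inj₁ q<0)
  ... | no q≮0 with q * q <? N
  ...   | yes h = inj₁ (inj₂ h)
  ...   | no h = inj₂ (0<r , ≤-<-trans (≮⇒≥ h)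
            (≤-<-trans (*-monoˡ-≤′ 0≤q (<⇒≤ q<r)) (*-monoʳ-<′ 0<r q<r)))
    where
    0≤q = ≮⇒≥ q≮0
    0<r = ≤-<-trans 0≤q q<r

infixl 7 _·_

-- Interval form of multiplication, which needs no case split on the sign of q.
_·_ : ℚ → ℝ → ℝ
q · x = record
  { L        = λ r → ∃ λ a → ∃ λ b → L x a × U x b × r < q * a × r < q * b
  ; U        = λ r → ∃ λ a → ∃ λ b → L x a × U x b × q * a < r × q * b < r
  ; L-inhab  = inhabL (L-inhab x) (U-inhab x)
  ; U-inhab  = inhabU (L-inhab x) (U-inhab x)
  ; L-closed = λ s<r (a , b , la , ub , h , h′) → a , b , la , ub , <-trans s<r h , <-trans s<r h′
  ; U-closed = λ r<s (a , b , la , ub , h , h′) → a , b , la , ub , <-trans h r<s , <-trans h′ r<s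
  ; L-open   = openL
  ; U-open   = openU
  ; disjoint = disj
  ; located  = λ r<s → loc r<s (reciprocal (+-mono-≤-< (0≤∣p∣ q) 0<1))
  }
  where
  Below Above : ℚ → Set
  Below r = ∃ λ a → ∃ λ b → L x a × U x b × r < q * a × r < q * b
  Above r = ∃ λ a → ∃ λ b → L x a × U x b × q * a < r × q * b < r
  inhabL : ∃ (L x) → ∃ (U x) → ∃ Below
  inhabL (a , la) (b , ub) = let (m , m≤ , m≤′ , _) = lb₂ (q * a) (q * b) in
    m - 1ℚ , a , b , la , ub , <-≤-trans (-1-bound m) m≤ , <-≤-trans (-1-bound m) m≤′
  inhabU : ∃ (L x) → ∃ (U x) → ∃ Above
  inhabU (a , la) (b , ub) = let (m , ≤m , ≤m′ , _) = ub₂ (q * a) (q * b) in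
    m + 1ℚ , a , b , la , ub , ≤-<-trans ≤m (+1-bound m) , ≤-<-trans ≤m′ (+1-bound m)
  openL : ∀ {r} → Below r → ∃ λ s → r < s × Below s
  openL {r} (a , b , la , ub , h , h′) =
    let (m , m≤ , m≤′ , e) = lb₂ (q * a) (q * b)
        (s , r<s , s<m) = <-dense (pick (r <_) e h h′)
    in s , r<s , a , b , la , ub , <-≤-trans s<m m≤ , <-≤-trans s<m m≤′
  openU : ∀ {r} → Above r → ∃ λ s → s < r × Above s
  openU {r} (a , b , la , ub , h , h′) =
    let (m , ≤m , ≤m′ , e) = ub₂ (q * a) (q * b)
        (s , m<s , s<r) = <-dense (pick (_< r) e h h′)
    in s , s<r , a , b , la , ub , ≤-<-trans ≤m m<s , ≤-<-trans ≤m′ m<s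
  disj : ∀ {r} → Below r → Above r → ⊥
  disj (a , b , la , ub , h , h′) (a₁ , b₁ , la₁ , ub₁ , g , g′) with ≤-total 0ℚ q
  ... | inj₁ 0≤q = <-irrefl refl (<-trans h
          (≤-<-trans (*-monoˡ-≤′ 0≤q (<⇒≤ (L<U x la ub₁))) g′))
  ... | inj₂ q≤0 = <-irrefl refl (<-trans h′
          (≤-<-trans (*-monoˡ-≤-nonPos q {{nonPositive q≤0}} (<⇒≤ (L<U x la₁ ub))) g))
  loc : ∀ {r s} → r < s → (∃ λ i → 0ℚ < i × (∣ q ∣ + 1ℚ) * i ≡ 1ℚ) → Below r ⊎ Above s
  loc {r} {s} r<s (i , 0<i , Ki) = split (approx x (*-pos (<⇒0<- r<s) 0<i))
    where
    K = ∣ q ∣ + 1ℚ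
    0≤K : 0ℚ ≤ K
    0≤K = +-nonNeg (0≤∣p∣ q) (<⇒≤ 0<1)
    split : (∃ λ a → ∃ λ b → L x a × U x b × b < a + (s - r) * i) → Below r ⊎ Above s
    split (a , b , la , ub , b<) = go (≤-total 0ℚ q)
      where
      0≤b-a : 0ℚ ≤ b - a
      0≤b-a = <⇒≤ (<⇒0<- (L<U x la ub))
      small : K * (b - a) < s - r
      small = subst (K * (b - a) <_)
        (trans (solve 3 (λ K d i → K :* (d :* i) := d :* (K :* i)) refl K (s - r) i)
          (trans (cong (λ z → (s - r) * z) Ki) (*-identityʳ (s - r))))
        (*-monoˡ-<′ (+-mono-≤-< (0≤∣p∣ q) 0<1)
          (0<-⇒< (subst (0ℚ <_) (solve 3 (λ a b e → a :+ e :- b := e :- (b :- a)) refl a b ((s - r) * i))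
            (<⇒0<- b<))))
      ∣q∣≤K : ∣ q ∣ ≤ K
      ∣q∣≤K = <⇒≤ (+1-bound ∣ q ∣)
      decide : ∀ m M → Dec (r < m) → m ≤ M → M - m < s - r →
               (r < m → r < M → Below r) → (m < s → M < s → Above s) → Below r ⊎ Above s
      decide m M (yes r<m) m≤M d f g = inj₁ (f r<m (<-≤-trans r<m m≤M))
      decide m M (no r≮m) m≤M d f g = inj₂ (g (≤-<-trans m≤M M<s) M<s)
        where
        M<s : M < s
        M<s = subst₂ _<_ (solve 2 (λ M m → M :- m :+ m := M) refl M m)
          (solve 2 (λ s r → s :- r :+ r := s) refl s r) (+-mono-<-≤ d (≮⇒≥ r≮m))
      go : 0ℚ ≤ q ⊎ q ≤ 0ℚ → Below r ⊎ Above s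
      go (inj₁ 0≤q) = decide (q * a) (q * b) (r <? q * a) (*-monoˡ-≤′ 0≤q (<⇒≤ (L<U x la ub)))
        (≤-<-trans (subst (_≤ K * (b - a))
            (solve 3 (λ q a b → q :* (b :- a) := q :* b :- q :* a) refl q a b)
            (*-monoʳ-≤′ 0≤b-a (≤-trans (≤∣∣ q) ∣q∣≤K))) small)
        (λ h h′ → a , b , la , ub , h , h′) (λ h h′ → a , b , la , ub , h , h′)
      go (inj₂ q≤0) = decide (q * b) (q * a) (r <? q * b)
        (*-monoˡ-≤-nonPos q {{nonPositive q≤0}} (<⇒≤ (L<U x la ub)))
        (≤-<-trans (subst (_≤ K * (b - a))
            (solve 3 (λ q a b → (:- q) :* (b :- a) := q :* a :- q :* b) refl q a b)
            (*-monoʳ-≤′ 0≤b-a (≤-trans (-≤∣∣ q) ∣q∣≤K))) small)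
        (λ h h′ → a , b , la , ub , h′ , h) (λ h h′ → a , b , la , ub , h′ , h)

·-pos : ∀ q x → 0ℚ < q → 0ℝ <ℝ x → 0ℝ <ℝ q · x
·-pos q x 0<q (a , 0<a , la) =
  let (b , ub) = U-inhab x
      (s , 0<s , s<qa) = <-dense (*-pos 0<q 0<a)
  in s , 0<s , a , b , la , ub , s<qa , <-trans s<qa (*-monoˡ-<′ 0<q (L<U x la ub))

*-room : ∀ q a s → q * a < s → ∃ λ r → q < r × r * a < s
*-room q a s h with a ≤? 0ℚ
... | yes a≤0 = q + 1ℚ , +1-bound q , ≤-<-trans
        (*-monoʳ-≤-nonPos a {{nonPositive a≤0}} (<⇒≤ (+1-bound q))) h
... | no a≰0 = room (reciprocal 0<a)
  where
  0<a = ≰⇒> a≰0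
  room : (∃ λ i → 0ℚ < i × a * i ≡ 1ℚ) → ∃ λ r → q < r × r * a < s
  room (i , 0<i , ai) = let (r , q<r , r<si) = <-dense q<si in
      r , q<r , subst (r * a <_) sia (*-monoʳ-<′ 0<a r<si)
    where
    sia : s * i * a ≡ s
    sia = trans (solve 3 (λ s i a → s :* i :* a := s :* (a :* i)) refl s i a)
      (trans (cong (λ z → s * z) ai) (*-identityʳ s))
    q<si : q < s * i
    q<si = *-cancelʳ-<′ a (<⇒≤ 0<a) (subst (q * a <_) (sym sia) h)

*-room-≤ : ∀ {q r₁ r a s} → q ≤ r₁ → r₁ ≤ r → q * a < s → r * a < s → r₁ * a < s
*-room-≤ {a = a} q≤r₁ r₁≤r h h′ with ≤-total 0ℚ a
... | inj₁ 0≤a = ≤-<-trans (*-monoʳ-≤′ 0≤a r₁≤r) h′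
... | inj₂ a≤0 = ≤-<-trans (*-monoʳ-≤-nonPos a {{nonPositive a≤0}} q≤r₁) h

*-room₂ : ∀ q a b s → q * a < s → q * b < s → ∃ λ r → q < r × r * a < s × r * b < s
*-room₂ q a b s h h′ =
  let (r₁ , q<r₁ , g) = *-room q a s h
      (r₂ , q<r₂ , g′) = *-room q b s h′
      (r , r≤r₁ , r≤r₂ , e) = lb₂ r₁ r₂
      q<r = pick (q <_) e q<r₁ q<r₂
  in r , q<r , *-room-≤ {a = a} (<⇒≤ q<r) r≤r₁ h g , *-room-≤ {a = b} (<⇒≤ q<r) r≤r₂ h′ g′

neg-*-< : ∀ {q a s} → s < q * a → (- q) * a < - s
neg-*-< {q} {a} h = subst (_< _) (neg-distribˡ-* q a) (neg-antimono-< h)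

neg-*-<′ : ∀ {r a s} → r * a < - s → s < (- r) * a
neg-*-<′ {r} {a} {s} h = subst₂ _<_ (solve 1 (λ s → :- (:- s) := s) refl s)
  (neg-distribˡ-* r a) (neg-antimono-< h)

·-mono : ∀ y → 0ℝ <ℝ y → ∀ {q r} → q < r → q · y <ℝ r · y
·-mono y (c , 0<c , lc) {q} {r} q<r = choose (reciprocal 0<K)
  where
  K = ∣ q ∣ + ∣ r ∣ + 1ℚ
  0<K : 0ℚ < K
  0<K = +-mono-≤-< (+-nonNeg (0≤∣p∣ q) (0≤∣p∣ r)) 0<1
  gap = (r - q) * c
  0<gap : 0ℚ < gap
  0<gap = *-pos (<⇒0<- q<r) 0<c
  choose : (∃ λ i → 0ℚ < i × K * i ≡ 1ℚ) → q · y <ℝ r · y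
  choose (i , 0<i , Ki) = enclose (approx y (*-pos 0<gap 0<i))
    where
    enclose : (∃ λ a → ∃ λ b → L y a × U y b × b < a + gap * i) → q · y <ℝ r · y
    enclose (a₀ , b , la₀ , ub , b<) = conclude (ub₂ a₀ c)
      where
      conclude : (∃ λ a → a₀ ≤ a × c ≤ a × (a ≡ a₀ ⊎ a ≡ c)) → q · y <ℝ r · y
      conclude (a , a₀≤a , c≤a , e) =
        let (M , ≤M , ≤M′ , eM) = ub₂ (q * a) (q * b)
            (m , m≤ , m≤′ , em) = lb₂ (r * a) (r * b)
            M<m = pick (_< m) eM (pick (q * a <_) em qa<ra qa<rb) (pick (q * b <_) em qb<ra qb<rb)
            (s , M<s , s<m) = <-dense M<m
        in s , (a , b , la , ub , ≤-<-trans ≤M M<s , ≤-<-trans ≤M′ M<s)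
             , (a , b , la , ub , <-≤-trans s<m m≤ , <-≤-trans s<m m≤′)
        where
        la : L y a
        la = pick (L y) e la₀ lc
        0<a = <-≤-trans 0<c c≤a
        a<b = L<U y la ub
        h = b - a
        0≤h : 0ℚ ≤ h
        0≤h = <⇒≤ (<⇒0<- a<b)
        h< : h < gap * i
        h< = 0<-⇒< (subst (0ℚ <_)
          (solve 3 (λ a b e → a :+ e :- b := e :- (b :- a)) refl a b (gap * i))
          (<⇒0<- (<-≤-trans b< (+-monoˡ-≤ (gap * i) a₀≤a))))
        Kh<gap : K * h < gap
        Kh<gap = subst (K * h <_)
          (trans (solve 3 (λ K d i → K :* (d :* i) := d :* (K :* i)) refl K gap i)
            (trans (cong (λ z → gap * z) Ki) (*-identityʳ gap)))
          (*-monoˡ-<′ 0<K h<)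
        Kh< : K * h < (r - q) * a
        Kh< = <-≤-trans Kh<gap (*-monoˡ-≤′ (<⇒≤ (<⇒0<- q<r)) c≤a)
        qh≤ : q * h ≤ K * h
        qh≤ = *-monoʳ-≤′ 0≤h (≤-trans (≤∣∣ q)
          (≤-by (∣ r ∣ + 1ℚ) (+-nonNeg (0≤∣p∣ r) (<⇒≤ 0<1)) (sym (+-assoc ∣ q ∣ ∣ r ∣ 1ℚ))))
        -rh≤ : (- r) * h ≤ K * h
        -rh≤ = *-monoʳ-≤′ 0≤h (≤-trans (-≤∣∣ r)
          (≤-by (∣ q ∣ + 1ℚ) (+-nonNeg (0≤∣p∣ q) (<⇒≤ 0<1))
            (solve 2 (λ q r → r :+ (q :+ con 1ℚ) := q :+ r :+ con 1ℚ) refl ∣ q ∣ ∣ r ∣)))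
        qa<ra : q * a < r * a
        qa<ra = *-monoʳ-<′ 0<a q<r
        qb<rb : q * b < r * b
        qb<rb = *-monoʳ-<′ (<-trans 0<a a<b) q<r
        qb<ra : q * b < r * a
        qb<ra = 0<-⇒< (subst (0ℚ <_)
          (solve 4 (λ q r a b → (r :- q) :* a :- q :* (b :- a) := r :* a :- q :* b) refl q r a b)
          (<⇒0<- (≤-<-trans qh≤ Kh<)))
        qa<rb : q * a < r * b
        qa<rb = 0<-⇒< (subst (0ℚ <_)
          (solve 4 (λ q r a b → (r :- q) :* a :- (:- r) :* (b :- a) := r :* b :- q :* a) refl q r a b)
          (<⇒0<- (≤-<-trans -rh≤ Kh<)))

·-increasing : ∀ y → 0ℝ <ℝ y → Increasing (_· y)
·-increasing y 0<y = record
  { mono  = ·-mono y 0<y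
  ; contʳ = λ {q} {s} (a , b , la , ub , h , h′) →
      let (r , q<r , g , g′) = *-room₂ q a b s h h′ in r , q<r , a , b , la , ub , g , g′
  ; contˡ = λ {q} {s} (a , b , la , ub , h , h′) →
      let (r , -q<r , g , g′) = *-room₂ (- q) a b (- s) (neg-*-< {q} {a} h) (neg-*-< {q} {b} h′)
      in - r , subst (- r <_) (solve 1 (λ q → :- (:- q) := q) refl q) (neg-antimono-< -q<r)
             , a , b , la , ub , neg-*-<′ {r} {a} g , neg-*-<′ {r} {b} g′
  }

-- x / y for y > 0 and x of any sign: q < x / y iff q · y < x.
quotient : (x y : ℝ) → 0ℝ <ℝ y → ℝ
quotient x y 0<y@(c , 0<c , lc) =
  inverse (_· y) (·-increasing y 0<y) x (below (L-inhab x)) (above (U-inhab x))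
  where
  b = proj₁ (U-inhab y)
  ub = proj₂ (U-inhab y)
  c<b : c < b
  c<b = L<U y lc ub
  large : ∀ s → ∃ λ m → 0ℚ ≤ m × s < m * c
  large s = bound (reciprocal 0<c)
    where
    bound : (∃ λ i → 0ℚ < i × c * i ≡ 1ℚ) → ∃ λ m → 0ℚ ≤ m × s < m * c
    bound (i , 0<i , ci) = let (n , h) = archimedean (s * i) in
      ι n , ι-nonNeg n , subst (_< ι n * c)
        (trans (solve 3 (λ s i c → s :* i :* c := s :* (c :* i)) refl s i c)
          (trans (cong (λ z → s * z) ci) (*-identityʳ s)))
        (*-monoʳ-<′ 0<c h)
  below : ∃ (L x) → ∃ λ q → q · y <ℝ x
  below (s , ls) = let (m , 0≤m , h) = large (- s)
                       h′ = <-≤-trans h (*-monoˡ-≤′ 0≤m (<⇒≤ c<b)) in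
    - m , s , (c , b , lc , ub , flip m c h , flip m b h′) , ls
    where
    flip : ∀ m a → - s < m * a → (- m) * a < s
    flip m a h = subst₂ _<_ (neg-distribˡ-* m a) (solve 1 (λ s → :- (:- s) := s) refl s)
      (neg-antimono-< h)
  above : ∃ (U x) → ∃ λ q → x <ℝ q · y
  above (s , us) = let (m , 0≤m , h) = large s in
    m , s , us , c , b , lc , ub , h , <-≤-trans h (*-monoˡ-≤′ 0≤m (<⇒≤ c<b))

0<fromℕ : ∀ {n} → 1 ℕ.≤ n → 0ℝ <ℝ fromℕ n
0<fromℕ 1≤n = let (a , 0<a , a<1) = <-dense 0<1 in
  a , 0<a , <-≤-trans a<1 (ι-mono 1≤n)

ln : ∀ n → 1 ℕ.≤ n → ℝ
ln n 1≤n = log (fromℕ n) (0<fromℕ 1≤n)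

exp1<3 : U (exp 1ℚ) (ι 3)
exp1<3 = 5 , from-yes (0ℚ <? 1ℚ - 1ℚ ÷suc 5) , from-yes (1ℚ <? ι 3 * (1ℚ - 1ℚ ÷suc 5) ^ 6)

exp0-U : ∀ a → 1ℚ < a → U (exp 0ℚ) a
exp0-U a h = 0 , 0<1 , subst (1ℚ <_) (sym (*-identityʳ a)) h

3≤⇒1≤ : ∀ {n} → 3 ℕ.≤ n → 1 ℕ.≤ n
3≤⇒1≤ = ℕ.≤-trans (ℕ.s≤s ℕ.z≤n)

1<ln : ∀ {n} (3≤n : 3 ℕ.≤ n) → fromℚ 1ℚ <ℝ ln n (3≤⇒1≤ 3≤n)
1<ln {n} 3≤n = L-open (ln n (3≤⇒1≤ 3≤n)) (raise (U-open (exp 1ℚ) exp1<3))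
  where
  raise : (∃ λ q → q < ι 3 × U (exp 1ℚ) q) → exp 1ℚ <ℝ fromℕ n
  raise (b , b<3 , u) = b , u , <-≤-trans b<3 (ι-mono 3≤n)

0<ln : ∀ {n} (3≤n : 3 ℕ.≤ n) → 0ℝ <ℝ ln n (3≤⇒1≤ 3≤n)
0<ln 3≤n = let (a , 1<a , l) = 1<ln 3≤n in a , <-trans 0<1 1<a , l

lnln : ∀ n → 3 ℕ.≤ n → ℝ
lnln n 3≤n = log (ln n (3≤⇒1≤ 3≤n)) (0<ln 3≤n)

0<lnln : ∀ {n} (3≤n : 3 ℕ.≤ n) → 0ℝ <ℝ lnln n 3≤n
0<lnln {n} 3≤n = L-open (lnln n 3≤n) (raise (1<ln 3≤n))
  where
  raise : fromℚ 1ℚ <ℝ ln n (3≤⇒1≤ 3≤n) → exp 0ℚ <ℝ ln n (3≤⇒1≤ 3≤n)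
  raise (a , 1<a , l) = a , exp0-U a 1<a , l

-- The condition 3 ≤ n makes log n and log log n positive.
ln/100lnln : ∀ n → 3 ℕ.≤ n → ℝ
ln/100lnln n 3≤n =
  quotient (ln n (3≤⇒1≤ 3≤n)) ((+ 100 / 1) · lnln n 3≤n)
    (·-pos (+ 100 / 1) (lnln n 3≤n) (from-yes (0ℚ <? + 100 / 1)) (0<lnln 3≤n))

-- The point set is Fin n. The blocks form an indexed family, so a subset
-- listed at two indices counts as two blocks.
record BlockDesign (n m : ℕ) : Set where
  field
    block    : Fin m → Subset n
    balanced : ∀ {x y} → x ≢ y → ∃! _≡_ λ i → x ∈ block i × y ∈ block i

Transversal : ∀ {n m} → BlockDesign n m → Subset n → Set
Transversal D Q = ∀ i → Nonempty (Q ∩ BlockDesign.block D i)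

{-# OPTIONS --safe #-}
module Submission where

-- S is a uniformly random set of points of the affine plane over Z/p, and the blocks are the traces on S of the
-- lines; by Chernoff's bound |S| is close to p²/2 and all blocks have about p/2 points.  Put t ≈ log n / (100 log log n).
-- If a transversal Q met every block in at most t points, Q would be a set of points of the plane meeting
-- every line in 1 to t points.  Such sets have few containers: sample G from Q at a suitable rate 1/D,
-- and discard from the current container A every point outside G on a line rich in A that contains j points of
-- G.  For the right j this loses few points of Q, while the number of pairs of a rich line and a j-set of Q on it
-- drops by a constant factor.  Iterating, Q ⊆ A ∪ E with |A| ≤ 16 t p and E small, where (A , E) is determined by few
-- points of Q.  For a fixed (A , E) most lines miss E and meet A in O(t) points, so by Janson's
-- inequality it is very unlikely that S ∩ A together with E meets every line; the union bound over (A , E) finishes.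

-- The union bound cannot run over `Q` itself: `Q` may have `t * p` points and takes more than p
-- bits to describe, while for one fixed pair (A , E) Janson's inequality only yields a probability
-- 2^-q with `q` of the order p / log p. So every sample and all of E must be sparser than p by a
-- power of log p, and this power is what limits `t`. Sampling at rate 1 / D is effective when the
-- pairs of a rich line and a j-set number about p D^j. At the best level j their number is compared
-- with level 0, where a quarter of all lines counts, and the comparison costs a factor of up to
-- `Z ^ t`. Hence the condition `room`, essentially `(D₀ * Z) ^ t ≤ p`. With `D₀ * Z` equal to the
-- 18th power of `B`, which is of the order of log p, it allows `t` to be a small multiple of log p
-- / log log p; the 100 of the theorem is generous enough for that. The factor 0.6 leaves room for
-- deviations: blocks of at least 9 p / 20 points and n ≤ 11 p² / 20 suffice, as 0.45 / √0.55 >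
-- 0.606. Probabilities are integer weights with all denominators multiplied out.

module RealEstimates where

  open import Algebra.Bundles using (CommutativeRing)
  open import Data.Empty using (⊥; ⊥-elim)
  open import Data.Integer using (+_)
  open import Data.Nat as ℕ using (ℕ; zero; suc)
  import Data.Nat.Properties as ℕ
  open import Data.Product using (∃; _×_; _,_; proj₁; proj₂)
  open import Data.Rational using (ℚ; 0ℚ; 1ℚ; _+_; _*_; _-_; -_; _/_; _≤_; _<_; _<?_)
  open import Data.Rational.Properties
    using (+-*-commutativeRing; ≤-refl; ≤-reflexive; ≤-trans; <-trans; <-≤-trans; ≤-<-trans; <⇒≤; <-irrefl; <-asym; ≮⇒≥; <-dense;
           *-identityˡ; *-identityʳ; *-comm; *-assoc; *-zeroˡ; +-identityˡ)
  open import Data.Rational.Solver using (module +-*-Solver)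
  open import Data.Sum using (inj₁; inj₂)
  open import Relation.Binary.PropositionalEquality using (_≡_; refl; sym; trans; cong; cong₂; subst; subst₂)
  open import Relation.Nullary using (yes; no)
  open import Relation.Nullary.Decidable using (from-yes)
  open import Algebra.Properties.CommutativeSemiring.Exp
    (CommutativeRing.commutativeSemiring +-*-commutativeRing) using (_^_; ^-assocʳ; ^-distrib-*)
  open import Defs
  open ℝ
  open +-*-Solver using (solve; _:=_; _:+_; _:*_; _:-_; con)

  -- Rational bounds for logarithms and square roots.

  ι-+ : ∀ m n → ι (m ℕ.+ n) ≡ ι m + ι n
  ι-+ zero    n = sym (+-identityˡ (ι n))
  ι-+ (suc m) n = trans (ι-suc (m ℕ.+ n)) (trans (cong (λ z → 1ℚ + z) (ι-+ m n))
    (trans (solve 3 (λ a b c → a :+ (b :+ c) := a :+ b :+ c) refl 1ℚ (ι m) (ι n)) (cong (λ z → z + ι n) (sym (ι-suc m)))))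

  ι-* : ∀ m n → ι (m ℕ.* n) ≡ ι m * ι n
  ι-* zero    n = sym (*-zeroˡ (ι n))
  ι-* (suc m) n = trans (ι-+ n (m ℕ.* n)) (trans (cong (λ z → ι n + z) (ι-* m n))
    (trans (solve 2 (λ a b → b :+ a :* b := (con 1ℚ :+ a) :* b) refl (ι m) (ι n)) (cong (_* ι n) (sym (ι-suc m)))))

  ι-^ : ∀ m n → ι (m ℕ.^ n) ≡ ι m ^ n
  ι-^ m zero    = refl
  ι-^ m (suc n) = trans (ι-* m (m ℕ.^ n)) (cong (ι m *_) (ι-^ m n))

  ι-mono-< : ∀ {m n} → m ℕ.< n → ι m < ι n
  ι-mono-< {m} h = <-≤-trans (<-by 1ℚ 0<1 (trans (solve 1 (λ a → a :+ con 1ℚ := con 1ℚ :+ a) refl (ι m)) (sym (ι-suc m)))) (ι-mono h)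

  -- At index 6 (k + 1) the factor 1 - q / N is 5/6 for every `k`, so everything reduces to a power
  -- of 1 < 3 (5/6)^6. Six is the first index at which this holds.
  exp-ι<3^ : ∀ k → U (exp (ι (suc k))) (ι (3 ℕ.^ suc k))
  exp-ι<3^ k = 5 ℕ.+ k ℕ.* 6 , subst (0ℚ <_) (sym base) (from-yes (0ℚ <? 1ℚ - + 1 / 6)) ,
    subst (1ℚ <_) (sym value) (power k)
    where
    ratio : ι (suc k) ÷suc (5 ℕ.+ k ℕ.* 6) ≡ + 1 / 6
    ratio = trans (cong (_÷suc (5 ℕ.+ k ℕ.* 6)) (sym (trans (cong (+ 1 / 6 *_) (ι-* (suc k) 6))
        (trans (solve 3 (λ a b c → a :* (b :* c) := a :* c :* b) refl (+ 1 / 6) (ι (suc k)) (ι 6)) (*-identityˡ (ι (suc k)))))))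
      (*ι-÷suc (+ 1 / 6) (5 ℕ.+ k ℕ.* 6))
    base : 1ℚ - ι (suc k) ÷suc (5 ℕ.+ k ℕ.* 6) ≡ 1ℚ - + 1 / 6
    base = cong (λ z → 1ℚ - z) ratio
    q : ℚ
    q = 1ℚ - + 1 / 6
    value : ι (3 ℕ.^ suc k) * (1ℚ - ι (suc k) ÷suc (5 ℕ.+ k ℕ.* 6)) ^ (suc k ℕ.* 6) ≡ (ι 3 * q ^ 6) ^ suc k
    value = trans (cong₂ _*_ (ι-^ 3 (suc k)) (trans (cong (_^ (suc k ℕ.* 6)) base)
        (trans (cong (q ^_) (ℕ.*-comm (suc k) 6)) (sym (^-assocʳ q 6 (suc k))))))
      (sym (^-distrib-* (ι 3) (q ^ 6) (suc k)))
    power : ∀ k → 1ℚ < (ι 3 * q ^ 6) ^ suc k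
    power zero    = from-yes (1ℚ <? (ι 3 * q ^ 6) ^ 1)
    power (suc k) = <-trans (power k) (subst (_< (ι 3 * q ^ 6) ^ suc (suc k)) (*-identityˡ _)
      (*-monoʳ-<′ (^-pos (from-yes (0ℚ <? ι 3 * q ^ 6)) (suc k)) (from-yes (1ℚ <? ι 3 * q ^ 6))))

  -- With N equal to the exponent the factor 1 + q / N is exactly 2.
  2^<exp-ι : ∀ m {c} → c < ι (2 ℕ.^ suc m) → L (exp (ι (suc m))) c
  2^<exp-ι m {c} h = m , subst (0ℚ <_) (sym base) (from-yes (0ℚ <? ι 2)) ,
    subst (c <_) (trans (ι-^ 2 (suc m)) (cong (_^ suc m) (sym base))) h
    where
    base : 1ℚ + ι (suc m) ÷suc m ≡ ι 2
    base = cong (λ z → 1ℚ + z) (trans (cong (_÷suc m) (sym (*-identityˡ (ι (suc m))))) (*ι-÷suc 1ℚ m))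

  ln-upper : ∀ n (1≤n : 1 ℕ.≤ n) m → n ℕ.< 2 ℕ.^ suc m → U (ln n 1≤n) (ι (suc m))
  ln-upper n 1≤n m h = let (c , n<c , c<) = <-dense (ι-mono-< h) in c , n<c , 2^<exp-ι m c<

  ln-lower : ∀ n (1≤n : 1 ℕ.≤ n) k → 3 ℕ.^ suc k ℕ.< n → L (ln n 1≤n) (ι (suc k))
  ln-lower n 1≤n k h = ι (3 ℕ.^ suc k) , exp-ι<3^ k , ι-mono-< h

  lnln-lower : ∀ n (3≤n : 3 ℕ.≤ n) k → 3 ℕ.^ (3 ℕ.^ suc k) ℕ.< n → L (lnln n 3≤n) (ι (suc k))
  lnln-lower n 3≤n k h = ι (3 ℕ.^ suc k) , exp-ι<3^ k , inner (3 ℕ.^ suc k) (ℕ.m^n>0 3 (suc k)) h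
    where
    inner : ∀ c → 1 ℕ.≤ c → 3 ℕ.^ c ℕ.< n → L (ln n (3≤⇒1≤ 3≤n)) (ι c)
    inner (suc c) _ h = ln-lower n (3≤⇒1≤ 3≤n) c h

  ·-U : ∀ q x {r} → U (q · x) r → ∃ λ b → U x b × q * b < r
  ·-U q x (a , b , _ , ub , _ , qb<r) = b , ub , qb<r

  quotient-L : ∀ x y (0<y : 0ℝ <ℝ y) {q} → L (quotient x y 0<y) q → ∃ λ r → L x r × ∃ λ b → U y b × q * b < r
  quotient-L x y 0<y {q} (r , u , l) = r , l , ·-U q y u

  -- If `q` were at least `T`, then `q` times an upper bound of the denominator would be at least
  -- `T * (s * k) ≥ M`, which lies above `x`; but `q` was chosen so that this product lies below
  -- `x`.
  quotient-bound : ∀ s x z (0<sz : 0ℝ <ℝ s · z) {M k T q} → 0ℚ < s → 0ℚ ≤ T → 0ℚ ≤ k → U x M → L z k → M ≤ T * (s * k) →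
    L (quotient x (s · z) 0<sz) q → q < T
  quotient-bound s x z 0<sz {M} {k} {T} {q} 0<s 0≤T 0≤k ux lz M≤ lq with q <? T
  ... | yes q<T = q<T
  ... | no q≮T =
    let (r , lr , b , ub , qb<r) = quotient-L x (s · z) 0<sz {q} lq
        (b′ , ub′ , sb′<b) = ·-U s z {b} ub
        sk<b = <-trans (*-monoˡ-<′ 0<s (L<U z lz ub′)) sb′<b
    in ⊥-elim (<-irrefl refl (<-trans (L<U x lr ux) (≤-<-trans
         (≤-trans M≤ (*-mono-≤′ 0≤T (≮⇒≥ q≮T) (*-nonNeg (<⇒≤ 0<s) 0≤k) (<⇒≤ sk<b))) qb<r)))

  ln/100lnln-bound : ∀ n (3≤n : 3 ℕ.≤ n) k m T x → 3 ℕ.^ (3 ℕ.^ suc k) ℕ.< n → n ℕ.< 2 ℕ.^ suc m →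
    suc m ℕ.≤ T ℕ.* (100 ℕ.* suc k) → T ℕ.≤ x → fromℕ x ≥ℝ ln/100lnln n 3≤n
  ln/100lnln-bound n 3≤n k m T x lo hi m≤ T≤x q lq = <-≤-trans
    (quotient-bound (+ 100 / 1) (ln n (3≤⇒1≤ 3≤n)) (lnln n 3≤n)
      (·-pos (+ 100 / 1) (lnln n 3≤n) (from-yes (0ℚ <? + 100 / 1)) (0<lnln 3≤n))
      (from-yes (0ℚ <? + 100 / 1)) (ι-nonNeg T) (ι-nonNeg (suc k))
      (ln-upper n (3≤⇒1≤ 3≤n) m hi) (lnln-lower n 3≤n k lo)
      (≤-trans (ι-mono m≤) (≤-reflexive (trans (ι-* T (100 ℕ.* suc k)) (cong (ι T *_) (ι-* 100 (suc k)))))) lq)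
    (ι-mono T≤x)

  -- Two rationals are interposed: 11/20 < (149/200)², and 0.6 · 149/200 < 449/1000 < 9/20.
  block-size-bound : ∀ n c p → 1 ℕ.≤ p → 20 ℕ.* n ℕ.≤ 11 ℕ.* (p ℕ.* p) → 9 ℕ.* p ℕ.≤ 20 ℕ.* c → (+ 6 / 10) · (√ n) <ℝ fromℕ c
  block-size-bound n c p 1≤p n≤ p≤ = r * P , (a , b , proj₂ (L-inhab (√ n)) , (*-pos (from-yes (0ℚ <? s)) 0<P , n<b²) , a<r , b<r) , r<c
    where
    P = ι p
    s = + 149 / 200
    r = + 449 / 1000
    -- Multiplication by a rational is defined through intervals, so a lower end is needed as well;
    -- this one is -1 for every `n`.
    a = proj₁ (L-inhab (√ n))
    b = s * P
    0<P : 0ℚ < P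
    0<P = <-≤-trans 0<1 (ι-mono 1≤p)
    b<r : (+ 6 / 10) * b < r * P
    b<r = subst (_< r * P) (*-assoc (+ 6 / 10) s P) (*-monoʳ-<′ 0<P (from-yes ((+ 6 / 10) * s <? r)))
    a<r : (+ 6 / 10) * a < r * P
    a<r = <-trans (from-yes ((+ 6 / 10) * a <? 0ℚ)) (*-pos (from-yes (0ℚ <? r)) 0<P)
    r<c : r * P < ι c
    r<c = *-cancelʳ-<′ (ι 20) (ι-nonNeg 20) (<-≤-trans
      (subst (_< ι 9 * P) (solve 3 (λ r t P → r :* t :* P := r :* P :* t) refl r (ι 20) P) (*-monoʳ-<′ 0<P (from-yes (r * ι 20 <? ι 9))))
      (subst₂ _≤_ (ι-* 9 p) (trans (ι-* 20 c) (*-comm (ι 20) (ι c))) (ι-mono p≤)))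
    n<b² : ι n < b * b
    n<b² = *-cancelʳ-<′ (ι 20) (ι-nonNeg 20) (≤-<-trans
      (subst₂ _≤_ (trans (ι-* 20 n) (*-comm (ι 20) (ι n))) (trans (ι-* 11 (p ℕ.* p)) (cong (ι 11 *_) (ι-* p p))) (ι-mono n≤))
      (subst (ι 11 * (P * P) <_) (solve 3 (λ s P t → s :* s :* t :* (P :* P) := (s :* P) :* (s :* P) :* t) refl s P (ι 20))
        (*-monoʳ-<′ (*-pos 0<P 0<P) (from-yes (ι 11 <? s * s * ι 20)))))

-- Ring identities for congruences modulo p.

module IntegerIdentities where

  open import Data.Integer using (_+_; _*_; _-_)
  open import Data.Integer.Solver using (module +-*-Solver)
  open import Relation.Binary.PropositionalEquality using (_≡_; refl)
  open +-*-Solver using (solve; _:=_; _:+_; _:*_; _:-_)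

  cancel-remainder : ∀ r a b p → (r + a * p) - (r + b * p) ≡ (a - b) * p
  cancel-remainder = solve 4 (λ r a b p → (r :+ a :* p) :- (r :+ b :* p) := (a :- b) :* p) refl

  cancel-common : ∀ u v c → (u + c) - (v + c) ≡ u - v
  cancel-common = solve 3 (λ u v c → (u :+ c) :- (v :+ c) := u :- v) refl

  slope-difference : ∀ x₁ x₂ y₁ y₂ a b → ((x₂ + a * x₁) - (y₂ + a * y₁)) - ((x₂ + b * x₁) - (y₂ + b * y₁)) ≡ (a - b) * (x₁ - y₁)
  slope-difference = solve 6 (λ x₁ x₂ y₁ y₂ a b →
    ((x₂ :+ a :* x₁) :- (y₂ :+ a :* y₁)) :- ((x₂ :+ b :* x₁) :- (y₂ :+ b :* y₁)) := (a :- b) :* (x₁ :- y₁)) refl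

open RealEstimates using (ln/100lnln-bound; block-size-bound)
open IntegerIdentities using (cancel-remainder; cancel-common; slope-difference)
open import Data.Bool using (Bool; true; false; _∧_; _∨_; not; if_then_else_)
open import Data.Empty using (⊥; ⊥-elim)
open import Data.Fin using (Fin; zero; suc; toℕ; fromℕ<; combine; remQuot; _↑ˡ_; _↑ʳ_)
open import Data.Fin.Properties using (toℕ<n; toℕ-fromℕ<; toℕ-injective; combine-remQuot; remQuot-combine) renaming (_≟_ to _≟ᶠ_; suc-injective to sucᶠ-injective)
open import Data.Fin.Subset using (Subset; _∩_; _∪_; ∁; _∈_)
open import Data.List using (List; []; _∷_; length; _++_; map; filter; take; allFin; cartesianProduct; concatMap; upTo) renaming (tabulate to tabulateₗ)
open import Data.List.Membership.Propositional using () renaming (_∈_ to _∈ₗ_)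
open import Data.List.Membership.Propositional.Properties using (∈-map⁺; ∈-++⁺ˡ; ∈-++⁺ʳ; ∈-concatMap⁺; ∈-upTo⁺; ∈-cartesianProduct⁺)
open import Data.List.Properties using (length-map; length-take; length-tabulate; length-++; length-upTo)
open import Data.List.Relation.Unary.All as All using (All; []; _∷_)
open import Data.List.Relation.Unary.All.Properties using (all-filter)
open import Data.List.Relation.Unary.AllPairs using (AllPairs; []; _∷_)
open import Data.List.Relation.Unary.Any as Any using (here; there)
open import Data.List.Relation.Unary.Unique.Propositional using (Unique)
open import Data.Nat
open import Data.Nat.Combinatorics using (_C_; nCk+nC[k+1]≡[n+1]C[k+1]; k>n⇒nCk≡0; nCn≡1; nC1≡n)
open import Data.Nat.DivMod using (_/_; _%_; m/n*n≤m; m≡m%n+[m/n]*n; m%n<n; _mod_)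
open import Data.Nat.Divisibility using (_∣_; ∣⇒≤; m∣m*n; ∣-trans; ∣m+n∣m⇒∣n; ∣1⇒≡1; m≤n⇒m!∣n!)
open import Data.Nat.Primality using (Prime; euclidsLemma; prime⇒nonZero; prime⇒nonTrivial)
open import Data.Nat.Primality.Factorisation using (PrimeFactorisation; factorise)
open import Data.Nat.Properties
open import Data.Nat.Solver using (module +-*-Solver)
open import Data.Product using (∃; _×_; _,_; proj₁; proj₂; ∃!; Σ-syntax)
open import Data.Sum using (_⊎_; inj₁; inj₂)
open import Data.Unit using (tt)
open import Data.Vec using ([]; _∷_; lookup; tabulate)
open import Data.Vec.Properties using (lookup∘tabulate; lookup-zipWith; lookup-map; []=⇒lookup; lookup⇒[]=)
open import Function using (_∘_; id)
open import Relation.Binary.Definitions using (tri<; tri≈; tri>)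
open import Relation.Binary.PropositionalEquality hiding (J)
open import Relation.Nullary using (¬_; Dec; yes; no; does)
open import Relation.Nullary.Decidable using (_×-dec_)
open import Algebra.Properties.Semiring.Sum +-*-semiring using (sum; sum-cong-≗; ∑-distrib-+; ∑-comm; *-distribˡ-sum; *-distribʳ-sum)
import Data.List.Relation.Unary.Unique.Propositional.Properties as Unique
open +-*-Solver using (solve; _:=_; _:+_; _:*_; con)

-- Finite sums, indicators and cardinalities of subsets.

∑-mono : ∀ {n} {f g : Fin n → ℕ} → (∀ i → f i ≤ g i) → sum f ≤ sum g
∑-mono {zero}  f≤g = z≤n
∑-mono {suc n} f≤g = +-mono-≤ (f≤g zero) (∑-mono (f≤g ∘ suc))

∑-const : ∀ n c → sum {n} (λ _ → c) ≡ n * c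
∑-const zero    c = refl
∑-const (suc n) c = cong (c +_) (∑-const n c)

∑-bound : ∀ {n} {f : Fin n → ℕ} {c} → (∀ i → f i ≤ c) → sum f ≤ n * c
∑-bound {n} {c = c} f≤c = ≤-trans (∑-mono f≤c) (≤-reflexive (∑-const n c))

∑-term : ∀ {n} (f : Fin n → ℕ) i → f i ≤ sum f
∑-term f zero    = m≤m+n _ _
∑-term f (suc i) = ≤-trans (∑-term (f ∘ suc) i) (m≤n+m _ _)

∑-zero : ∀ {n} {f : Fin n → ℕ} → (∀ i → f i ≡ 0) → sum f ≡ 0
∑-zero {zero}  f≡0 = refl
∑-zero {suc n} f≡0 = cong₂ _+_ (f≡0 zero) (∑-zero (f≡0 ∘ suc))

+-<-split : ∀ {a b c d} → a + b < c + d → a < c ⊎ b < d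
+-<-split {a} {b} {c} {d} h with a <? c
... | yes a<c = inj₁ a<c
... | no a≮c with b <? d
...   | yes b<d = inj₂ b<d
...   | no b≮d = ⊥-elim (<⇒≱ h (+-mono-≤ (≮⇒≥ a≮c) (≮⇒≥ b≮d)))

𝟙 : Bool → ℕ
𝟙 true  = 1
𝟙 false = 0

𝟙≤1 : ∀ b → 𝟙 b ≤ 1
𝟙≤1 true  = ≤-refl
𝟙≤1 false = z≤n

𝟙-∧ : ∀ a b → 𝟙 (a ∧ b) ≡ 𝟙 a * 𝟙 b
𝟙-∧ true  b = sym (+-identityʳ _)
𝟙-∧ false b = refl

𝟙-mono : ∀ {a b} → (a ≡ true → b ≡ true) → 𝟙 a ≤ 𝟙 b
𝟙-mono {true}  h = ≤-reflexive (cong 𝟙 (sym (h refl)))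
𝟙-mono {false} h = z≤n

𝟙-*-mono : ∀ a {m n} → (a ≡ true → m ≤ n) → 𝟙 a * m ≤ 𝟙 a * n
𝟙-*-mono true  h = +-monoˡ-≤ 0 (h refl)
𝟙-*-mono false h = z≤n

𝟙-*-≤ : ∀ a {m n} → (a ≡ true → m ≤ n) → 𝟙 a * m ≤ n
𝟙-*-≤ true  {m} h = ≤-trans (≤-reflexive (+-identityʳ m)) (h refl)
𝟙-*-≤ false h = z≤n

∧-split : ∀ {a b} → a ∧ b ≡ true → a ≡ true × b ≡ true
∧-split {true} {true} _ = refl , refl

∧-join : ∀ {a b} → a ≡ true → b ≡ true → a ∧ b ≡ true
∧-join refl refl = refl

bool-case : (b : Bool) → b ≡ true ⊎ b ≡ false
bool-case true  = inj₁ refl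
bool-case false = inj₂ refl

true≢false : ∀ {b} → b ≡ true → b ≡ false → ⊥
true≢false refl ()

_==_ : ∀ {n} → Fin n → Fin n → Bool
i == j = does (i ≟ᶠ j)

does-true : ∀ {ℓ} {P : Set ℓ} (d : Dec P) → does d ≡ true → P
does-true (yes p) _ = p

does-yes : ∀ {ℓ} {P : Set ℓ} (d : Dec P) → P → does d ≡ true
does-yes (yes _) _ = refl
does-yes (no ¬p) p = ⊥-elim (¬p p)

does-false : ∀ {ℓ} {P : Set ℓ} (d : Dec P) → does d ≡ false → ¬ P
does-false (no ¬p) _ = ¬p

does-no : ∀ {ℓ} {P : Set ℓ} (d : Dec P) → ¬ P → does d ≡ false
does-no (yes p) ¬p = ⊥-elim (¬p p)
does-no (no _)  _  = refl

∑-pick : ∀ {n} (i : Fin n) (f : Fin n → ℕ) → sum (λ j → 𝟙 (i == j) * f j) ≡ f i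
∑-pick {suc n} zero f = begin
  f zero + 0 + sum {n} (λ j → 0) ≡⟨ cong₂ _+_ (+-identityʳ (f zero)) (∑-zero {n} (λ _ → refl)) ⟩
  f zero + 0                     ≡⟨ +-identityʳ _ ⟩
  f zero                         ∎
  where open ≡-Reasoning
∑-pick {suc n} (suc i) f = trans (sum-cong-≗ same) (∑-pick i (f ∘ suc))
  where
  same : ∀ j → 𝟙 (suc i == suc j) * f (suc j) ≡ 𝟙 (i == j) * f (suc j)
  same j with i ≟ᶠ j
  ... | yes _ = refl
  ... | no _  = refl

-- Turns uniqueness into a count: common lines of two points, points of a line in one column,
-- mutually exclusive events.
∑-unique≤1 : ∀ {n} (b : Fin n → Bool) → (∀ {i j} → b i ≡ true → b j ≡ true → i ≡ j) → sum (𝟙 ∘ b) ≤ 1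
∑-unique≤1 {zero}  b u = z≤n
∑-unique≤1 {suc n} b u with bool-case (b zero)
... | inj₂ e = ≤-trans (≤-reflexive (cong (λ z → 𝟙 z + sum (𝟙 ∘ b ∘ suc)) e))
                 (∑-unique≤1 (b ∘ suc) (λ p q → sucᶠ-injective (u p q)))
... | inj₁ e = ≤-reflexive (cong₂ _+_ (cong 𝟙 e) (∑-zero {n} zeros))
  where
  zeros : ∀ j → 𝟙 (b (suc j)) ≡ 0
  zeros j with bool-case (b (suc j))
  ... | inj₂ e′ = cong 𝟙 e′
  ... | inj₁ e′ with u e e′
  ...   | ()

card : ∀ {n} → Subset n → ℕ
card S = sum (λ x → 𝟙 (lookup S x))

lookup-∩ : ∀ {n} (S T : Subset n) x → lookup (S ∩ T) x ≡ lookup S x ∧ lookup T x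
lookup-∩ S T x = lookup-zipWith _∧_ x S T

lookup-∪ : ∀ {n} (S T : Subset n) x → lookup (S ∪ T) x ≡ lookup S x ∨ lookup T x
lookup-∪ S T x = lookup-zipWith _∨_ x S T

card-tabulate : ∀ {n} (f : Fin n → Bool) → card (tabulate f) ≡ sum (𝟙 ∘ f)
card-tabulate f = sum-cong-≗ (λ x → cong 𝟙 (lookup∘tabulate f x))

card-∩ : ∀ {n} (S T : Subset n) → card (S ∩ T) ≡ sum (λ x → 𝟙 (lookup S x) * 𝟙 (lookup T x))
card-∩ S T = sum-cong-≗ (λ x → trans (cong 𝟙 (lookup-∩ S T x)) (𝟙-∧ (lookup S x) _))

_⊑_ : ∀ {n} → Subset n → Subset n → Set
S ⊑ T = ∀ x → lookup S x ≡ true → lookup T x ≡ true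

∩⊑ˡ : ∀ {n} (S T : Subset n) → (S ∩ T) ⊑ S
∩⊑ˡ S T x h = proj₁ (∧-split (trans (sym (lookup-∩ S T x)) h))

∩⊑ʳ : ∀ {n} (S T : Subset n) → (S ∩ T) ⊑ T
∩⊑ʳ S T x h = proj₂ (∧-split {lookup S x} (trans (sym (lookup-∩ S T x)) h))

∩-join : ∀ {n} (S T : Subset n) x → lookup S x ≡ true → lookup T x ≡ true → lookup (S ∩ T) x ≡ true
∩-join S T x s t = trans (lookup-∩ S T x) (∧-join s t)

card-mono : ∀ {n} {S T : Subset n} → S ⊑ T → card S ≤ card T
card-mono h = ∑-mono (λ x → 𝟙-mono (h x))

card≤n : ∀ {n} (S : Subset n) → card S ≤ n
card≤n {n} S = ≤-trans (∑-bound (λ x → 𝟙≤1 (lookup S x))) (≤-reflexive (*-identityʳ n))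

card-pos : ∀ {n} (S : Subset n) {x} → lookup S x ≡ true → 1 ≤ card S
card-pos S {x} h = ≤-trans (≤-reflexive (cong 𝟙 (sym h))) (∑-term (λ x → 𝟙 (lookup S x)) x)

card-inhabited : ∀ {n} (S : Subset n) → 1 ≤ card S → ∃ λ x → lookup S x ≡ true
card-inhabited (true ∷ S) _ = zero , refl
card-inhabited (false ∷ S) h = let (x , e) = card-inhabited S h in suc x , e

-- A point of `T` outside `S` is left out as long as the remaining part of `T` still has `j` points;
-- from then on all of `T` is taken.
interpolate : ∀ {n} (S T : Subset n) j → S ⊑ T → card S ≤ j → j ≤ card T → ∃ λ H → S ⊑ H × H ⊑ T × card H ≡ j
interpolate [] [] zero _ _ _ = [] , (λ x h → h) , (λ x h → h) , refl
interpolate (true ∷ S) (true ∷ T) (suc j) s⊑t (s≤s lo) (s≤s hi) =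
  let (H , a , b , c) = interpolate S T j (λ x → s⊑t (suc x)) lo hi in
  true ∷ H , (λ { zero h → h ; (suc x) h → a x h }) , (λ { zero h → h ; (suc x) h → b x h }) , cong suc c
interpolate (true ∷ S) (false ∷ T) j s⊑t lo hi with s⊑t zero refl
... | ()
interpolate (false ∷ S) (false ∷ T) j s⊑t lo hi =
  let (H , a , b , c) = interpolate S T j (λ x → s⊑t (suc x)) lo hi in
  false ∷ H , (λ { zero h → h ; (suc x) h → a x h }) , (λ { zero h → h ; (suc x) h → b x h }) , c
interpolate (false ∷ S) (true ∷ T) j s⊑t lo hi with j ≤? card T
... | yes j≤ =
  let (H , a , b , c) = interpolate S T j (λ x → s⊑t (suc x)) lo j≤ in
  false ∷ H , (λ { zero () ; (suc x) h → a x h }) , (λ { zero () ; (suc x) h → b x h }) , c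
... | no j≰ =
  let e = ≤-antisym hi (≰⇒> j≰) in
  true ∷ T , (λ { zero () ; (suc x) h → s⊑t (suc x) h }) , (λ x h → h) , sym e

∅-card : ∀ {n} → card {n} (tabulate (λ _ → false)) ≡ 0
∅-card {n} = trans (card-tabulate {n} (λ _ → false)) (∑-zero {n} (λ _ → refl))

subset-of-size : ∀ {n} (T : Subset n) j → j ≤ card T → ∃ λ H → H ⊑ T × card H ≡ j
subset-of-size {n} T j hi =
  let (H , _ , b , c) = interpolate (tabulate (λ _ → false)) T j
        (λ x h → ⊥-elim (true≢false h (lookup∘tabulate (λ _ → false) x)))
        (≤-trans (≤-reflexive (∅-card {n})) z≤n) hi in H , b , c

-- Weighted sums over subsets

-- The total weight of f when a subset H of n points has weight d ^ (n - |H|).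
wsum : ℕ → ∀ {n} → (Subset n → ℕ) → ℕ
wsum d {zero}  f = f []
wsum d {suc n} f = wsum d (f ∘ (true ∷_)) + d * wsum d (f ∘ (false ∷_))

module _ (d : ℕ) where

  wsum-cong : ∀ {n} {f g : Subset n → ℕ} → (∀ H → f H ≡ g H) → wsum d f ≡ wsum d g
  wsum-cong {zero}  e = e []
  wsum-cong {suc n} e = cong₂ (λ a b → a + d * b) (wsum-cong (e ∘ (true ∷_))) (wsum-cong (e ∘ (false ∷_)))

  wsum-mono : ∀ {n} {f g : Subset n → ℕ} → (∀ H → f H ≤ g H) → wsum d f ≤ wsum d g
  wsum-mono {zero}  h = h []
  wsum-mono {suc n} h = +-mono-≤ (wsum-mono (h ∘ (true ∷_))) (*-monoʳ-≤ d (wsum-mono (h ∘ (false ∷_))))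

  wsum-+ : ∀ {n} (f g : Subset n → ℕ) → wsum d (λ H → f H + g H) ≡ wsum d f + wsum d g
  wsum-+ {zero}  f g = refl
  wsum-+ {suc n} f g = trans
    (cong₂ (λ a b → a + d * b) (wsum-+ (f ∘ (true ∷_)) (g ∘ (true ∷_))) (wsum-+ (f ∘ (false ∷_)) (g ∘ (false ∷_))))
    (solve 5 (λ a b c e d → (a :+ b) :+ d :* (c :+ e) := (a :+ d :* c) :+ (b :+ d :* e)) refl
      (wsum d (f ∘ (true ∷_))) (wsum d (g ∘ (true ∷_))) (wsum d (f ∘ (false ∷_))) (wsum d (g ∘ (false ∷_))) d)

  wsum-* : ∀ {n} c (f : Subset n → ℕ) → wsum d (λ H → c * f H) ≡ c * wsum d f
  wsum-* {zero}  c f = refl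
  wsum-* {suc n} c f = trans
    (cong₂ (λ a b → a + d * b) (wsum-* c (f ∘ (true ∷_))) (wsum-* c (f ∘ (false ∷_))))
    (solve 4 (λ c d a b → c :* a :+ d :* (c :* b) := c :* (a :+ d :* b)) refl
      c d (wsum d (f ∘ (true ∷_))) (wsum d (f ∘ (false ∷_))))

  wsum-const : ∀ n c → wsum d {n} (λ _ → c) ≡ suc d ^ n * c
  wsum-const zero    c = sym (+-identityʳ c)
  wsum-const (suc n) c = trans (cong (λ a → a + d * a) (wsum-const n c)) (sym (*-assoc (suc d) (suc d ^ n) c))

  wsum-∑ : ∀ {n m} (f : Fin m → Subset n → ℕ) → wsum d (λ H → sum (λ i → f i H)) ≡ sum (λ i → wsum d (f i))
  wsum-∑ {n} {zero}  f = trans (wsum-const n 0) (*-zeroʳ (suc d ^ n))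
  wsum-∑ {n} {suc m} f = trans (wsum-+ (f zero) _) (cong (wsum d (f zero) +_) (wsum-∑ (f ∘ suc)))

  -- First moment method; the samples of `Q` and the final point set are both obtained through it.
  wsum-witness : ∀ {n} {f g : Subset n → ℕ} → wsum d f < wsum d g → ∃ λ H → f H < g H
  wsum-witness {zero}  h = [] , h
  wsum-witness {suc n} h with +-<-split h
  ... | inj₁ h′ = let (H , e) = wsum-witness h′ in true ∷ H , e
  ... | inj₂ h′ = let (H , e) = wsum-witness (*-cancelˡ-< d _ _ h′) in false ∷ H , e

  wsum-witness-≤ : ∀ {n} {f : Subset n → ℕ} {c} → wsum d f ≤ suc d ^ n * c → ∃ λ H → f H ≤ c
  wsum-witness-≤ {n} {f} {c} h = let (H , e) = wsum-witness {f = f} {λ _ → suc c} big in H , ≤-pred e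
    where
    big : wsum d f < wsum d {n} (λ _ → suc c)
    big = subst (wsum d f <_) (sym (wsum-const n (suc c)))
      (≤-<-trans h (*-monoʳ-< (suc d ^ n) {{m^n≢0 (suc d) n}} (n<1+n c)))

  wsum-member : ∀ {n} (x : Fin n) → suc d * wsum d (λ H → 𝟙 (lookup H x)) ≡ suc d ^ n
  wsum-member {suc n} zero = cong (suc d *_)
    (trans (cong₂ (λ a b → a + d * b) (wsum-const n 1) (trans (wsum-const n 0) (*-zeroʳ (suc d ^ n))))
      (trans (cong (suc d ^ n * 1 +_) (*-zeroʳ d)) (trans (+-identityʳ _) (*-identityʳ _))))
  wsum-member {suc n} (suc x) = trans
    (solve 2 (λ d a → (con 1 :+ d) :* (a :+ d :* a) := (con 1 :+ d) :* ((con 1 :+ d) :* a)) refl d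
      (wsum d (λ H → 𝟙 (lookup H x))))
    (cong (suc d *_) (wsum-member x))

  Independent : ∀ {n} → Subset n → (Subset n → ℕ) → Set
  Independent T I = ∀ H H′ → (∀ x → lookup T x ≡ false → lookup H x ≡ lookup H′ x) → I H ≡ I H′

_⊆ᵇ_ : ∀ {n} → Subset n → Subset n → Bool
[] ⊆ᵇ [] = true
(t ∷ T) ⊆ᵇ (h ∷ H) = (not t ∨ h) ∧ (T ⊆ᵇ H)

⊆ᵇ⇒⊑ : ∀ {n} (T H : Subset n) → T ⊆ᵇ H ≡ true → T ⊑ H
⊆ᵇ⇒⊑ (true ∷ T) (true ∷ H) e zero    h = refl
⊆ᵇ⇒⊑ (t ∷ T) (h ∷ H) e (suc x) h′ = ⊆ᵇ⇒⊑ T H (proj₂ (∧-split {not t ∨ h} e)) x h′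

meets : ∀ {n} → Subset n → Subset n → Bool
meets [] [] = false
meets (t ∷ T) (h ∷ H) = (t ∧ h) ∨ meets T H

meets-true : ∀ {n} (T H : Subset n) x → lookup T x ≡ true → lookup H x ≡ true → meets T H ≡ true
meets-true (true ∷ T) (true ∷ H) zero refl refl = refl
meets-true (t ∷ T) (h ∷ H) (suc x) p q with t ∧ h
... | true = refl
... | false = meets-true T H x p q

meets-witness : ∀ {n} (T H : Subset n) → meets T H ≡ true → ∃ λ x → lookup T x ≡ true × lookup H x ≡ true
meets-witness [] [] ()
meets-witness (true ∷ T) (true ∷ H) e = zero , refl , refl
meets-witness (true ∷ T) (false ∷ H) e = let (x , p , q) = meets-witness T H e in suc x , p , q
meets-witness (false ∷ T) (h ∷ H) e = let (x , p , q) = meets-witness T H e in suc x , p , q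

independent-tail : ∀ d {n} {t} {T : Subset n} {I} h → Independent d (t ∷ T) I → Independent d T (I ∘ (h ∷_))
independent-tail d h ind H H′ e = ind (h ∷ H) (h ∷ H′) (λ { zero _ → refl ; (suc x) p → e x p })

-- Points are chosen independently, each with probability `1 / suc d`, and `I` does not look at `T`.
-- So requiring `T` to be contained divides the expectation by `suc d ^ card T`.
wsum-⊆-independent : ∀ d {n} (T : Subset n) (I : Subset n → ℕ) → Independent d T I →
  wsum d (λ H → 𝟙 (T ⊆ᵇ H) * I H) * suc d ^ card T ≡ wsum d I
wsum-⊆-independent d [] I ind = trans (*-identityʳ _) (+-identityʳ _)
wsum-⊆-independent d (false ∷ T) I ind = trans
  (solve 4 (λ a b d c → (a :+ d :* b) :* c := a :* c :+ d :* (b :* c)) refl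
    (wsum d (λ H → 𝟙 (T ⊆ᵇ H) * I (true ∷ H))) (wsum d (λ H → 𝟙 (T ⊆ᵇ H) * I (false ∷ H))) d (suc d ^ card T))
  (cong₂ (λ a b → a + d * b) (wsum-⊆-independent d T _ (independent-tail d true ind))
                             (wsum-⊆-independent d T _ (independent-tail d false ind)))
wsum-⊆-independent d {suc n} (true ∷ T) I ind = begin
  (W + d * wsum d {n} (λ _ → 0)) * (suc d * C) ≡⟨ cong (λ z → (W + d * z) * (suc d * C)) (trans (wsum-const d n 0) (*-zeroʳ (suc d ^ n))) ⟩
  (W + d * 0) * (suc d * C)          ≡⟨ solve 3 (λ w d c → (w :+ d :* con 0) :* ((con 1 :+ d) :* c) := w :* c :+ d :* (w :* c)) refl W d C ⟩
  W * C + d * (W * C)                ≡⟨ cong (λ z → z + d * z) (wsum-⊆-independent d T _ (independent-tail d true ind)) ⟩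
  V + d * V                          ≡⟨ cong (λ z → V + d * z) (wsum-cong d (λ H → ind (true ∷ H) (false ∷ H) (λ { zero () ; (suc x) _ → refl }))) ⟩
  V + d * wsum d (I ∘ (false ∷_))    ∎
  where
  open ≡-Reasoning
  W = wsum d (λ H → 𝟙 (T ⊆ᵇ H) * I (true ∷ H))
  C = suc d ^ card T
  V = wsum d (I ∘ (true ∷_))

wsum-miss-independent : ∀ {n} (T : Subset n) (I : Subset n → ℕ) → Independent 1 T I →
  wsum 1 (λ H → 𝟙 (not (meets T H)) * I H) * 2 ^ card T ≡ wsum 1 I
wsum-miss-independent [] I ind = trans (*-identityʳ _) (+-identityʳ _)
wsum-miss-independent (false ∷ T) I ind = trans
  (solve 3 (λ a b c → (a :+ con 1 :* b) :* c := a :* c :+ con 1 :* (b :* c)) refl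
    (wsum 1 (λ H → 𝟙 (not (meets T H)) * I (true ∷ H))) (wsum 1 (λ H → 𝟙 (not (meets T H)) * I (false ∷ H))) (2 ^ card T))
  (cong₂ (λ a b → a + 1 * b) (wsum-miss-independent T _ (independent-tail 1 true ind))
                             (wsum-miss-independent T _ (independent-tail 1 false ind)))
wsum-miss-independent {suc n} (true ∷ T) I ind = begin
  (wsum 1 {n} (λ _ → 0) + 1 * W) * (2 * C) ≡⟨ cong (λ z → (z + 1 * W) * (2 * C)) (trans (wsum-const 1 n 0) (*-zeroʳ (2 ^ n))) ⟩
  (1 * W) * (2 * C)                ≡⟨ solve 2 (λ w c → (con 1 :* w) :* (con 2 :* c) := w :* c :+ con 1 :* (w :* c)) refl W C ⟩
  W * C + 1 * (W * C)              ≡⟨ cong (λ z → z + 1 * z) (wsum-miss-independent T _ (independent-tail 1 false ind)) ⟩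
  V + 1 * V                        ≡⟨ cong (λ z → z + 1 * V) (wsum-cong 1 (λ H → ind (false ∷ H) (true ∷ H) (λ { zero () ; (suc x) _ → refl }))) ⟩
  wsum 1 (I ∘ (true ∷_)) + 1 * V   ∎
  where
  open ≡-Reasoning
  W = wsum 1 (λ H → 𝟙 (not (meets T H)) * I (false ∷ H))
  C = 2 ^ card T
  V = wsum 1 (I ∘ (false ∷_))

Increasing : ∀ {n} → (Subset n → ℕ) → Set
Increasing I = ∀ H H′ → H ⊑ H′ → I H ≤ I H′

increasing-tail : ∀ {n} {I : Subset (suc n) → ℕ} h → Increasing I → Increasing (I ∘ (h ∷_))
increasing-tail h inc H H′ s = inc (h ∷ H) (h ∷ H′) (λ { zero p → p ; (suc x) p → s x p })

-- A special case of Harris' correlation inequality.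
wsum-miss-increasing : ∀ {n} (T : Subset n) (I : Subset n → ℕ) → Increasing I →
  wsum 1 (λ H → 𝟙 (not (meets T H)) * I H) * 2 ^ card T ≤ wsum 1 I
wsum-miss-increasing [] I inc = ≤-reflexive (trans (*-identityʳ _) (+-identityʳ _))
wsum-miss-increasing (false ∷ T) I inc = ≤-trans (≤-reflexive
  (solve 3 (λ a b c → (a :+ con 1 :* b) :* c := a :* c :+ con 1 :* (b :* c)) refl
    (wsum 1 (λ H → 𝟙 (not (meets T H)) * I (true ∷ H))) (wsum 1 (λ H → 𝟙 (not (meets T H)) * I (false ∷ H))) (2 ^ card T)))
  (+-mono-≤ (wsum-miss-increasing T _ (increasing-tail {I = I} true inc))
            (*-monoʳ-≤ 1 (wsum-miss-increasing T _ (increasing-tail {I = I} false inc))))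
wsum-miss-increasing {suc n} (true ∷ T) I inc = begin
  (wsum 1 {n} (λ _ → 0) + 1 * W) * (2 * C) ≡⟨ cong (λ z → (z + 1 * W) * (2 * C)) (trans (wsum-const 1 n 0) (*-zeroʳ (2 ^ n))) ⟩
  (1 * W) * (2 * C)                ≡⟨ solve 2 (λ w c → (con 1 :* w) :* (con 2 :* c) := w :* c :+ con 1 :* (w :* c)) refl W C ⟩
  W * C + 1 * (W * C)              ≤⟨ +-mono-≤ ih (*-monoʳ-≤ 1 ih) ⟩
  V + 1 * V                        ≤⟨ +-monoˡ-≤ (1 * V) (wsum-mono 1 (λ H → inc (false ∷ H) (true ∷ H) (λ { zero () ; (suc x) p → p }))) ⟩
  wsum 1 (I ∘ (true ∷_)) + 1 * V   ∎
  where
  open ≤-Reasoning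
  W = wsum 1 (λ H → 𝟙 (not (meets T H)) * I (false ∷ H))
  C = 2 ^ card T
  V = wsum 1 (I ∘ (false ∷_))
  ih = wsum-miss-increasing T _ (increasing-tail {I = I} false inc)

-- Janson's inequality

module _ {n : ℕ} where

  hits : List (Subset n) → Subset n → ℕ
  hits []       S = 1
  hits (H ∷ Hs) S = 𝟙 (meets H S) * hits Hs S

  neighbours : Subset n → List (Subset n) → ℕ
  neighbours H []        = 0
  neighbours H (H′ ∷ Hs) = 𝟙 (meets H H′) + neighbours H Hs

  -- Members meeting `H` are left out of the product, which makes it independent of the trace of `S`
  -- on `H`.
  far : Subset n → List (Subset n) → Subset n → ℕ
  far H []        S = 1
  far H (H′ ∷ Hs) S = (if meets H H′ then 1 else 𝟙 (meets H′ S)) * far H Hs S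

  near-miss : Subset n → List (Subset n) → Subset n → ℕ
  near-miss H []        S = 0
  near-miss H (H′ ∷ Hs) S = 𝟙 (meets H H′) * 𝟙 (not (meets (H ∪ H′) S)) + near-miss H Hs S

  meets-mono : ∀ H {S S′ : Subset n} → S ⊑ S′ → meets H S ≡ true → meets H S′ ≡ true
  meets-mono H {S} {S′} s e = let (x , p , q) = meets-witness H S e in meets-true H S′ x p (s x q)

  far-increasing : ∀ H Hs → Increasing (far H Hs)
  far-increasing H []        S S′ s = ≤-refl
  far-increasing H (H′ ∷ Hs) S S′ s with meets H H′
  ... | true  = *-monoʳ-≤ 1 (far-increasing H Hs S S′ s)
  ... | false = *-mono-≤ (𝟙-mono (meets-mono H′ s)) (far-increasing H Hs S S′ s)

  meets-off : ∀ {H H′ : Subset n} S S′ → meets H H′ ≡ false →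
    (∀ x → lookup H x ≡ false → lookup S x ≡ lookup S′ x) → meets H′ S ≡ true → meets H′ S′ ≡ true
  meets-off {H} {H′} S S′ disj agree e with meets-witness H′ S e
  ... | x , p , q with bool-case (lookup H x)
  ...   | inj₁ h = ⊥-elim (true≢false (meets-true H H′ x h p) disj)

  ...   | inj₂ h = meets-true H′ S′ x p (trans (sym (agree x h)) q)


  bool-≡ : ∀ {a b : Bool} → (a ≡ true → b ≡ true) → (b ≡ true → a ≡ true) → a ≡ b
  bool-≡ {true}  f g = sym (f refl)
  bool-≡ {false} {true}  f g = g refl
  bool-≡ {false} {false} f g = refl

  far-independent : ∀ (H : Subset n) Hs → Independent 1 H (far H Hs)
  far-independent H []        S S′ e = refl
  far-independent H (H′ ∷ Hs) S S′ e with bool-case (meets H H′)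
  ... | inj₁ m rewrite m = cong (1 *_) (far-independent H Hs S S′ e)
  ... | inj₂ m rewrite m = cong₂ (λ a b → 𝟙 a * b)
      (bool-≡ (meets-off {H} {H′} S S′ m e) (meets-off {H} {H′} S′ S m (λ x h → sym (e x h))))
      (far-independent H Hs S S′ e)

  hits≤far : ∀ H Hs S → hits Hs S ≤ far H Hs S
  hits≤far H []        S = ≤-refl
  hits≤far H (H′ ∷ Hs) S with meets H H′
  ... | true  = *-mono-≤ (𝟙≤1 (meets H′ S)) (hits≤far H Hs S)
  ... | false = *-monoʳ-≤ (𝟙 (meets H′ S)) (hits≤far H Hs S)


  misses-∪ : ∀ (H H′ S : Subset n) → meets H S ≡ false → meets H′ S ≡ false → meets (H ∪ H′) S ≡ false
  misses-∪ H H′ S a b with bool-case (meets (H ∪ H′) S)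
  ... | inj₂ e = e
  ... | inj₁ e with meets-witness (H ∪ H′) S e
  ...   | x , p , q with bool-case (lookup H x)
  ...     | inj₁ h = ⊥-elim (true≢false (meets-true H S x h q) a)
  ...     | inj₂ h = ⊥-elim (true≢false (meets-true H′ S x
              (trans (cong (_∨ lookup H′ x) (sym h)) (trans (sym (lookup-∪ H H′ x)) p)) q) b)

  -- A set `S` that misses `H` and meets all far members either meets every member or also misses
  -- some neighbour of `H`; that neighbour is then counted by `near-miss`.
  far-split : ∀ H Hs S → meets H S ≡ false → far H Hs S ≤ hits Hs S + near-miss H Hs S * far H Hs S
  far-split H []        S h = s≤s z≤n
  far-split H (H′ ∷ Hs) S h with meets H H′ | bool-case (meets H′ S)
  ... | true  | inj₁ m rewrite m = begin
    f + 0                      ≡⟨ +-identityʳ f ⟩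
    f                          ≤⟨ far-split H Hs S h ⟩
    t + r * f                  ≤⟨ +-mono-≤ (m≤m+n t 0) (*-mono-≤ (m≤n+m r (𝟙 (not (meets (H ∪ H′) S)) + 0)) (m≤m+n f 0)) ⟩
    t + 0 + (𝟙 (not (meets (H ∪ H′) S)) + 0 + r) * (f + 0) ∎
    where
    open ≤-Reasoning
    f = far H Hs S
    t = hits Hs S
    r = near-miss H Hs S
  ... | true  | inj₂ m rewrite m = weigh (meets (H ∪ H′) S) (near-miss H Hs S) (far H Hs S + 0) (misses-∪ H H′ S h m)
    where
    weigh : ∀ b r f → b ≡ false → f ≤ (𝟙 (not b) + 0 + r) * f
    weigh _ r f refl = m≤m+n f (r * f)
  ... | false | inj₁ m rewrite m = begin
    f + 0                      ≡⟨ +-identityʳ f ⟩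
    f                          ≤⟨ far-split H Hs S h ⟩
    t + r * f                  ≤⟨ +-mono-≤ (m≤m+n t 0) (*-monoʳ-≤ r (m≤m+n f 0)) ⟩
    t + 0 + r * (f + 0)        ∎
    where
    open ≤-Reasoning
    f = far H Hs S
    t = hits Hs S
    r = near-miss H Hs S
  ... | false | inj₂ m rewrite m = z≤n

  -- Two members share at most one point; this is written as |H ∪ H′| ≥ 2 J - 1.
  data Spread (J : ℕ) : List (Subset n) → Set where
    []  : Spread J []
    add : ∀ {H Hs} → card H ≡ J → 4 * neighbours H Hs ≤ 2 ^ J →
          (∀ {H′} → H′ ∈ₗ Hs → J + J ≤ suc (card (H ∪ H′))) → Spread J Hs → Spread J (H ∷ Hs)

  module _ {J : ℕ} {H : Subset n} where
    private
      c = 2 ^ J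

    -- `far` is increasing and missing `H ∪ H′` is a decreasing event, so Harris' inequality bounds
    -- the share of each neighbour by 2 to the power `- card (H ∪ H′)`, which is at most 2 / c².
    near-weight : ∀ Hs Fs → (∀ {H′} → H′ ∈ₗ Hs → J + J ≤ suc (card (H ∪ H′))) →
      wsum 1 (λ S → near-miss H Hs S * far H Fs S) * (c * c) ≤ 2 * neighbours H Hs * wsum 1 (far H Fs)
    near-weight [] Fs _ = ≤-reflexive (cong (_* (c * c)) (trans (wsum-const 1 n 0) (*-zeroʳ (2 ^ n))))
    near-weight (H′ ∷ Hs) Fs big = begin
      wsum 1 (λ S → (b * u S + r S) * f S) * (c * c)
        ≡⟨ cong (_* (c * c)) (wsum-cong 1 (λ S → solve 4 (λ b u r f → (b :* u :+ r) :* f := b :* (u :* f) :+ r :* f) refl b (u S) (r S) (f S))) ⟩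
      wsum 1 (λ S → b * (u S * f S) + r S * f S) * (c * c)
        ≡⟨ cong (_* (c * c)) (trans (wsum-+ 1 (λ S → b * (u S * f S)) (λ S → r S * f S)) (cong (_+ R) (wsum-* 1 b (λ S → u S * f S)))) ⟩
      (b * U + R) * (c * c)
        ≡⟨ solve 4 (λ b u r c → (b :* u :+ r) :* c := b :* (u :* c) :+ r :* c) refl b U R (c * c) ⟩
      b * (U * (c * c)) + R * (c * c)
        ≤⟨ +-mono-≤ (*-monoʳ-≤ b one) (near-weight Hs Fs (λ i → big (there i))) ⟩
      b * (2 * M) + 2 * k * M
        ≡⟨ solve 3 (λ b k m → b :* (con 2 :* m) :+ con 2 :* k :* m := con 2 :* (b :+ k) :* m) refl b k M ⟩
      2 * (b + k) * M ∎
      where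
      open ≤-Reasoning
      open import Data.List.Relation.Unary.Any using (there; here)
      b = 𝟙 (meets H H′)
      u r f : Subset n → ℕ
      u S = 𝟙 (not (meets (H ∪ H′) S))
      r = near-miss H Hs
      f = far H Fs
      U = wsum 1 (λ S → u S * f S)
      R = wsum 1 (λ S → r S * f S)
      M = wsum 1 f
      k = neighbours H Hs
      one : U * (c * c) ≤ 2 * M
      one = begin
        U * (c * c)                     ≡⟨ cong (U *_) (sym (^-distribˡ-+-* 2 J J)) ⟩
        U * 2 ^ (J + J)                 ≤⟨ *-monoʳ-≤ U (^-monoʳ-≤ 2 (big (here refl))) ⟩
        U * (2 * 2 ^ card (H ∪ H′))     ≡⟨ solve 2 (λ u e → u :* (con 2 :* e) := con 2 :* (u :* e)) refl U (2 ^ card (H ∪ H′)) ⟩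
        2 * (U * 2 ^ card (H ∪ H′))     ≤⟨ *-monoʳ-≤ 2 (wsum-miss-increasing (H ∪ H′) f (far-increasing H Fs)) ⟩
        2 * M                           ∎

    -- By independence, missing `H` costs exactly a factor 1 / c on `far`. Near misses take away at
    -- most half of what is left, because `4 * neighbours H Hs ≤ c`. Hence the sets that meet all of
    -- `Hs` but miss `H` have at least 1 / (2 c) of the weight of `far`, and `hits` is below `far`.
    miss-weight : ∀ Hs → card H ≡ J → 4 * neighbours H Hs ≤ c →
      (∀ {H′} → H′ ∈ₗ Hs → J + J ≤ suc (card (H ∪ H′))) →
      wsum 1 (hits Hs) ≤ 2 * c * wsum 1 (λ S → 𝟙 (not (meets H S)) * hits Hs S)
    miss-weight Hs hJ k≤ big = ≤-trans (wsum-mono 1 (hits≤far H Hs)) (*-cancelˡ-≤ c {{m^n≢0 2 J}} M≤)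
      where
      open ≤-Reasoning
      v : Subset n → ℕ
      v S = 𝟙 (not (meets H S))
      f = far H Hs
      M = wsum 1 f
      X = wsum 1 (λ S → v S * hits Hs S)
      R = wsum 1 (λ S → near-miss H Hs S * f S)
      k = neighbours H Hs
      point : ∀ S → v S * f S ≤ v S * hits Hs S + near-miss H Hs S * f S
      point S with bool-case (meets H S)
      ... | inj₁ e rewrite e = z≤n
      ... | inj₂ e rewrite e = ≤-trans (≤-reflexive (+-identityʳ (f S))) (≤-trans (far-split H Hs S e)
              (+-monoˡ-≤ (near-miss H Hs S * f S) (m≤m+n (hits Hs S) 0)))
      step : c * M ≤ c * c * X + 2 * k * M
      step = begin
        c * M                                  ≡⟨ cong (c *_) (sym (wsum-miss-independent H f (far-independent H Hs))) ⟩
        c * (wsum 1 (λ S → v S * f S) * 2 ^ card H) ≡⟨ cong (λ z → c * (wsum 1 (λ S → v S * f S) * 2 ^ z)) hJ ⟩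
        c * (wsum 1 (λ S → v S * f S) * c)     ≤⟨ *-monoʳ-≤ c (*-monoˡ-≤ c (wsum-mono 1 point)) ⟩
        c * (wsum 1 (λ S → v S * hits Hs S + near-miss H Hs S * f S) * c)
          ≡⟨ cong (λ z → c * (z * c)) (wsum-+ 1 (λ S → v S * hits Hs S) (λ S → near-miss H Hs S * f S)) ⟩
        c * ((X + R) * c)                      ≡⟨ solve 3 (λ c x r → c :* ((x :+ r) :* c) := c :* c :* x :+ r :* (c :* c)) refl c X R ⟩
        c * c * X + R * (c * c)                ≤⟨ +-monoʳ-≤ (c * c * X) (near-weight Hs Hs big) ⟩
        c * c * X + 2 * k * M                  ∎
      M≤ : c * M ≤ c * (2 * c * X)
      M≤ = +-cancelʳ-≤ (c * M) (c * M) (c * (2 * c * X)) (begin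
        c * M + c * M                          ≤⟨ +-mono-≤ step step ⟩
        (c * c * X + 2 * k * M) + (c * c * X + 2 * k * M)
          ≡⟨ solve 4 (λ c x k m → (c :* c :* x :+ con 2 :* k :* m) :+ (c :* c :* x :+ con 2 :* k :* m)
                := c :* (con 2 :* c :* x) :+ con 4 :* k :* m) refl c X k M ⟩
        c * (2 * c * X) + 4 * k * M            ≤⟨ +-monoʳ-≤ (c * (2 * c * X)) (*-monoˡ-≤ M k≤) ⟩
        c * (2 * c * X) + c * M                ∎)

  -- Janson's inequality for the event that a uniformly random set meets every member of a list.
  hits-weight : ∀ {J Hs} e → suc e ≡ 2 * 2 ^ J → Spread J Hs →
    wsum 1 (hits Hs) * suc e ^ length Hs ≤ 2 ^ n * e ^ length Hs
  hits-weight e e≡ [] = ≤-reflexive (cong (_* 1) (trans (wsum-const 1 n 1) (*-identityʳ (2 ^ n))))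
  hits-weight {J} e e≡ (add {H} {Hs} hJ k≤ big spread) = begin
    Y * (suc e * suc e ^ r)         ≡⟨ solve 3 (λ y a b → y :* (a :* b) := (a :* y) :* b) refl Y (suc e) (suc e ^ r) ⟩
    (suc e * Y) * suc e ^ r         ≤⟨ *-monoˡ-≤ (suc e ^ r) Y≤ ⟩
    (e * W) * suc e ^ r             ≡⟨ *-assoc e W (suc e ^ r) ⟩
    e * (W * suc e ^ r)             ≤⟨ *-monoʳ-≤ e (hits-weight e e≡ spread) ⟩
    e * (2 ^ n * e ^ r)             ≡⟨ solve 3 (λ a b c → a :* (b :* c) := b :* (a :* c)) refl e (2 ^ n) (e ^ r) ⟩
    2 ^ n * (e * e ^ r)             ∎
    where
    open ≤-Reasoning
    r = length Hs
    W = wsum 1 (hits Hs)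
    Y = wsum 1 (λ S → 𝟙 (meets H S) * hits Hs S)
    X = wsum 1 (λ S → 𝟙 (not (meets H S)) * hits Hs S)
    split : ∀ b h → 𝟙 b * h + 𝟙 (not b) * h ≡ h
    split true  h = trans (+-identityʳ (h + 0)) (+-identityʳ h)
    split false h = +-identityʳ h
    Y+X : Y + X ≡ W
    Y+X = trans (sym (wsum-+ 1 (λ S → 𝟙 (meets H S) * hits Hs S) (λ S → 𝟙 (not (meets H S)) * hits Hs S)))
      (wsum-cong 1 (λ S → split (meets H S) (hits Hs S)))
    W≤ : W ≤ suc e * X
    W≤ = subst (λ z → W ≤ z * X) (sym e≡) (miss-weight Hs hJ k≤ big)
    Y≤ : suc e * Y ≤ e * W
    Y≤ = +-cancelʳ-≤ W (suc e * Y) (e * W) (begin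
      suc e * Y + W         ≤⟨ +-monoʳ-≤ (suc e * Y) W≤ ⟩
      suc e * Y + suc e * X ≡⟨ sym (*-distribˡ-+ (suc e) Y X) ⟩
      suc e * (Y + X)       ≡⟨ cong (suc e *_) Y+X ⟩
      W + e * W             ≡⟨ +-comm W (e * W) ⟩
      e * W + W             ∎)

-- Binomial coefficients.

nC0≡1 : ∀ n → n C 0 ≡ 1
nC0≡1 zero = refl
nC0≡1 (suc n) = refl

-- The exact ratio of the two coefficients is (i - j) / (j + 1), and `i - j` is at least 1. Pascal's
-- rule gives the inequality without division.
nCj≤[j+1]nC[j+1] : ∀ i j → j < i → i C j ≤ suc j * (i C suc j)
nCj≤[j+1]nC[j+1] (suc i) zero    _ =
  ≤-trans (≤-reflexive (nC0≡1 (suc i))) (≤-trans (s≤s z≤n) (≤-reflexive (sym (trans (+-identityʳ _) (nC1≡n (suc i))))))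
nCj≤[j+1]nC[j+1] (suc i) (suc j) (s≤s j<i) = begin
  suc i C suc j                    ≡⟨ sym (nCk+nC[k+1]≡[n+1]C[k+1] i j) ⟩
  i C j + u                        ≤⟨ +-monoˡ-≤ u (nCj≤[j+1]nC[j+1] i j j<i) ⟩
  suc j * u + u                    ≡⟨ +-comm (suc j * u) u ⟩
  suc (suc j) * u                  ≤⟨ *-monoʳ-≤ (suc (suc j)) (m≤m+n u (i C suc (suc j))) ⟩
  suc (suc j) * (u + i C suc (suc j)) ≡⟨ cong (suc (suc j) *_) (nCk+nC[k+1]≡[n+1]C[k+1] i (suc j)) ⟩
  suc (suc j) * (suc i C suc (suc j)) ∎
  where
  open ≤-Reasoning
  u = i C suc j

-- The indicator pays for the case `i = j`, in which the next coefficient vanishes. Summed over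
-- lines, this bounds a moment by a number of lines plus `t` times the next moment.
nCj≤𝟙+t*nC[j+1] : ∀ i j {t} → i ≤ t → i C j ≤ 𝟙 (j ≤ᵇ i) + t * (i C suc j)
nCj≤𝟙+t*nC[j+1] i j {t} i≤t with <-cmp j i
... | tri< j<i _ _ = ≤-trans (nCj≤[j+1]nC[j+1] i j j<i)
        (≤-trans (*-monoˡ-≤ (i C suc j) (≤-trans j<i i≤t)) (m≤n+m _ (𝟙 (j ≤ᵇ i))))
... | tri≈ _ refl _ = ≤-trans (≤-reflexive (nCn≡1 i))
        (≤-trans (≤-reflexive (cong 𝟙 (sym (does-yes (i ≤? i) ≤-refl)))) (m≤m+n _ _))
... | tri> _ _ i<j = ≤-trans (≤-reflexive (k>n⇒nCk≡0 i<j)) z≤n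

≤ᵇ-suc : ∀ j m → (suc j ≤ᵇ suc m) ≡ (j ≤ᵇ m)
≤ᵇ-suc zero    m = refl
≤ᵇ-suc (suc j) m = refl

-- The union bound over the j-element subsets of B.
wsum-≥-weight : ∀ d {n} (B : Subset n) j →
  wsum d (λ H → 𝟙 (j ≤ᵇ card (H ∩ B))) * suc d ^ j ≤ (card B C j) * suc d ^ n
wsum-≥-weight d [] zero    = ≤-refl
wsum-≥-weight d [] (suc j) = z≤n
wsum-≥-weight d {suc n} (false ∷ B) j = begin
  (wsum d (λ H → 𝟙 (j ≤ᵇ 𝟙 (true ∧ false) + card (H ∩ B))) + d * W) * D ≡⟨⟩
  (W + d * W) * D        ≡⟨ solve 3 (λ w d e → (w :+ d :* w) :* e := (con 1 :+ d) :* (w :* e)) refl W d D ⟩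
  suc d * (W * D)        ≤⟨ *-monoʳ-≤ (suc d) (wsum-≥-weight d B j) ⟩
  suc d * (c * suc d ^ n) ≡⟨ solve 3 (λ a b e → a :* (b :* e) := b :* (a :* e)) refl (suc d) c (suc d ^ n) ⟩
  c * (suc d * suc d ^ n) ∎
  where
  open ≤-Reasoning
  W = wsum d (λ H → 𝟙 (j ≤ᵇ card (H ∩ B)))
  D = suc d ^ j
  c = card B C j
wsum-≥-weight d {suc n} (true ∷ B) zero = ≤-trans
  (≤-reflexive (trans (*-identityʳ _) (trans (wsum-const d (suc n) 1) (*-comm (suc d ^ suc n) 1))))
  (*-monoˡ-≤ (suc d ^ suc n) (≤-reflexive (sym (nC0≡1 (suc (card B))))))
wsum-≥-weight d {suc n} (true ∷ B) (suc j) = begin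
  (wsum d (λ H → 𝟙 (suc j ≤ᵇ suc (card (H ∩ B)))) + d * V) * (suc d * D)
    ≡⟨ cong (λ z → (z + d * V) * (suc d * D)) (wsum-cong d (λ H → cong 𝟙 (≤ᵇ-suc j (card (H ∩ B))))) ⟩
  (W + d * V) * (suc d * D)
    ≡⟨ solve 4 (λ w d v e → (w :+ d :* v) :* ((con 1 :+ d) :* e) := (con 1 :+ d) :* (w :* e) :+ d :* (v :* ((con 1 :+ d) :* e))) refl W d V D ⟩
  suc d * (W * D) + d * (V * (suc d * D))
    ≤⟨ +-mono-≤ (*-monoʳ-≤ (suc d) (wsum-≥-weight d B j)) (≤-trans (*-monoʳ-≤ d (wsum-≥-weight d B (suc j))) (*-monoˡ-≤ _ (n≤1+n d))) ⟩
  suc d * ((card B C j) * E) + suc d * ((card B C suc j) * E)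
    ≡⟨ solve 4 (λ s a b e → s :* (a :* e) :+ s :* (b :* e) := (a :+ b) :* (s :* e)) refl (suc d) (card B C j) (card B C suc j) E ⟩
  (card B C j + card B C suc j) * (suc d * E)
    ≡⟨ cong (_* (suc d * E)) (nCk+nC[k+1]≡[n+1]C[k+1] (card B) j) ⟩
  (suc (card B) C suc j) * (suc d * E) ∎
  where
  open ≤-Reasoning
  W = wsum d (λ H → 𝟙 (j ≤ᵇ card (H ∩ B)))
  V = wsum d (λ H → 𝟙 (suc j ≤ᵇ card (H ∩ B)))
  D = suc d ^ j
  E = suc d ^ n

2xy-ordered : ∀ x y → x ≤ y → 2 * (x * y) ≤ x * x + y * y
2xy-ordered x y x≤y = subst (λ y → 2 * (x * y) ≤ x * x + y * y) (m+[n∸m]≡n x≤y)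
  (≤-trans (m≤m+n _ (k * k)) (≤-reflexive
    (solve 2 (λ x k → con 2 :* (x :* (x :+ k)) :+ k :* k := x :* x :+ (x :+ k) :* (x :+ k)) refl x k)))
  where k = y ∸ x

2xy≤x²+y² : ∀ x y → 2 * (x * y) ≤ x * x + y * y
2xy≤x²+y² x y with ≤-total x y
... | inj₁ x≤y = 2xy-ordered x y x≤y
... | inj₂ y≤x = ≤-trans (≤-reflexive (cong (2 *_) (*-comm x y))) (≤-trans (2xy-ordered y x y≤x) (≤-reflexive (+-comm (y * y) (x * x))))

-- Boolean existential quantifiers.

any : ∀ {n} → (Fin n → Bool) → Bool
any {zero}  f = false
any {suc n} f = f zero ∨ any (f ∘ suc)

any-true : ∀ {n} (f : Fin n → Bool) i → f i ≡ true → any f ≡ true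
any-true f zero    e rewrite e = refl
any-true f (suc i) e with f zero
... | true  = refl
... | false = any-true (f ∘ suc) i e

any-witness : ∀ {n} (f : Fin n → Bool) → any f ≡ true → ∃ λ i → f i ≡ true
any-witness {suc n} f e with bool-case (f zero)
... | inj₁ h = zero , h
... | inj₂ h rewrite h = let (i , h′) = any-witness (f ∘ suc) e in suc i , h′

any-cong : ∀ {n} {f g : Fin n → Bool} → (∀ i → f i ≡ g i) → any f ≡ any g
any-cong {zero}  e = refl
any-cong {suc n} e = cong₂ _∨_ (e zero) (any-cong (e ∘ suc))

not-true : ∀ {b} → not b ≡ true → b ≡ false
not-true {false} _ = refl

not-any : ∀ {n} (f : Fin n → Bool) → not (any f) ≡ true → ∀ i → f i ≡ false
not-any f h i with bool-case (f i)
... | inj₂ e = e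
... | inj₁ e = ⊥-elim (true≢false (any-true f i e) (not-true h))

none-true : ∀ {n} (f : Fin n → Bool) → (∀ i → f i ≡ false) → not (any f) ≡ true
none-true f h with bool-case (any f)
... | inj₂ e = cong not e
... | inj₁ e = let (i , e′) = any-witness f e in ⊥-elim (true≢false e′ (h i))

-- Nets of lines

-- Points are sorted into p lines by each of s parallel classes; ln a x is the line of class a through x.
module Lines {s p N : ℕ} (ln : Fin s → Fin N → Fin p) where

  line : Fin s → Fin p → Subset N
  line a b = tabulate (λ x → ln a x == b)

  load : Subset N → Fin s → Fin p → ℕ
  load A a b = card (A ∩ line a b)

  on-line : ∀ a b x → lookup (line a b) x ≡ (ln a x == b)
  on-line a b x = lookup∘tabulate (λ x → ln a x == b) x

  load-sum : ∀ A a b → load A a b ≡ sum (λ x → 𝟙 (lookup A x) * 𝟙 (ln a x == b))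
  load-sum A a b = trans (card-∩ A (line a b)) (sum-cong-≗ (λ x → cong (λ z → 𝟙 (lookup A x) * 𝟙 z) (on-line a b x)))

  load-mono : ∀ {A A′} a b → A ⊑ A′ → load A a b ≤ load A′ a b
  load-mono {A} {A′} a b h = card-mono {S = A ∩ line a b} {T = A′ ∩ line a b}
    (λ x e → ∩-join A′ (line a b) x (h x (∩⊑ˡ A (line a b) x e)) (∩⊑ʳ A (line a b) x e))

  -- Every point lies on exactly one line of class `a`, so a sum taken line by line is a sum over
  -- points.
  class-sum : ∀ (h : Fin N → ℕ) (f : Fin p → ℕ) a →
    sum (λ b → f b * sum (λ x → h x * 𝟙 (ln a x == b))) ≡ sum (λ x → h x * f (ln a x))
  class-sum h f a = begin
    sum (λ b → f b * sum (λ x → h x * 𝟙 (ln a x == b)))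
      ≡⟨ sum-cong-≗ (λ b → *-distribˡ-sum (f b) (λ x → h x * 𝟙 (ln a x == b))) ⟩
    sum (λ b → sum (λ x → f b * (h x * 𝟙 (ln a x == b))))
      ≡⟨ ∑-comm (λ b x → f b * (h x * 𝟙 (ln a x == b))) ⟩
    sum (λ x → sum (λ b → f b * (h x * 𝟙 (ln a x == b))))
      ≡⟨ sum-cong-≗ (λ x → trans
           (sum-cong-≗ (λ b → solve 3 (λ f h i → f :* (h :* i) := i :* (h :* f)) refl (f b) (h x) (𝟙 (ln a x == b))))
           (∑-pick (ln a x) (λ b → h x * f b))) ⟩
    sum (λ x → h x * f (ln a x)) ∎
    where open ≡-Reasoning

  class-load : ∀ A (f : Fin p → ℕ) a → sum (λ b → f b * load A a b) ≡ sum (λ x → 𝟙 (lookup A x) * f (ln a x))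
  class-load A f a = trans (sum-cong-≗ (λ b → cong (f b *_) (load-sum A a b))) (class-sum (λ x → 𝟙 (lookup A x)) f a)

  -- Each class partitions the points.
  class-total : ∀ A a → sum (load A a) ≡ card A
  class-total A a = trans (sum-cong-≗ (λ b → sym (+-identityʳ (load A a b))))
    (trans (class-load A (λ _ → 1) a) (sum-cong-≗ (λ x → *-identityʳ (𝟙 (lookup A x)))))

module Net {p N : ℕ} (ln : Fin p → Fin N → Fin p)
  (meet : ∀ {a a′ x y} → x ≢ y → ln a x ≡ ln a y → ln a′ x ≡ ln a′ y → a ≡ a′) where

  open Lines ln public

  ∑ₗ : (Fin p → Fin p → ℕ) → ℕ
  ∑ₗ f = sum (λ a → sum (f a))

  ∑ₗ-mono : ∀ {f g} → (∀ a b → f a b ≤ g a b) → ∑ₗ f ≤ ∑ₗ g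
  ∑ₗ-mono h = ∑-mono (λ a → ∑-mono (h a))

  ∑ₗ-+ : ∀ f g → ∑ₗ (λ a b → f a b + g a b) ≡ ∑ₗ f + ∑ₗ g
  ∑ₗ-+ f g = trans (sum-cong-≗ (λ a → ∑-distrib-+ (f a) (g a))) (∑-distrib-+ (λ a → sum (f a)) (λ a → sum (g a)))

  ∑ₗ-* : ∀ c f → ∑ₗ (λ a b → c * f a b) ≡ c * ∑ₗ f
  ∑ₗ-* c f = sym (trans (*-distribˡ-sum c (λ a → sum (f a))) (sum-cong-≗ (λ a → *-distribˡ-sum c (f a))))

  ∑ₗ-const : ∀ c → ∑ₗ (λ _ _ → c) ≡ p * (p * c)
  ∑ₗ-const c = trans (∑-const p (sum {p} (λ _ → c))) (cong (p *_) (∑-const p c))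

  load-swap : ∀ A (f : Fin p → Fin p → ℕ) → ∑ₗ (λ a b → f a b * load A a b) ≡ sum (λ x → 𝟙 (lookup A x) * sum (λ a → f a (ln a x)))
  load-swap A f = begin
    ∑ₗ (λ a b → f a b * load A a b)                          ≡⟨ sum-cong-≗ (λ a → class-load A (f a) a) ⟩
    sum (λ a → sum (λ x → 𝟙 (lookup A x) * f a (ln a x)))    ≡⟨ ∑-comm (λ a x → 𝟙 (lookup A x) * f a (ln a x)) ⟩
    sum (λ x → sum (λ a → 𝟙 (lookup A x) * f a (ln a x)))
      ≡⟨ sum-cong-≗ (λ x → sym (*-distribˡ-sum (𝟙 (lookup A x)) (λ a → f a (ln a x)))) ⟩
    sum (λ x → 𝟙 (lookup A x) * sum (λ a → f a (ln a x)))    ∎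
    where open ≡-Reasoning

  ∑-load : ∀ A → ∑ₗ (load A) ≡ p * card A
  ∑-load A = trans (sum-cong-≗ (class-total A)) (∑-const p (card A))

  -- Two distinct points lie on at most one common line.
  ∑-load² : ∀ A → ∑ₗ (λ a b → load A a b * load A a b) ≤ card A * (card A + p)
  ∑-load² A = begin
    ∑ₗ (λ a b → load A a b * load A a b)
      ≡⟨ load-swap A (load A) ⟩
    sum (λ x → 𝟙 (lookup A x) * sum (λ a → load A a (ln a x)))
      ≤⟨ ∑-mono (λ x → *-monoʳ-≤ (𝟙 (lookup A x)) (through x)) ⟩
    sum (λ x → 𝟙 (lookup A x) * (card A + p))
      ≡⟨ sym (*-distribʳ-sum (card A + p) (λ x → 𝟙 (lookup A x))) ⟩
    card A * (card A + p) ∎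
    where
    open ≤-Reasoning
    common : ∀ x y → sum (λ a → 𝟙 (ln a y == ln a x)) ≤ 1 + 𝟙 (x == y) * p
    common x y with x ≟ᶠ y
    ... | yes refl = ≤-trans (∑-bound {p} {c = 1} (λ a → 𝟙≤1 (ln a x == ln a x)))
                       (≤-trans (≤-reflexive (trans (*-identityʳ p) (sym (+-identityʳ p)))) (n≤1+n (p + 0)))
    ... | no x≢y = ≤-trans (∑-unique≤1 (λ a → ln a y == ln a x) (λ {a} {a′} e e′ →
                       meet (λ q → x≢y (sym q)) (does-true (ln a y ≟ᶠ ln a x) e) (does-true (ln a′ y ≟ᶠ ln a′ x) e′)))
                       (m≤m+n 1 0)
    through : ∀ x → sum (λ a → load A a (ln a x)) ≤ card A + p
    through x = begin
      sum (λ a → load A a (ln a x))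
        ≡⟨ sum-cong-≗ (λ a → load-sum A a (ln a x)) ⟩
      sum (λ a → sum (λ y → 𝟙 (lookup A y) * 𝟙 (ln a y == ln a x)))
        ≡⟨ ∑-comm (λ a y → 𝟙 (lookup A y) * 𝟙 (ln a y == ln a x)) ⟩
      sum (λ y → sum (λ a → 𝟙 (lookup A y) * 𝟙 (ln a y == ln a x)))
        ≡⟨ sum-cong-≗ (λ y → sym (*-distribˡ-sum (𝟙 (lookup A y)) (λ a → 𝟙 (ln a y == ln a x)))) ⟩
      sum (λ y → 𝟙 (lookup A y) * sum (λ a → 𝟙 (ln a y == ln a x)))
        ≤⟨ ∑-mono (λ y → *-monoʳ-≤ (𝟙 (lookup A y)) (common x y)) ⟩
      sum (λ y → 𝟙 (lookup A y) * (1 + 𝟙 (x == y) * p))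
        ≤⟨ ∑-mono (λ y → ≤-trans (≤-reflexive (*-distribˡ-+ (𝟙 (lookup A y)) 1 (𝟙 (x == y) * p)))
             (+-mono-≤ (≤-reflexive (*-identityʳ _)) (≤-trans (*-monoˡ-≤ (𝟙 (x == y) * p) (𝟙≤1 (lookup A y))) (≤-reflexive (+-identityʳ _))))) ⟩
      sum (λ y → 𝟙 (lookup A y) + 𝟙 (x == y) * p)
        ≡⟨ ∑-distrib-+ (λ y → 𝟙 (lookup A y)) (λ y → 𝟙 (x == y) * p) ⟩
      card A + sum (λ y → 𝟙 (x == y) * p)
        ≡⟨ cong (card A +_) (∑-pick x (λ _ → p)) ⟩
      card A + p ∎

  heavy : ℕ → Subset N → Fin p → Fin p → Bool
  heavy κ A a b = κ ≤ᵇ load A a b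

  heavy-mono : ∀ {κ A A′} a b → A ⊑ A′ → heavy κ A a b ≡ true → heavy κ A′ a b ≡ true
  heavy-mono {κ} {A} {A′} a b h e =
    does-yes (κ ≤? load A′ a b) (≤-trans (does-true (κ ≤? load A a b) e) (load-mono {A} {A′} a b h))

  -- A second moment argument. Light lines carry at most a quarter of the `p * card A` incidences,
  -- so heavy lines carry three quarters, and `∑-load²` prevents a small number of lines from
  -- carrying that much.
  many-heavy : ∀ κ A → 4 * (p * κ) ≤ card A → p ≤ card A → 1 ≤ card A →
    p * p ≤ 4 * ∑ₗ (λ a b → 𝟙 (heavy κ A a b))
  many-heavy κ A κ≤ p≤ 1≤ = *-cancelˡ-≤ (c * c) {{>-nonZero (*-mono-≤ 1≤ 1≤)}} (+-cancelˡ-≤ (2 * (c * c * (p * p))) _ _ final)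
    where
    open ≤-Reasoning
    c = card A
    n₀ = ∑ₗ (λ a b → 𝟙 (heavy κ A a b))
    Y = ∑ₗ (λ a b → 𝟙 (heavy κ A a b) * load A a b)
    light : ∀ a b → load A a b ≤ 𝟙 (heavy κ A a b) * load A a b + κ
    light a b with bool-case (heavy κ A a b)
    ... | inj₁ e rewrite e = ≤-trans (m≤m+n _ κ) (+-monoˡ-≤ κ (m≤m+n _ 0))
    ... | inj₂ e rewrite e = <⇒≤ (≰⇒> (does-false (κ ≤? load A a b) e))
    total : p * c ≤ Y + p * (p * κ)
    total = begin
      p * c                              ≡⟨ sym (∑-load A) ⟩
      ∑ₗ (load A)                        ≤⟨ ∑ₗ-mono light ⟩
      ∑ₗ (λ a b → 𝟙 (heavy κ A a b) * load A a b + κ) ≡⟨ ∑ₗ-+ (λ a b → 𝟙 (heavy κ A a b) * load A a b) (λ _ _ → κ) ⟩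
      Y + ∑ₗ (λ _ _ → κ)                 ≡⟨ cong (Y +_) (∑ₗ-const κ) ⟩
      Y + p * (p * κ)                    ∎
    3≤ : 3 * (p * c) ≤ 4 * Y
    3≤ = +-cancelʳ-≤ (p * c) _ _ (begin
      3 * (p * c) + p * c                ≡⟨ solve 1 (λ x → con 3 :* x :+ x := con 4 :* x) refl (p * c) ⟩
      4 * (p * c)                        ≤⟨ *-monoʳ-≤ 4 total ⟩
      4 * (Y + p * (p * κ))              ≡⟨ solve 3 (λ y p k → con 4 :* (y :+ p :* (p :* k)) := con 4 :* y :+ p :* (con 4 :* (p :* k))) refl Y p κ ⟩
      4 * Y + p * (4 * (p * κ))          ≤⟨ +-monoʳ-≤ (4 * Y) (*-monoʳ-≤ p κ≤) ⟩
      4 * Y + p * c                      ∎)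
    -- Cauchy-Schwarz in linear form: 2 x y ≤ x² + y² with `x = p * l` and `y = 2 * c`, balanced for
    -- lines of twice the mean load.
    point : ∀ a b → 4 * (p * c) * (𝟙 (heavy κ A a b) * load A a b)
                    ≤ p * p * (load A a b * load A a b) + 4 * (c * c) * 𝟙 (heavy κ A a b)
    point a b with heavy κ A a b
    ... | false = ≤-trans (≤-reflexive (*-zeroʳ (4 * (p * c)))) z≤n
    ... | true = begin
      4 * (p * c) * (l + 0)              ≡⟨ solve 3 (λ p c l → con 4 :* (p :* c) :* (l :+ con 0) := con 2 :* ((p :* l) :* (con 2 :* c))) refl p c l ⟩
      2 * ((p * l) * (2 * c))            ≤⟨ 2xy≤x²+y² (p * l) (2 * c) ⟩
      (p * l) * (p * l) + (2 * c) * (2 * c)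
        ≡⟨ solve 3 (λ p c l → (p :* l) :* (p :* l) :+ (con 2 :* c) :* (con 2 :* c) := p :* p :* (l :* l) :+ con 4 :* (c :* c) :* con 1) refl p c l ⟩
      p * p * (l * l) + 4 * (c * c) * 1  ∎
      where l = load A a b
    L2 = ∑ₗ (λ a b → load A a b * load A a b)
    sums : 4 * (p * c) * Y ≤ p * p * L2 + 4 * (c * c) * n₀
    sums = begin
      4 * (p * c) * Y                    ≡⟨ sym (∑ₗ-* (4 * (p * c)) (λ a b → 𝟙 (heavy κ A a b) * load A a b)) ⟩
      ∑ₗ (λ a b → 4 * (p * c) * (𝟙 (heavy κ A a b) * load A a b)) ≤⟨ ∑ₗ-mono point ⟩
      ∑ₗ (λ a b → p * p * (load A a b * load A a b) + 4 * (c * c) * 𝟙 (heavy κ A a b))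
        ≡⟨ ∑ₗ-+ (λ a b → p * p * (load A a b * load A a b)) (λ a b → 4 * (c * c) * 𝟙 (heavy κ A a b)) ⟩
      ∑ₗ (λ a b → p * p * (load A a b * load A a b)) + ∑ₗ (λ a b → 4 * (c * c) * 𝟙 (heavy κ A a b))
        ≡⟨ cong₂ _+_ (∑ₗ-* (p * p) (λ a b → load A a b * load A a b)) (∑ₗ-* (4 * (c * c)) (λ a b → 𝟙 (heavy κ A a b))) ⟩
      p * p * L2 + 4 * (c * c) * n₀      ∎
    L2≤ : L2 ≤ 2 * (c * c)
    L2≤ = begin
      L2               ≤⟨ ∑-load² A ⟩
      c * (c + p)      ≤⟨ *-monoʳ-≤ c (+-monoʳ-≤ c p≤) ⟩
      c * (c + c)      ≡⟨ solve 1 (λ c → c :* (c :+ c) := con 2 :* (c :* c)) refl c ⟩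
      2 * (c * c)      ∎
    final : 2 * (c * c * (p * p)) + c * c * (p * p) ≤ 2 * (c * c * (p * p)) + c * c * (4 * n₀)
    final = begin
      2 * (c * c * (p * p)) + c * c * (p * p) ≡⟨ solve 2 (λ c p → con 2 :* (c :* c :* (p :* p)) :+ c :* c :* (p :* p) := p :* c :* (con 3 :* (p :* c))) refl c p ⟩
      p * c * (3 * (p * c))              ≤⟨ *-monoʳ-≤ (p * c) 3≤ ⟩
      p * c * (4 * Y)                    ≡⟨ solve 3 (λ p c y → p :* c :* (con 4 :* y) := con 4 :* (p :* c) :* y) refl p c Y ⟩
      4 * (p * c) * Y                    ≤⟨ sums ⟩
      p * p * L2 + 4 * (c * c) * n₀      ≤⟨ +-monoˡ-≤ (4 * (c * c) * n₀) (*-monoʳ-≤ (p * p) L2≤) ⟩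
      p * p * (2 * (c * c)) + 4 * (c * c) * n₀
        ≡⟨ solve 3 (λ p c n → p :* p :* (con 2 :* (c :* c)) :+ con 4 :* (c :* c) :* n := con 2 :* (c :* c :* (p :* p)) :+ c :* c :* (con 4 :* n)) refl p c n₀ ⟩
      2 * (c * c * (p * p)) + c * c * (4 * n₀) ∎

𝟙-*-one : ∀ b c → b ≡ true → 𝟙 b * c ≡ c
𝟙-*-one true c _ = +-identityʳ c

-- Pruning a container by a sample.

module Pruning {p N : ℕ} (ln : Fin p → Fin N → Fin p)
  (meet : ∀ {a a′ x y} → x ≢ y → ln a x ≡ ln a y → ln a′ x ≡ ln a′ y → a ≡ a′) where

  open Net ln meet

  captures : ℕ → ℕ → Subset N → Subset N → Fin N → Fin p → Bool
  captures κ j G A x a = heavy κ A a (ln a x) ∧ (j ≤ᵇ load G a (ln a x))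

  -- The result depends on `κ`, `j`, `G` and `A` only, not on the rest of `Q`; therefore a list of
  -- small samples describes a container. Points of `G` stay even if their lines are captured.
  prune : ℕ → ℕ → Subset N → Subset N → Subset N
  prune κ j G A = tabulate (λ x → lookup A x ∧ (lookup G x ∨ not (any (captures κ j G A x))))

  module _ (κ j : ℕ) (G A : Subset N) where

    prune-lookup : ∀ x → lookup (prune κ j G A) x ≡ (lookup A x ∧ (lookup G x ∨ not (any (captures κ j G A x))))
    prune-lookup x = lookup∘tabulate (λ x → lookup A x ∧ (lookup G x ∨ not (any (captures κ j G A x)))) x

    prune⊑ : prune κ j G A ⊑ A
    prune⊑ x e = proj₁ (∧-split (trans (sym (prune-lookup x)) e))

    survivor : ∀ x → lookup (prune κ j G A) x ≡ true → lookup G x ≡ false → not (any (captures κ j G A x)) ≡ true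
    survivor x e g = trans (cong (_∨ not (any (captures κ j G A x))) (sym g))
      (proj₂ (∧-split {lookup A x} (trans (sym (prune-lookup x)) e)))

    victim : ∀ x → lookup A x ∧ not (lookup (prune κ j G A) x) ≡ true →
      lookup G x ≡ false × ∃ λ a → captures κ j G A x a ≡ true
    victim x e with ∧-split {lookup A x} e
    ... | ax , np with bool-case (lookup G x) | bool-case (any (captures κ j G A x))
    ...   | inj₂ g | inj₁ c = g , any-witness (captures κ j G A x) c
    ...   | inj₁ g | _ = ⊥-elim (true≢false np (cong not (trans (prune-lookup x) (∧-join ax (cong (_∨ not (any (captures κ j G A x))) g)))))
    ...   | inj₂ g | inj₂ c = ⊥-elim (true≢false np (cong not (trans (prune-lookup x)
              (∧-join ax (trans (cong (_∨ not (any (captures κ j G A x))) g) (cong not c))))))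

-- Averages over a random sample of Q.

module Sampling {p N : ℕ} (ln : Fin p → Fin N → Fin p)
  (meet : ∀ {a a′ x y} → x ≢ y → ln a x ≡ ln a y → ln a′ x ≡ ln a′ y → a ≡ a′)
  (Q : Subset N) (t : ℕ) where

  open Net ln meet
  open Pruning ln meet

  -- The number of pairs of a rich line and a j-set spoken of in the overview.
  moment : ℕ → Subset N → ℕ → ℕ
  moment κ A j = ∑ₗ (λ a b → 𝟙 (heavy κ A a b) * (load Q a b C j))

  module Averages (κ j : ℕ) (A : Subset N) (d : ℕ) where

    D = suc d

    sample-size : D * wsum d (λ H → card (Q ∩ H)) ≡ card Q * D ^ N
    sample-size = begin
      D * wsum d (λ H → card (Q ∩ H))
        ≡⟨ cong (D *_) (wsum-cong d (λ H → card-∩ Q H)) ⟩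
      D * wsum d (λ H → sum (λ x → 𝟙 (lookup Q x) * 𝟙 (lookup H x)))
        ≡⟨ cong (D *_) (wsum-∑ d (λ x H → 𝟙 (lookup Q x) * 𝟙 (lookup H x))) ⟩
      D * sum (λ x → wsum d (λ H → 𝟙 (lookup Q x) * 𝟙 (lookup H x)))
        ≡⟨ *-distribˡ-sum D (λ x → wsum d (λ H → 𝟙 (lookup Q x) * 𝟙 (lookup H x))) ⟩
      sum (λ x → D * wsum d (λ H → 𝟙 (lookup Q x) * 𝟙 (lookup H x)))
        ≡⟨ sum-cong-≗ each ⟩
      sum (λ x → 𝟙 (lookup Q x) * D ^ N)
        ≡⟨ sym (*-distribʳ-sum (D ^ N) (λ x → 𝟙 (lookup Q x))) ⟩
      card Q * D ^ N ∎
      where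
      open ≡-Reasoning
      each : ∀ x → D * wsum d (λ H → 𝟙 (lookup Q x) * 𝟙 (lookup H x)) ≡ 𝟙 (lookup Q x) * D ^ N
      each x = begin
        D * wsum d (λ H → q * 𝟙 (lookup H x)) ≡⟨ cong (D *_) (wsum-* d q (λ H → 𝟙 (lookup H x))) ⟩
        D * (q * w)                           ≡⟨ solve 3 (λ d q w → d :* (q :* w) := q :* (d :* w)) refl D q w ⟩
        q * (D * w)                           ≡⟨ cong (q *_) (wsum-member d x) ⟩
        q * D ^ N                             ∎
        where
        q = 𝟙 (lookup Q x)
        w = wsum d (λ H → 𝟙 (lookup H x))

    -- The points of `Q` that this round removes from the container and that E will have to absorb.
    paid : Subset N → ℕ
    paid H = sum (λ x → 𝟙 (lookup Q x) * 𝟙 (lookup A x ∧ not (lookup (prune κ j (Q ∩ H) A) x)))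

    load-assoc : ∀ H a b → load (Q ∩ H) a b ≡ card (H ∩ (Q ∩ line a b))
    load-assoc H a b = sum-cong-≗ (λ x → cong 𝟙 (begin
      lookup ((Q ∩ H) ∩ line a b) x                    ≡⟨ lookup-∩ (Q ∩ H) (line a b) x ⟩
      lookup (Q ∩ H) x ∧ lookup (line a b) x           ≡⟨ cong (_∧ _) (lookup-∩ Q H x) ⟩
      (lookup Q x ∧ lookup H x) ∧ lookup (line a b) x  ≡⟨ swap (lookup Q x) (lookup H x) ⟩
      lookup H x ∧ (lookup Q x ∧ lookup (line a b) x)  ≡⟨ cong (lookup H x ∧_) (sym (lookup-∩ Q (line a b) x)) ⟩
      lookup H x ∧ lookup (Q ∩ line a b) x             ≡⟨ sym (lookup-∩ H (Q ∩ line a b) x) ⟩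
      lookup (H ∩ (Q ∩ line a b)) x                    ∎))
      where
      open ≡-Reasoning
      swap : ∀ q h {l} → (q ∧ h) ∧ l ≡ h ∧ (q ∧ l)
      swap true  h     = refl
      swap false true  = refl
      swap false false = refl

    capture-weight : ∀ a b → wsum d (λ H → 𝟙 (j ≤ᵇ load (Q ∩ H) a b)) * D ^ j ≤ (load Q a b C j) * D ^ N
    capture-weight a b = ≤-trans
      (≤-reflexive (cong (_* D ^ j) (wsum-cong d (λ H → cong (λ z → 𝟙 (j ≤ᵇ z)) (load-assoc H a b)))))
      (wsum-≥-weight d (Q ∩ line a b) j)

    overfull : Fin p → Fin p → ℕ
    overfull a b = 𝟙 (heavy κ A a b) * 𝟙 (suc j ≤ᵇ load Q a b)

    -- A point of Q is pruned only if it is an additional point of Q on a captured line.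
    paid≤ : (∀ a b → load Q a b ≤ t) → ∀ H → paid H ≤ t * ∑ₗ (λ a b → overfull a b * 𝟙 (j ≤ᵇ load (Q ∩ H) a b))
    paid≤ q≤t H = begin
      paid H
        ≤⟨ ∑-mono (λ x → 𝟙-*-mono (lookup Q x) (point x)) ⟩
      sum (λ x → 𝟙 (lookup Q x) * sum (λ a → f a (ln a x)))
        ≡⟨ sym (load-swap Q f) ⟩
      ∑ₗ (λ a b → f a b * load Q a b)
        ≤⟨ ∑ₗ-mono (λ a b → ≤-trans (*-monoʳ-≤ (f a b) (q≤t a b)) (≤-reflexive (*-comm (f a b) t))) ⟩
      ∑ₗ (λ a b → t * f a b)
        ≡⟨ ∑ₗ-* t f ⟩
      t * ∑ₗ f ∎
      where
      open ≤-Reasoning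
      G = Q ∩ H
      f : Fin p → Fin p → ℕ
      f a b = overfull a b * 𝟙 (j ≤ᵇ load G a b)
      point : ∀ x → lookup Q x ≡ true → 𝟙 (lookup A x ∧ not (lookup (prune κ j G A) x)) ≤ sum (λ a → f a (ln a x))
      point x qx with bool-case (lookup A x ∧ not (lookup (prune κ j G A) x))
      ... | inj₂ e = ≤-trans (≤-reflexive (cong 𝟙 e)) z≤n
      ... | inj₁ e with victim κ j G A x e
      ...   | gx , a , cap with ∧-split {heavy κ A a (ln a x)} cap
      ...     | hv , full = ≤-trans (≤-reflexive (trans (cong 𝟙 e) (sym (one hv extra full)))) (∑-term (λ a → f a (ln a x)) a)
        where
        ℓ = line a (ln a x)
        xℓ : lookup ℓ x ≡ true
        xℓ = trans (on-line a (ln a x) x) (does-yes (ln a x ≟ᶠ ln a x) refl)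
        one : ∀ {h o c} → h ≡ true → o ≡ true → c ≡ true → 𝟙 h * 𝟙 o * 𝟙 c ≡ 1
        one refl refl refl = refl
        -- The removed point `x` belongs to `Q` but not to the sample, so it comes on top of the `j`
        -- sampled points of the line. This is why the loss involves level `j + 1`.
        more : suc (load G a (ln a x)) ≤ load Q a (ln a x)
        more = begin
          suc (load G a (ln a x))                                    ≡⟨ +-comm 1 _ ⟩
          load G a (ln a x) + 1                                      ≡⟨ cong (load G a (ln a x) +_) (sym (∑-pick x (λ _ → 1))) ⟩
          load G a (ln a x) + sum (λ y → 𝟙 (x == y) * 1)             ≡⟨ sym (∑-distrib-+ (λ y → 𝟙 (lookup (G ∩ ℓ) y)) (λ y → 𝟙 (x == y) * 1)) ⟩
          sum (λ y → 𝟙 (lookup (G ∩ ℓ) y) + 𝟙 (x == y) * 1)          ≤⟨ ∑-mono gain ⟩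
          load Q a (ln a x)                                          ∎
          where
          gain : ∀ y → 𝟙 (lookup (G ∩ ℓ) y) + 𝟙 (x == y) * 1 ≤ 𝟙 (lookup (Q ∩ ℓ) y)
          gain y with x ≟ᶠ y
          ... | yes refl = ≤-reflexive (trans
                 (cong (λ z → 𝟙 z + 1) (trans (lookup-∩ G ℓ x) (cong (_∧ lookup ℓ x) gx)))
                 (cong 𝟙 (sym (∩-join Q ℓ x qx xℓ))))
          ... | no _ = ≤-trans (≤-reflexive (+-identityʳ _)) (𝟙-mono (λ e′ →
                 ∩-join Q ℓ y (∩⊑ˡ Q H y (∩⊑ˡ G ℓ y e′)) (∩⊑ʳ G ℓ y e′)))
        extra : (suc j ≤ᵇ load Q a (ln a x)) ≡ true
        extra = does-yes (suc j ≤? load Q a (ln a x))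
          (≤-trans (s≤s (does-true (j ≤? load G a (ln a x)) full)) more)

    -- A line is captured with probability at most `load Q a b C j` divided by `D ^ j`. On a line
    -- with more than `j` points of `Q` that coefficient is at most `t` times the next one; the
    -- other factor `t` comes from `paid≤`.
    paid-weight : (∀ a b → load Q a b ≤ t) → wsum d paid * D ^ j ≤ t * (t * moment κ A (suc j)) * D ^ N
    paid-weight q≤t = begin
      wsum d paid * E
        ≤⟨ *-monoˡ-≤ E (wsum-mono d (paid≤ q≤t)) ⟩
      wsum d (λ H → t * ∑ₗ (λ a b → overfull a b * cap a b H)) * E
        ≡⟨ cong (_* E) (trans (wsum-* d t (λ H → ∑ₗ (λ a b → overfull a b * cap a b H))) (cong (t *_) inner)) ⟩
      t * ∑ₗ (λ a b → overfull a b * wsum d (cap a b)) * E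
        ≡⟨ solve 3 (λ t s e → t :* s :* e := t :* (e :* s)) refl t (∑ₗ (λ a b → overfull a b * wsum d (cap a b))) E ⟩
      t * (E * ∑ₗ (λ a b → overfull a b * wsum d (cap a b)))
        ≡⟨ cong (t *_) (sym (∑ₗ-* E (λ a b → overfull a b * wsum d (cap a b)))) ⟩
      t * ∑ₗ (λ a b → E * (overfull a b * wsum d (cap a b)))
        ≤⟨ *-monoʳ-≤ t (∑ₗ-mono line-bound) ⟩
      t * ∑ₗ (λ a b → (t * D ^ N) * (𝟙 (heavy κ A a b) * (load Q a b C suc j)))
        ≡⟨ cong (t *_) (∑ₗ-* (t * D ^ N) (λ a b → 𝟙 (heavy κ A a b) * (load Q a b C suc j))) ⟩
      t * ((t * D ^ N) * moment κ A (suc j))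
        ≡⟨ solve 3 (λ t e m → t :* ((t :* e) :* m) := t :* (t :* m) :* e) refl t (D ^ N) (moment κ A (suc j)) ⟩
      t * (t * moment κ A (suc j)) * D ^ N ∎
      where
      open ≤-Reasoning
      E = D ^ j
      cap : Fin p → Fin p → Subset N → ℕ
      cap a b H = 𝟙 (j ≤ᵇ load (Q ∩ H) a b)
      inner : wsum d (λ H → ∑ₗ (λ a b → overfull a b * cap a b H)) ≡ ∑ₗ (λ a b → overfull a b * wsum d (cap a b))
      inner = trans (wsum-∑ d (λ a H → sum (λ b → overfull a b * cap a b H)))
        (sum-cong-≗ (λ a → trans (wsum-∑ d (λ b H → overfull a b * cap a b H))
          (sum-cong-≗ (λ b → wsum-* d (overfull a b) (cap a b)))))
      line-bound : ∀ a b → E * (overfull a b * wsum d (cap a b)) ≤ (t * D ^ N) * (𝟙 (heavy κ A a b) * (load Q a b C suc j))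
      line-bound a b with suc j ≤? load Q a b
      ... | no j≮ = ≤-trans (≤-reflexive (trans (cong (λ z → E * (𝟙 (heavy κ A a b) * 𝟙 z * wsum d (cap a b))) (does-no (suc j ≤? load Q a b) j≮))
              (solve 3 (λ e h w → e :* (h :* con 0 :* w) := con 0) refl E (𝟙 (heavy κ A a b)) (wsum d (cap a b))))) z≤n
      ... | yes j< = begin
        E * (h * 𝟙 (suc j ≤ᵇ load Q a b) * w)  ≤⟨ *-monoʳ-≤ E (*-monoˡ-≤ w (*-monoʳ-≤ h (𝟙≤1 (suc j ≤ᵇ load Q a b)))) ⟩
        E * (h * 1 * w)                        ≡⟨ solve 3 (λ e h w → e :* (h :* con 1 :* w) := h :* (w :* e)) refl E h w ⟩
        h * (w * E)                            ≤⟨ *-monoʳ-≤ h (capture-weight a b) ⟩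
        h * ((load Q a b C j) * D ^ N)         ≤⟨ *-monoʳ-≤ h (*-monoˡ-≤ (D ^ N) (≤-trans (nCj≤[j+1]nC[j+1] (load Q a b) j j<) (*-monoˡ-≤ c (≤-trans j< (q≤t a b))))) ⟩
        h * (t * c * D ^ N)                    ≡⟨ solve 4 (λ h t c e → h :* (t :* c :* e) := (t :* e) :* (h :* c)) refl h t c (D ^ N) ⟩
        (t * D ^ N) * (h * c)                  ∎
        where
        h = 𝟙 (heavy κ A a b)
        w = wsum d (cap a b)
        c = load Q a b C suc j

    -- Counts the lines through `x` that some sample could capture.
    busy : Fin N → ℕ
    busy x = sum (λ a → 𝟙 (heavy κ A a (ln a x) ∧ (j ≤ᵇ load Q a (ln a x))))

    -- Pairs of a surviving point outside `Q` and a line through it that could have been captured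
    -- but was not. If they are few, then few rich lines with `j` points of `Q` remain.
    rest : Subset N → ℕ
    rest H = sum (λ x → 𝟙 (lookup (prune κ j (Q ∩ H) A) x ∧ not (lookup Q x)) * busy x)

    none : Fin N → Subset N → Bool
    none x H = not (any (captures κ j (Q ∩ H) A x))

    -- For a busy line a choose a set T of j points of Q on it. The events "T ⊆ H and no other line through x
    -- is captured" are disjoint, and each has probability at least D ^ - j times that of none x.
    none-weight : ∀ x → lookup Q x ≡ false → busy x * wsum d (λ H → 𝟙 (none x H)) ≤ D ^ j * D ^ N
    none-weight x x∉Q = begin
      busy x * w
        ≡⟨ *-distribʳ-sum w (λ a → 𝟙 (sel a)) ⟩
      sum (λ a → 𝟙 (sel a) * w)
        ≤⟨ ∑-mono each ⟩
      sum (λ a → E * wsum d (λ H → 𝟙 (event a H)))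
        ≡⟨ sym (*-distribˡ-sum E (λ a → wsum d (λ H → 𝟙 (event a H)))) ⟩
      E * sum (λ a → wsum d (λ H → 𝟙 (event a H)))
        ≡⟨ cong (E *_) (sym (wsum-∑ d (λ a H → 𝟙 (event a H)))) ⟩
      E * wsum d (λ H → sum (λ a → 𝟙 (event a H)))
        ≤⟨ *-monoʳ-≤ E (wsum-mono d (λ H → ∑-unique≤1 (λ a → event a H) (λ {a} {a′} → disjoint H a a′))) ⟩
      E * wsum d {N} (λ _ → 1)
        ≡⟨ cong (E *_) (trans (wsum-const d N 1) (*-identityʳ (D ^ N))) ⟩
      E * D ^ N ∎
      where
      open ≤-Reasoning
      E = D ^ j
      w = wsum d (λ H → 𝟙 (none x H))
      sel : Fin p → Bool
      sel a = heavy κ A a (ln a x) ∧ (j ≤ᵇ load Q a (ln a x))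
      block : Fin p → Subset N
      block a = Q ∩ line a (ln a x)
      others : Fin p → Subset N → Fin p → Bool
      others a H a′ = not (a == a′) ∧ captures κ j (Q ∩ H) A x a′
      other-free : Fin p → Subset N → Bool
      other-free a H = not (any (others a H))
      choose : ∀ a → sel a ≡ true → ∃ λ T → T ⊑ block a × card T ≡ j
      choose a e = subset-of-size (block a) j (does-true (j ≤? load Q a (ln a x)) (proj₂ (∧-split {heavy κ A a (ln a x)} e)))
      target : Fin p → Subset N
      target a with bool-case (sel a)
      ... | inj₁ e = proj₁ (choose a e)
      ... | inj₂ _ = tabulate (λ _ → false)
      target⊑ : ∀ a → sel a ≡ true → target a ⊑ block a
      target⊑ a e with bool-case (sel a)
      ... | inj₁ e′ = proj₁ (proj₂ (choose a e′))
      ... | inj₂ e′ = ⊥-elim (true≢false e e′)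
      target-card : ∀ a → sel a ≡ true → card (target a) ≡ j
      target-card a e with bool-case (sel a)
      ... | inj₁ e′ = proj₂ (proj₂ (choose a e′))
      ... | inj₂ e′ = ⊥-elim (true≢false e e′)
      event : Fin p → Subset N → Bool
      event a H = sel a ∧ ((target a ⊆ᵇ H) ∧ other-free a H)
      -- Two lines through `x` have only `x` in common, and `x` is not in `Q`; so the target on one
      -- line avoids the points of `Q` on all others.
      off-line : ∀ a a′ → sel a ≡ true → a ≢ a′ → ∀ y → lookup (block a′) y ≡ true → lookup (target a) y ≡ false
      off-line a a′ s a≢a′ y y∈ with bool-case (lookup (target a) y)
      ... | inj₂ e = e
      ... | inj₁ e = ⊥-elim (a≢a′ (meet x≢y
              (sym (via a (∩⊑ʳ Q (line a (ln a x)) y (target⊑ a s y e))))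
              (sym (via a′ (∩⊑ʳ Q (line a′ (ln a′ x)) y y∈)))))
        where
        via : ∀ c → lookup (line c (ln c x)) y ≡ true → ln c y ≡ ln c x
        via c h = does-true (ln c y ≟ᶠ ln c x) (trans (sym (on-line c (ln c x) y)) h)
        x≢y : x ≢ y
        x≢y refl = true≢false (∩⊑ˡ Q (line a′ (ln a′ x)) y y∈) x∉Q
      independent : ∀ a → sel a ≡ true → Independent d (target a) (λ H → 𝟙 (other-free a H))
      independent a s H H′ agree = cong (𝟙 ∘ not) (any-cong same)
        where
        same : ∀ a′ → others a H a′ ≡ others a H′ a′
        same a′ with a ≟ᶠ a′
        ... | yes _ = refl
        ... | no a≢a′ = cong (λ z → heavy κ A a′ (ln a′ x) ∧ (j ≤ᵇ z))
          (trans (load-assoc H a′ (ln a′ x)) (trans (sum-cong-≗ point) (sym (load-assoc H′ a′ (ln a′ x)))))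
          where
          point : ∀ y → 𝟙 (lookup (H ∩ block a′) y) ≡ 𝟙 (lookup (H′ ∩ block a′) y)
          point y with bool-case (lookup (block a′) y)
          ... | inj₁ e = cong 𝟙 (trans (lookup-∩ H (block a′) y) (trans
                  (cong (_∧ lookup (block a′) y) (agree y (off-line a a′ s a≢a′ y e))) (sym (lookup-∩ H′ (block a′) y))))
          ... | inj₂ e = cong 𝟙 (trans (lookup-∩ H (block a′) y) (trans (off e) (sym (trans (lookup-∩ H′ (block a′) y) (off e)))))
            where
            off : ∀ {b c} → c ≡ false → b ∧ c ≡ false
            off {true}  e = e
            off {false} e = refl
      none⇒other-free : ∀ a H → none x H ≡ true → other-free a H ≡ true
      none⇒other-free a H e = none-true (others a H) (λ a′ → weaken {not (a == a′)} (not-any (captures κ j (Q ∩ H) A x) e a′))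
        where
        weaken : ∀ {b c} → c ≡ false → b ∧ c ≡ false
        weaken {true}  e = e
        weaken {false} e = refl
      each : ∀ a → 𝟙 (sel a) * w ≤ E * wsum d (λ H → 𝟙 (event a H))
      each a = 𝟙-*-≤ (sel a) λ s → begin
        w
          ≤⟨ wsum-mono d (λ H → 𝟙-mono (none⇒other-free a H)) ⟩
        wsum d (λ H → 𝟙 (other-free a H))
          ≡⟨ sym (wsum-⊆-independent d (target a) (λ H → 𝟙 (other-free a H)) (independent a s)) ⟩
        wsum d (λ H → 𝟙 (target a ⊆ᵇ H) * 𝟙 (other-free a H)) * D ^ card (target a)
          ≡⟨ cong₂ (λ u k → u * D ^ k) (wsum-cong d (λ H → trans (sym (𝟙-∧ (target a ⊆ᵇ H) (other-free a H)))
               (cong 𝟙 (sym (cong (_∧ ((target a ⊆ᵇ H) ∧ other-free a H)) s))))) (target-card a s) ⟩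
        wsum d (λ H → 𝟙 (event a H)) * E
          ≡⟨ *-comm (wsum d (λ H → 𝟙 (event a H))) E ⟩
        E * wsum d (λ H → 𝟙 (event a H)) ∎
      -- `target a` contained in `H` makes the line of class `a` captured, which `other-free a′ H`
      -- forbids.
      disjoint : ∀ H a a′ → event a H ≡ true → event a′ H ≡ true → a ≡ a′
      disjoint H a a′ e e′ with a ≟ᶠ a′
      ... | yes a≡a′ = a≡a′
      ... | no a≢a′ = ⊥-elim (true≢false
              (∧-join (cong not (does-no (a′ ≟ᶠ a) (λ q → a≢a′ (sym q)))) captured)
              (not-any (others a′ H) (proj₂ (∧-split {target a′ ⊆ᵇ H} (proj₂ (∧-split {sel a′} e′)))) a))
        where
        s = proj₁ (∧-split e)
        T⊑H = ⊆ᵇ⇒⊑ (target a) H (proj₁ (∧-split (proj₂ (∧-split {sel a} e))))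
        captured : captures κ j (Q ∩ H) A x a ≡ true
        captured = ∧-join (proj₁ (∧-split s)) (does-yes (j ≤? load (Q ∩ H) a (ln a x))
          (subst (j ≤_) (sym (load-assoc H a (ln a x)))
            (subst (_≤ card (H ∩ block a)) (target-card a s)
              (card-mono {S = target a} {T = H ∩ block a} (λ y h → ∩-join H (block a) y (T⊑H y h) (target⊑ a s y h))))))

    -- A point outside `Q` survives only if no line through it is captured. By `none-weight` the
    -- probability of this times the number of its busy lines is at most `D ^ j`.
    rest-weight : wsum d rest ≤ card A * (D ^ j * D ^ N)
    rest-weight = begin
      wsum d rest
        ≤⟨ wsum-mono d (λ H → ∑-mono (point H)) ⟩
      wsum d (λ H → sum (λ x → 𝟙 (lookup A x) * (𝟙 (not (lookup Q x)) * (busy x * 𝟙 (none x H)))))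
        ≡⟨ wsum-∑ d (λ x H → 𝟙 (lookup A x) * (𝟙 (not (lookup Q x)) * (busy x * 𝟙 (none x H)))) ⟩
      sum (λ x → wsum d (λ H → 𝟙 (lookup A x) * (𝟙 (not (lookup Q x)) * (busy x * 𝟙 (none x H)))))
        ≡⟨ sum-cong-≗ (λ x → trans (wsum-* d (𝟙 (lookup A x)) (λ H → 𝟙 (not (lookup Q x)) * (busy x * 𝟙 (none x H))))
             (cong (𝟙 (lookup A x) *_) (trans (wsum-* d (𝟙 (not (lookup Q x))) (λ H → busy x * 𝟙 (none x H)))
               (cong (𝟙 (not (lookup Q x)) *_) (wsum-* d (busy x) (λ H → 𝟙 (none x H))))))) ⟩
      sum (λ x → 𝟙 (lookup A x) * (𝟙 (not (lookup Q x)) * (busy x * wsum d (λ H → 𝟙 (none x H)))))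
        ≤⟨ ∑-mono (λ x → *-monoʳ-≤ (𝟙 (lookup A x)) (𝟙-*-≤ (not (lookup Q x)) (λ e → none-weight x (not-true e)))) ⟩
      sum (λ x → 𝟙 (lookup A x) * (D ^ j * D ^ N))
        ≡⟨ sym (*-distribʳ-sum (D ^ j * D ^ N) (λ x → 𝟙 (lookup A x))) ⟩
      card A * (D ^ j * D ^ N) ∎
      where
      open ≤-Reasoning
      point : ∀ H x → 𝟙 (lookup (prune κ j (Q ∩ H) A) x ∧ not (lookup Q x)) * busy x
                      ≤ 𝟙 (lookup A x) * (𝟙 (not (lookup Q x)) * (busy x * 𝟙 (none x H)))
      point H x = 𝟙-*-≤ (lookup (prune κ j (Q ∩ H) A) x ∧ not (lookup Q x)) λ e →
        let (s , q) = ∧-split {lookup (prune κ j (Q ∩ H) A) x} e in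
        ≤-reflexive (sym (trans (𝟙-*-one (lookup A x) _ (prune⊑ κ j (Q ∩ H) A x s))
          (trans (𝟙-*-one (not (lookup Q x)) _ q)
            (trans (cong (λ z → busy x * 𝟙 z) (survivor κ j (Q ∩ H) A x s
              (trans (lookup-∩ Q H x) (cong (_∧ lookup H x) (not-true q))))) (*-identityʳ (busy x))))))

-- Each function divided by its bound has average at most 1, so their sum is at most 3 for some set,
-- which then serves all three. Multiplying each function by the other two bounds clears the
-- denominators.
three-averages : ∀ d {n} (f₁ f₂ f₃ : Subset n → ℕ) c₁ c₂ c₃ → 1 ≤ c₁ → 1 ≤ c₂ → 1 ≤ c₃ →
  wsum d f₁ ≤ suc d ^ n * c₁ → wsum d f₂ ≤ suc d ^ n * c₂ → wsum d f₃ ≤ suc d ^ n * c₃ →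
  ∃ λ H → f₁ H ≤ 3 * c₁ × f₂ H ≤ 3 * c₂ × f₃ H ≤ 3 * c₃
three-averages d {n} f₁ f₂ f₃ c₁ c₂ c₃ p₁ p₂ p₃ h₁ h₂ h₃ =
  H , cancel (c₂ * c₃) (f₁ H) c₁ (*-mono-≤ p₂ p₃) (≤-trans (≤-trans (m≤m+n _ _) (m≤m+n _ _)) bound) (solve 3 (λ a b c → con 3 :* (a :* b :* c) := b :* c :* (con 3 :* a)) refl c₁ c₂ c₃)
    , cancel (c₁ * c₃) (f₂ H) c₂ (*-mono-≤ p₁ p₃) (≤-trans (≤-trans (m≤n+m _ (c₂ * c₃ * f₁ H)) (m≤m+n _ _)) bound) (solve 3 (λ a b c → con 3 :* (a :* b :* c) := a :* c :* (con 3 :* b)) refl c₁ c₂ c₃)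
    , cancel (c₁ * c₂) (f₃ H) c₃ (*-mono-≤ p₁ p₂) (≤-trans (m≤n+m _ _) bound) (solve 3 (λ a b c → con 3 :* (a :* b :* c) := a :* b :* (con 3 :* c)) refl c₁ c₂ c₃)
  where
  open ≤-Reasoning
  E = suc d ^ n
  F : Subset n → ℕ
  F H = c₂ * c₃ * f₁ H + c₁ * c₃ * f₂ H + c₁ * c₂ * f₃ H
  total : wsum d F ≤ E * (3 * (c₁ * c₂ * c₃))
  total = begin
    wsum d F
      ≡⟨ trans (wsum-+ d (λ H → c₂ * c₃ * f₁ H + c₁ * c₃ * f₂ H) (λ H → c₁ * c₂ * f₃ H))
           (cong₂ _+_ (trans (wsum-+ d (λ H → c₂ * c₃ * f₁ H) (λ H → c₁ * c₃ * f₂ H))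
             (cong₂ _+_ (wsum-* d (c₂ * c₃) f₁) (wsum-* d (c₁ * c₃) f₂))) (wsum-* d (c₁ * c₂) f₃)) ⟩
    c₂ * c₃ * wsum d f₁ + c₁ * c₃ * wsum d f₂ + c₁ * c₂ * wsum d f₃
      ≤⟨ +-mono-≤ (+-mono-≤ (*-monoʳ-≤ (c₂ * c₃) h₁) (*-monoʳ-≤ (c₁ * c₃) h₂)) (*-monoʳ-≤ (c₁ * c₂) h₃) ⟩
    c₂ * c₃ * (E * c₁) + c₁ * c₃ * (E * c₂) + c₁ * c₂ * (E * c₃)
      ≡⟨ solve 4 (λ e a b c → b :* c :* (e :* a) :+ a :* c :* (e :* b) :+ a :* b :* (e :* c) := e :* (con 3 :* (a :* b :* c))) refl E c₁ c₂ c₃ ⟩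
    E * (3 * (c₁ * c₂ * c₃)) ∎
  found = wsum-witness-≤ d {f = F} total
  H = proj₁ found
  bound = proj₂ found
  cancel : ∀ u f c → 1 ≤ u → u * f ≤ 3 * (c₁ * c₂ * c₃) → 3 * (c₁ * c₂ * c₃) ≡ u * (3 * c) → f ≤ 3 * c
  cancel u f c 1≤u h e = *-cancelˡ-≤ u {{>-nonZero 1≤u}} (≤-trans h (≤-reflexive e))

-- Powers and integer roots.

nCk≤2^n : ∀ n k → n C k ≤ 2 ^ n
nCk≤2^n n       zero    = ≤-trans (≤-reflexive (nC0≡1 n)) (m^n>0 2 n)
nCk≤2^n zero    (suc k) = z≤n
nCk≤2^n (suc n) (suc k) = ≤-trans (≤-reflexive (sym (nCk+nC[k+1]≡[n+1]C[k+1] n k)))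
  (≤-trans (+-mono-≤ (nCk≤2^n n k) (nCk≤2^n n (suc k))) (≤-reflexive (cong (2 ^ n +_) (sym (+-identityʳ (2 ^ n))))))

^-distrib-* : ∀ m n k → (m * n) ^ k ≡ m ^ k * n ^ k
^-distrib-* m n zero    = refl
^-distrib-* m n (suc k) = trans (cong (m * n *_) (^-distrib-* m n k))
  (solve 4 (λ m n a b → m :* n :* (a :* b) := m :* a :* (n :* b)) refl m n (m ^ k) (n ^ k))

positive-factor : ∀ {p m} → 1 ≤ p → p * p ≤ 4 * m → 1 ≤ m
positive-factor {m = zero}  1≤p h = ⊥-elim (<⇒≱ (*-mono-≤ 1≤p 1≤p) h)
positive-factor {m = suc m} 1≤p h = s≤s z≤n

argmax : ∀ {n} (f : Fin (suc n) → ℕ) → ∃ λ j → ∀ i → f i ≤ f j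
argmax {zero}  f = zero , λ { zero → ≤-refl }
argmax {suc n} f with argmax (f ∘ suc)
... | j , h with ≤-total (f zero) (f (suc j))
...   | inj₁ le = suc j , λ { zero → le ; (suc i) → h i }
...   | inj₂ ge = zero , λ { zero → ≤-refl ; (suc i) → ≤-trans (h i) ge }

-- Bernoulli's inequality (1 - 1/X)^j ≥ 1 - j/X for `X = suc D`, with denominators cleared.
bernoulli-∸ : ∀ D j → j ≤ suc D → suc D ^ j * (suc D ∸ j) ≤ D ^ j * suc D
bernoulli-∸ D zero    _ = ≤-refl
bernoulli-∸ D (suc j) (s≤s j≤D) = begin
  suc D * suc D ^ j * (D ∸ j)      ≡⟨ solve 3 (λ a b c → a :* b :* c := b :* (a :* c)) refl (suc D) (suc D ^ j) (D ∸ j) ⟩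
  suc D ^ j * (suc D * (D ∸ j))    ≤⟨ *-monoʳ-≤ (suc D ^ j) shift ⟩
  suc D ^ j * (D * (suc D ∸ j))    ≡⟨ solve 3 (λ a b c → a :* (b :* c) := b :* (a :* c)) refl (suc D ^ j) D (suc D ∸ j) ⟩
  D * (suc D ^ j * (suc D ∸ j))    ≤⟨ *-monoʳ-≤ D (bernoulli-∸ D j (m≤n⇒m≤1+n j≤D)) ⟩
  D * (D ^ j * suc D)              ≡⟨ sym (*-assoc D (D ^ j) (suc D)) ⟩
  D * D ^ j * suc D                ∎
  where
  open ≤-Reasoning
  shift : suc D * (D ∸ j) ≤ D * (suc D ∸ j)
  shift = begin
    (D ∸ j) + D * (D ∸ j)          ≤⟨ +-monoˡ-≤ (D * (D ∸ j)) (m∸n≤m D j) ⟩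
    D + D * (D ∸ j)                ≡⟨ sym (*-suc D (D ∸ j)) ⟩
    D * suc (D ∸ j)                ≡⟨ cong (D *_) (sym (+-∸-assoc 1 j≤D)) ⟩
    D * (suc D ∸ j)                ∎

suc-^≤2* : ∀ D j → 2 * j ≤ suc D → suc D ^ j ≤ 2 * D ^ j
suc-^≤2* D j h = *-cancelʳ-≤ _ _ (suc D) (begin
  suc D ^ j * suc D                ≤⟨ *-monoʳ-≤ (suc D ^ j) half ⟩
  suc D ^ j * (2 * (suc D ∸ j))    ≡⟨ solve 2 (λ a b → a :* (con 2 :* b) := con 2 :* (a :* b)) refl (suc D ^ j) (suc D ∸ j) ⟩
  2 * (suc D ^ j * (suc D ∸ j))    ≤⟨ *-monoʳ-≤ 2 (bernoulli-∸ D j j≤) ⟩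
  2 * (D ^ j * suc D)              ≡⟨ sym (*-assoc 2 (D ^ j) (suc D)) ⟩
  2 * D ^ j * suc D                ∎)
  where
  open ≤-Reasoning
  j≤ : j ≤ suc D
  j≤ = ≤-trans (m≤m+n j (j + 0)) h
  half : suc D ≤ 2 * (suc D ∸ j)
  half = begin
    suc D                          ≡⟨ sym (m∸n+n≡m j≤) ⟩
    (suc D ∸ j) + j                ≤⟨ +-monoʳ-≤ (suc D ∸ j) (m+n≤o⇒m≤o∸n j (≤-trans (≤-reflexive (cong (j +_) (sym (+-identityʳ j)))) h)) ⟩
    (suc D ∸ j) + (suc D ∸ j)      ≡⟨ cong ((suc D ∸ j) +_) (sym (+-identityʳ (suc D ∸ j))) ⟩
    2 * (suc D ∸ j)                ∎

-- Supplies the sampling rate 1 / D, for which `c * p * D ^ j` must be close to the j-th moment. By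
-- `suc-^≤2*`, rounding the root to an integer costs only a factor 2.
integer-root : ∀ c m j D₀ → 1 ≤ c → 1 ≤ j → c * D₀ ^ j ≤ m → ∃ λ D → D₀ ≤ D × c * D ^ j ≤ m × m < c * suc D ^ j
integer-root c m j D₀ 1≤c 1≤j init = search (suc m) D₀ ≤-refl init enough
  where
  open ≤-Reasoning
  enough : m < c * (D₀ + suc m) ^ j
  enough = begin
    suc m                ≤⟨ m≤n+m (suc m) D₀ ⟩
    D₀ + suc m           ≡⟨ sym (^-identityʳ _) ⟩
    (D₀ + suc m) ^ 1     ≤⟨ ^-monoʳ-≤ (D₀ + suc m) {{>-nonZero (≤-trans (s≤s z≤n) (m≤n+m (suc m) D₀))}} 1≤j ⟩
    (D₀ + suc m) ^ j     ≤⟨ m≤n*m ((D₀ + suc m) ^ j) c {{>-nonZero 1≤c}} ⟩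
    c * (D₀ + suc m) ^ j ∎
  search : ∀ f D → D₀ ≤ D → c * D ^ j ≤ m → m < c * (D + f) ^ j → ∃ λ D → D₀ ≤ D × c * D ^ j ≤ m × m < c * suc D ^ j
  search zero D lo h hi = ⊥-elim (<⇒≱ hi (subst (λ z → c * z ^ j ≤ m) (sym (+-identityʳ D)) h))
  search (suc f) D lo h hi with c * suc D ^ j ≤? m
  ... | no big = D , lo , h , ≰⇒> big
  ... | yes ok = search f (suc D) (m≤n⇒m≤1+n lo) ok (subst (λ z → m < c * z ^ j) (+-suc D f) hi)

full : ∀ {n} → Subset n
full = tabulate (λ _ → true)

-- Containers

module Containers {p N : ℕ} (ln : Fin p → Fin N → Fin p)
  (meet : ∀ {a a′ x y} → x ≢ y → ln a x ≡ ln a y → ln a′ x ≡ ln a′ y → a ≡ a′)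
  (Q : Subset N) (t : ℕ)
  (c : ℕ) (c≥ : 4 * (6 * 16) ≤ c) (1≤p : 1 ≤ p)
  (blocked : ∀ a b → 1 ≤ Net.load ln meet Q a b) (bounded : ∀ a b → Net.load ln meet Q a b ≤ t) where

  open Net ln meet
  open Pruning ln meet
  open Sampling ln meet Q t

  1≤c : 1 ≤ c
  1≤c = ≤-trans (s≤s z≤n) c≥

  some-class : Fin p
  some-class = fromℕ< 1≤p

  1≤t : 1 ≤ t
  1≤t = ≤-trans (blocked some-class some-class) (bounded some-class some-class)

  card-Q : card Q ≤ t * p
  card-Q = begin
    card Q                   ≡⟨ sym (class-total Q some-class) ⟩
    sum (load Q some-class)  ≤⟨ ∑-bound (bounded some-class) ⟩
    p * t                    ≡⟨ *-comm p t ⟩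
    t * p                    ∎
    where open ≤-Reasoning

  moment-mono : ∀ κ {A A′} j → A′ ⊑ A → moment κ A′ j ≤ moment κ A j
  moment-mono κ {A} {A′} j h = ∑ₗ-mono (λ a b → *-monoˡ-≤ (load Q a b C j) (𝟙-mono (heavy-mono {κ} {A′} {A} a b h)))

  live : ℕ → Subset N → ℕ → ℕ
  live κ A j = ∑ₗ (λ a b → 𝟙 (heavy κ A a b) * 𝟙 (j ≤ᵇ load Q a b))

  moment≤live : ∀ κ A j → moment κ A j ≤ live κ A j + t * moment κ A (suc j)
  moment≤live κ A j = begin
    moment κ A j
      ≤⟨ ∑ₗ-mono (λ a b → *-monoʳ-≤ (h a b) (nCj≤𝟙+t*nC[j+1] (load Q a b) j (bounded a b))) ⟩
    ∑ₗ (λ a b → h a b * (𝟙 (j ≤ᵇ load Q a b) + t * (load Q a b C suc j)))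
      ≡⟨ sum-cong-≗ (λ a → sum-cong-≗ (λ b → solve 4 (λ h i t c → h :* (i :+ t :* c) := h :* i :+ t :* (h :* c)) refl
           (h a b) (𝟙 (j ≤ᵇ load Q a b)) t (load Q a b C suc j))) ⟩
    ∑ₗ (λ a b → h a b * 𝟙 (j ≤ᵇ load Q a b) + t * (h a b * (load Q a b C suc j)))
      ≡⟨ trans (∑ₗ-+ (λ a b → h a b * 𝟙 (j ≤ᵇ load Q a b)) (λ a b → t * (h a b * (load Q a b C suc j))))
           (cong (live κ A j +_) (∑ₗ-* t (λ a b → h a b * (load Q a b C suc j)))) ⟩
    live κ A j + t * moment κ A (suc j) ∎
    where
    open ≤-Reasoning
    h : Fin p → Fin p → ℕ
    h a b = 𝟙 (heavy κ A a b)

  -- Of the `κ` or more remaining points on such a line at most `t` are in `Q`. Each of the others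
  -- is a survivor outside `Q` for which the line is busy.
  live-rest : ∀ κ j A d H → live κ (prune κ j (Q ∩ H) A) j * (κ ∸ t) ≤ Averages.rest κ j A d H
  live-rest κ j A d H = begin
    live κ A′ j * (κ ∸ t)
      ≡⟨ trans (*-comm (live κ A′ j) (κ ∸ t)) (sym (∑ₗ-* (κ ∸ t) f)) ⟩
    ∑ₗ (λ a b → (κ ∸ t) * f a b)
      ≤⟨ ∑ₗ-mono line-bound ⟩
    ∑ₗ (λ a b → f a b * load R a b)
      ≡⟨ load-swap R f ⟩
    sum (λ x → 𝟙 (lookup R x) * sum (λ a → f a (ln a x)))
      ≤⟨ ∑-mono (λ x → ≤-trans (≤-reflexive (cong (λ z → 𝟙 z * sum (λ a → f a (ln a x))) (R-lookup x)))
           (*-monoʳ-≤ (𝟙 (lookup A′ x ∧ not (lookup Q x))) (∑-mono (λ a → point a (ln a x))))) ⟩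
    Averages.rest κ j A d H ∎
    where
    open ≤-Reasoning
    A′ = prune κ j (Q ∩ H) A
    R = tabulate (λ x → lookup A′ x ∧ not (lookup Q x))
    R-lookup : ∀ x → lookup R x ≡ (lookup A′ x ∧ not (lookup Q x))
    R-lookup = lookup∘tabulate (λ x → lookup A′ x ∧ not (lookup Q x))
    f : Fin p → Fin p → ℕ
    f a b = 𝟙 (heavy κ A′ a b) * 𝟙 (j ≤ᵇ load Q a b)
    point : ∀ a b → f a b ≤ 𝟙 (heavy κ A a b ∧ (j ≤ᵇ load Q a b))
    point a b = ≤-trans (*-monoˡ-≤ (𝟙 (j ≤ᵇ load Q a b)) (𝟙-mono (heavy-mono {κ} {A′} {A} a b (prune⊑ κ j (Q ∩ H) A))))
      (≤-reflexive (sym (𝟙-∧ (heavy κ A a b) (j ≤ᵇ load Q a b))))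
    cover : ∀ a b → load A′ a b ≤ load R a b + load Q a b
    cover a b = ≤-trans (∑-mono each) (≤-reflexive (∑-distrib-+ (λ x → 𝟙 (lookup (R ∩ line a b) x)) (λ x → 𝟙 (lookup (Q ∩ line a b) x))))
      where
      each : ∀ x → 𝟙 (lookup (A′ ∩ line a b) x) ≤ 𝟙 (lookup (R ∩ line a b) x) + 𝟙 (lookup (Q ∩ line a b) x)
      each x with bool-case (lookup Q x)
      ... | inj₁ q = ≤-trans (𝟙-mono (λ e → ∩-join Q (line a b) x q (∩⊑ʳ A′ (line a b) x e))) (m≤n+m _ (𝟙 (lookup (R ∩ line a b) x)))
      ... | inj₂ q = ≤-trans (𝟙-mono (λ e → ∩-join R (line a b) x
              (trans (R-lookup x) (∧-join (∩⊑ˡ A′ (line a b) x e) (cong not q))) (∩⊑ʳ A′ (line a b) x e))) (m≤m+n _ (𝟙 (lookup (Q ∩ line a b) x)))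
    line-bound : ∀ a b → (κ ∸ t) * f a b ≤ f a b * load R a b
    line-bound a b with bool-case (heavy κ A′ a b)
    ... | inj₂ e = ≤-trans (≤-reflexive (trans (cong (λ z → (κ ∸ t) * (𝟙 z * 𝟙 (j ≤ᵇ load Q a b))) e) (*-zeroʳ (κ ∸ t)))) z≤n
    ... | inj₁ e = ≤-trans (≤-reflexive (*-comm (κ ∸ t) (f a b))) (*-monoʳ-≤ (f a b) (begin
      κ ∸ t                          ≤⟨ ∸-monoˡ-≤ t (does-true (κ ≤? load A′ a b) e) ⟩
      load A′ a b ∸ t                ≤⟨ ∸-monoˡ-≤ t (≤-trans (cover a b) (+-monoʳ-≤ (load R a b) (bounded a b))) ⟩
      (load R a b + t) ∸ t           ≡⟨ m+n∸n≡m (load R a b) t ⟩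
      load R a b                     ∎))

  lost : Subset N → ℕ
  lost A = sum (λ x → 𝟙 (lookup Q x) * 𝟙 (not (lookup A x)))

  lost-prune : ∀ κ j A d H → lost (prune κ j (Q ∩ H) A) ≤ lost A + Averages.paid κ j A d H
  lost-prune κ j A d H = ≤-trans (∑-mono each)
    (≤-reflexive (∑-distrib-+ (λ x → 𝟙 (lookup Q x) * 𝟙 (not (lookup A x))) (λ x → 𝟙 (lookup Q x) * 𝟙 (lookup A x ∧ not (lookup A′ x)))))
    where
    A′ = prune κ j (Q ∩ H) A
    cases : ∀ a b → 𝟙 (not b) ≤ 𝟙 (not a) + 𝟙 (a ∧ not b)
    cases true  b = ≤-refl
    cases false b = ≤-trans (𝟙≤1 (not b)) (m≤m+n 1 0)
    each : ∀ x → 𝟙 (lookup Q x) * 𝟙 (not (lookup A′ x)) ≤ 𝟙 (lookup Q x) * 𝟙 (not (lookup A x)) + 𝟙 (lookup Q x) * 𝟙 (lookup A x ∧ not (lookup A′ x))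
    each x = ≤-trans (*-monoʳ-≤ (𝟙 (lookup Q x)) (cases (lookup A x) (lookup A′ x)))
      (≤-reflexive (*-distribˡ-+ (𝟙 (lookup Q x)) (𝟙 (not (lookup A x))) _))

  record Step (Z κ j D : ℕ) (A : Subset N) : Set where
    field
      G        : Subset N
      G-small  : D * card G ≤ 3 * (t * p)
      loss     : Z * lost (prune κ j G A) ≤ Z * lost A + 6 * c * (t * t * p)
      halved   : 2 * moment κ (prune κ j G A) j ≤ moment κ A j

  -- The lower bound `lo` makes the live lines left by `rest` account for at most a quarter of the
  -- old moment, and `decay` with `4 * t ≤ Z` bounds the share of level `j + 1` by another quarter;
  -- so the moment is halved. The upper bound `hi` keeps the loss of points of `Q` small.
  step : ∀ Z κ j d A → 4 * t ≤ Z → 2 * t ≤ κ → 1 ≤ card A → card A ≤ 16 * (p * κ) → Z * moment κ A (suc j) ≤ moment κ A j →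
    c * p * suc d ^ j ≤ moment κ A j → moment κ A j ≤ 2 * c * p * suc d ^ j → Step Z κ j (suc d) A
  step Z κ j d A 4t≤Z 2t≤κ 1≤A A≤ decay lo hi = record
    { G = Q ∩ H
    ; G-small = h₁
    ; loss = ≤-trans (*-monoʳ-≤ Z (lost-prune κ j A d H)) (≤-trans (≤-reflexive (*-distribˡ-+ Z (lost A) (paid H))) (+-monoʳ-≤ (Z * lost A) paid-bound))
    ; halved = halved
    }
    where
    open ≤-Reasoning
    open Averages κ j A d
    E = D ^ j
    M = moment κ A j
    M⁺ = moment κ A (suc j)
    1≤E : 1 ≤ E
    1≤E = m^n>0 D j
    1≤M : 1 ≤ M
    1≤M = ≤-trans (*-mono-≤ {1} {c * p} (*-mono-≤ {1} {c} 1≤c 1≤p) 1≤E) lo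
    w₁ : wsum d (λ H → D * card (Q ∩ H)) ≤ D ^ N * (t * p)
    w₁ = begin
      wsum d (λ H → D * card (Q ∩ H))   ≡⟨ wsum-* d D (λ H → card (Q ∩ H)) ⟩
      D * wsum d (λ H → card (Q ∩ H))   ≡⟨ sample-size ⟩
      card Q * D ^ N                    ≤⟨ *-monoˡ-≤ (D ^ N) card-Q ⟩
      t * p * D ^ N                     ≡⟨ *-comm (t * p) (D ^ N) ⟩
      D ^ N * (t * p)                   ∎
    w₂ : wsum d (λ H → Z * E * paid H) ≤ D ^ N * (t * t * M)
    w₂ = begin
      wsum d (λ H → Z * E * paid H)     ≡⟨ wsum-* d (Z * E) paid ⟩
      Z * E * wsum d paid               ≡⟨ solve 3 (λ z e w → z :* e :* w := z :* (w :* e)) refl Z E (wsum d paid) ⟩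
      Z * (wsum d paid * E)             ≤⟨ *-monoʳ-≤ Z (paid-weight bounded) ⟩
      Z * (t * (t * M⁺) * D ^ N)        ≡⟨ solve 4 (λ z t m e → z :* (t :* (t :* m) :* e) := e :* (t :* t :* (z :* m))) refl Z t M⁺ (D ^ N) ⟩
      D ^ N * (t * t * (Z * M⁺))        ≤⟨ *-monoʳ-≤ (D ^ N) (*-monoʳ-≤ (t * t) decay) ⟩
      D ^ N * (t * t * M)               ∎
    w₃ : wsum d rest ≤ D ^ N * (card A * E)
    w₃ = ≤-trans rest-weight (≤-reflexive (solve 3 (λ a e n → a :* (e :* n) := n :* (a :* e)) refl (card A) E (D ^ N)))
    found = three-averages d (λ H → D * card (Q ∩ H)) (λ H → Z * E * paid H) rest (t * p) (t * t * M) (card A * E)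
      (*-mono-≤ 1≤t 1≤p) (*-mono-≤ {1} {t * t} (*-mono-≤ 1≤t 1≤t) 1≤M) (*-mono-≤ 1≤A 1≤E) w₁ w₂ w₃
    H = proj₁ found
    h₁ = proj₁ (proj₂ found)
    h₂ = proj₁ (proj₂ (proj₂ found))
    h₃ = proj₂ (proj₂ (proj₂ found))
    A′ = prune κ j (Q ∩ H) A
    paid-bound : Z * paid H ≤ 6 * c * (t * t * p)
    paid-bound = *-cancelˡ-≤ E {{>-nonZero 1≤E}} (begin
      E * (Z * paid H)                  ≡⟨ solve 3 (λ e z x → e :* (z :* x) := z :* e :* x) refl E Z (paid H) ⟩
      Z * E * paid H                    ≤⟨ h₂ ⟩
      3 * (t * t * M)                   ≤⟨ *-monoʳ-≤ 3 (*-monoʳ-≤ (t * t) hi) ⟩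
      3 * (t * t * (2 * c * p * E))     ≡⟨ solve 4 (λ c t p e → con 3 :* (t :* t :* (con 2 :* c :* p :* e)) := e :* (con 6 :* c :* (t :* t :* p))) refl c t p E ⟩
      E * (6 * c * (t * t * p))          ∎)
    L = live κ A′ j
    1≤κ : 1 ≤ κ
    1≤κ = ≤-trans (≤-trans 1≤t (m≤m+n t (t + 0))) 2t≤κ
    κ≤ : κ ≤ 2 * (κ ∸ t)
    κ≤ = begin
      κ                                 ≡⟨ sym (m∸n+n≡m t≤κ) ⟩
      (κ ∸ t) + t                       ≤⟨ +-monoʳ-≤ (κ ∸ t) (m+n≤o⇒m≤o∸n t (≤-trans (≤-reflexive (cong (t +_) (sym (+-identityʳ t)))) 2t≤κ)) ⟩
      (κ ∸ t) + (κ ∸ t)                 ≡⟨ cong ((κ ∸ t) +_) (sym (+-identityʳ (κ ∸ t))) ⟩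
      2 * (κ ∸ t)                       ∎
      where
      t≤κ : t ≤ κ
      t≤κ = ≤-trans (m≤m+n t (t + 0)) 2t≤κ
    -- The 2 in 6 = 2 · 3 is from `κ ≤ 2 * (κ ∸ t)`, the 3 from averaging three quantities at once,
    -- and 16 from `card A ≤ 16 * (p * κ)`. Four times the product is the bound required of `c`.
    L≤ : L ≤ 6 * (16 * (p * E))
    L≤ = *-cancelʳ-≤ _ _ κ {{>-nonZero 1≤κ}} (begin
      L * κ                             ≤⟨ *-monoʳ-≤ L κ≤ ⟩
      L * (2 * (κ ∸ t))                 ≡⟨ solve 2 (λ l k → l :* (con 2 :* k) := con 2 :* (l :* k)) refl L (κ ∸ t) ⟩
      2 * (L * (κ ∸ t))                 ≤⟨ *-monoʳ-≤ 2 (≤-trans (live-rest κ j A d H) h₃) ⟩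
      2 * (3 * (card A * E))            ≤⟨ *-monoʳ-≤ 2 (*-monoʳ-≤ 3 (*-monoˡ-≤ E A≤)) ⟩
      2 * (3 * (16 * (p * κ) * E))      ≡⟨ solve 4 (λ s p k e → con 2 :* (con 3 :* (s :* (p :* k) :* e)) := con 6 :* (s :* (p :* e)) :* k) refl 16 p κ E ⟩
      6 * (16 * (p * E)) * κ                  ∎)
    constants : 4 * (6 * (16 * (p * E))) ≤ c * p * E
    constants = begin
      4 * (6 * (16 * (p * E)))          ≡⟨ cong (4 *_) (sym (*-assoc 6 16 (p * E))) ⟩
      4 * ((6 * 16) * (p * E))          ≡⟨ sym (*-assoc 4 (6 * 16) (p * E)) ⟩
      (4 * (6 * 16)) * (p * E)          ≤⟨ *-monoˡ-≤ (p * E) c≥ ⟩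
      c * (p * E)                       ≡⟨ sym (*-assoc c p E) ⟩
      c * p * E                         ∎
    halved : 2 * moment κ A′ j ≤ M
    halved = *-cancelˡ-≤ 2 (begin
      2 * (2 * moment κ A′ j)           ≤⟨ *-monoʳ-≤ 2 (*-monoʳ-≤ 2 (≤-trans (moment≤live κ A′ j) (+-monoʳ-≤ L (*-monoʳ-≤ t (moment-mono κ {A} {A′} (suc j) (prune⊑ κ j (Q ∩ H) A)))))) ⟩
      2 * (2 * (L + t * M⁺))            ≡⟨ solve 3 (λ l t m → con 2 :* (con 2 :* (l :+ t :* m)) := con 4 :* l :+ con 4 :* t :* m) refl L t M⁺ ⟩
      4 * L + 4 * t * M⁺                ≤⟨ +-mono-≤ (*-monoʳ-≤ 4 L≤) (*-monoˡ-≤ M⁺ 4t≤Z) ⟩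
      4 * (6 * (16 * (p * E))) + Z * M⁺ ≤⟨ +-mono-≤ constants decay ⟩
      c * p * E + M                   ≤⟨ +-monoˡ-≤ M lo ⟩
      M + M                             ≡⟨ cong (M +_) (sym (+-identityʳ M)) ⟩
      2 * M                             ∎)

  moment-top : ∀ κ A → moment κ A (suc t) ≡ 0
  moment-top κ A = ∑-zero (λ a → ∑-zero (λ b → trans
    (cong (𝟙 (heavy κ A a b) *_) (k>n⇒nCk≡0 (s≤s (bounded a b)))) (*-zeroʳ (𝟙 (heavy κ A a b)))))

  moment-0 : ∀ κ A → moment κ A 0 ≡ ∑ₗ (λ a b → 𝟙 (heavy κ A a b))
  moment-0 κ A = sum-cong-≗ (λ a → sum-cong-≗ (λ b → trans (cong (𝟙 (heavy κ A a b) *_) (nC0≡1 (load Q a b))) (*-identityʳ _)))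

  -- Every line contains a point of `Q`; this keeps the best level away from 0.
  moment-0≤1 : ∀ κ A → moment κ A 0 ≤ moment κ A 1
  moment-0≤1 κ A = ∑ₗ-mono (λ a b → *-monoʳ-≤ (𝟙 (heavy κ A a b))
    (≤-trans (≤-reflexive (nC0≡1 (load Q a b))) (≤-trans (blocked a b) (≤-reflexive (sym (nC1≡n (load Q a b)))))))

  moment≤ : ∀ κ A j → moment κ A j ≤ p * (p * 2 ^ t)
  moment≤ κ A j = ≤-trans (∑ₗ-mono (λ a b → ≤-trans (*-monoˡ-≤ (load Q a b C j) (𝟙≤1 (heavy κ A a b)))
      (≤-trans (≤-reflexive (+-identityʳ _)) (≤-trans (nCk≤2^n (load Q a b) j) (^-monoʳ-≤ 2 (bounded a b))))))
    (≤-reflexive (∑ₗ-const (2 ^ t)))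

  -- Iterated pruning.

  module Rounds (Z D₀ : ℕ) (4t≤Z : 4 * t ≤ Z) (2t≤D₀ : 2 * t ≤ D₀) (room : 4 * c * (D₀ * Z) ^ t ≤ p) where

    1≤Z : 1 ≤ Z
    1≤Z = ≤-trans (≤-trans 1≤t (m≤n*m t 4)) 4t≤Z

    1≤D₀ : 1 ≤ D₀
    1≤D₀ = ≤-trans (≤-trans 1≤t (m≤n*m t 2)) 2t≤D₀

    term : ℕ → Subset N → Fin (suc t) → ℕ
    term κ A i = moment κ A (toℕ i) * Z ^ toℕ i

    -- At the level j where Z ^ j m_j is largest (m_j the j-th moment), m_(j+1) ≤ m_j / Z; this is why pruning at
    -- level j loses few points of Q.
    potential : ℕ → Subset N → ℕ
    potential κ A = sum (term κ A)

    record Shrink (κ : ℕ) (A : Subset N) : Set where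
      field
        j       : ℕ
        G       : Subset N
        j≤t     : j ≤ t
        G-small : D₀ * card G ≤ 3 * (t * p)
        loss    : Z * lost (prune κ j G A) ≤ Z * lost A + 6 * c * (t * t * p)
        decay   : suc (suc (2 * t)) * potential κ (prune κ j G A) ≤ suc (2 * t) * potential κ A

    module Level (κ : ℕ) (A : Subset N) (2t≤κ : 2 * t ≤ κ) (1≤A : 1 ≤ card A) (p≤A : p ≤ card A)
      (κ≤A : 4 * (p * κ) ≤ card A) (A≤κ : card A ≤ 16 * (p * κ))
      (jᶠ : Fin (suc t)) (best : ∀ i → term κ A i ≤ term κ A jᶠ) where

      open ≤-Reasoning
      M = moment κ A
      F = term κ A
      j = toℕ jᶠ
      j≤t : j ≤ t
      j≤t = ≤-pred (toℕ<n jᶠ)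
      F≤ : ∀ i → i ≤ t → M i * Z ^ i ≤ M j * Z ^ j
      F≤ i i≤t = subst (λ k → M k * Z ^ k ≤ M j * Z ^ j) (toℕ-fromℕ< (s≤s i≤t)) (best (fromℕ< (s≤s i≤t)))
      p²≤ : p * p ≤ 4 * M 0
      p²≤ = subst (λ z → p * p ≤ 4 * z) (sym (moment-0 κ A)) (many-heavy κ A κ≤A p≤A 1≤A)
      1≤M0 : 1 ≤ M 0
      1≤M0 = positive-factor 1≤p p²≤
      -- The term at level 1 is at least `Z` times the one at level 0, so level 0 is never the best
      -- and a j-th root can be taken.
      1≤j : 1 ≤ j
      1≤j = n≢0⇒n>0 λ e → <⇒≱ (begin-strict
        M 0                ≡⟨ sym (*-identityʳ (M 0)) ⟩
        M 0 * 1            <⟨ *-monoʳ-< (M 0) {{>-nonZero 1≤M0}} (≤-trans (s≤s (s≤s z≤n)) (≤-trans (*-monoʳ-≤ 4 1≤t) 4t≤Z)) ⟩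
        M 0 * Z            ≤⟨ *-monoˡ-≤ Z (moment-0≤1 κ A) ⟩
        M 1 * Z            ≡⟨ cong (M 1 *_) (sym (*-identityʳ Z)) ⟩
        M 1 * Z ^ 1        ∎) (≤-trans (subst (λ k → M 1 * Z ^ 1 ≤ M k * Z ^ k) e (F≤ 1 1≤t)) (≤-reflexive (*-identityʳ (M 0))))
      -- Maximality of the term at `j`. At the top level `t` the next moment is zero, since no line
      -- has more than `t` points of `Q`.
      ratio : Z * M (suc j) ≤ M j
      ratio with suc j ≤? t
      ... | yes j<t = *-cancelʳ-≤ _ _ (Z ^ j) {{m^n≢0 Z j {{>-nonZero 1≤Z}}}} (≤-trans (≤-reflexive
              (solve 3 (λ z m e → z :* m :* e := m :* (z :* e)) refl Z (M (suc j)) (Z ^ j))) (F≤ (suc j) j<t))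
      ... | no j≮t = ≤-trans (≤-reflexive (trans (cong (Z *_)
              (subst (λ k → M (suc k) ≡ 0) (≤-antisym (≤-pred (≰⇒> j≮t)) j≤t) (moment-top κ A))) (*-zeroʳ Z))) z≤n
      -- The best term is at least the one at level 0, hence at least p² / 4 by `many-heavy`. The
      -- condition `room` turns this into a moment large enough for a sampling rate of `1 / D₀` or
      -- less.
      first : c * p * D₀ ^ j ≤ M j
      first = *-cancelˡ-≤ (4 * Z ^ j) {{m*n≢0 4 (Z ^ j) {{_}} {{m^n≢0 Z j {{>-nonZero 1≤Z}}}}}} (begin
        4 * Z ^ j * (c * p * D₀ ^ j)   ≡⟨ solve 4 (λ c z p d → con 4 :* z :* (c :* p :* d) := con 4 :* c :* (d :* z) :* p) refl c (Z ^ j) p (D₀ ^ j) ⟩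
        4 * c * (D₀ ^ j * Z ^ j) * p      ≡⟨ cong (λ z → 4 * c * z * p) (sym (^-distrib-* D₀ Z j)) ⟩
        4 * c * (D₀ * Z) ^ j * p          ≤⟨ *-monoˡ-≤ p (*-monoʳ-≤ (4 * c) (^-monoʳ-≤ (D₀ * Z) {{m*n≢0 D₀ Z {{>-nonZero 1≤D₀}} {{>-nonZero 1≤Z}}}} j≤t)) ⟩
        4 * c * (D₀ * Z) ^ t * p          ≤⟨ *-monoˡ-≤ p room ⟩
        p * p                            ≤⟨ p²≤ ⟩
        4 * M 0                          ≡⟨ cong (4 *_) (sym (*-identityʳ (M 0))) ⟩
        4 * (M 0 * Z ^ 0)                ≤⟨ *-monoʳ-≤ 4 (F≤ 0 z≤n) ⟩
        4 * (M j * Z ^ j)                ≡⟨ solve 2 (λ m z → con 4 :* (m :* z) := con 4 :* z :* m) refl (M j) (Z ^ j) ⟩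
        4 * Z ^ j * M j                  ∎)

      module _ (d : ℕ) (D₀≤D : D₀ ≤ suc d) (lo : c * p * suc d ^ j ≤ M j) (hi : M j < c * p * suc (suc d) ^ j) where

        hi′ : M j ≤ 2 * c * p * suc d ^ j
        hi′ = begin
          M j                            ≤⟨ <⇒≤ hi ⟩
          c * p * suc (suc d) ^ j        ≤⟨ *-monoʳ-≤ (c * p) (suc-^≤2* (suc d) j (≤-trans (*-monoʳ-≤ 2 j≤t) (≤-trans 2t≤D₀ (m≤n⇒m≤1+n D₀≤D)))) ⟩
          c * p * (2 * suc d ^ j)        ≡⟨ solve 3 (λ c p e → c :* p :* (con 2 :* e) := con 2 :* c :* p :* e) refl c p (suc d ^ j) ⟩
          2 * c * p * suc d ^ j          ∎

        stepped : Step Z κ j (suc d) A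
        stepped = step Z κ j d A 4t≤Z 2t≤κ 1≤A A≤κ ratio lo hi′

      Ψ = potential κ A

      Ψ≤ : Ψ ≤ suc t * F jᶠ
      Ψ≤ = ∑-bound best

      module _ (A′ : Subset N) (A′⊑A : A′ ⊑ A) (halved : 2 * moment κ A′ j ≤ M j) where
        F′ = term κ A′
        Ψ′ = potential κ A′
        each : ∀ i → 2 * F′ i + 𝟙 (jᶠ == i) * F i ≤ 2 * F i
        each i with jᶠ ≟ᶠ i
        ... | no _ = ≤-trans (≤-reflexive (+-identityʳ _)) (*-monoʳ-≤ 2 (*-monoˡ-≤ (Z ^ toℕ i) (moment-mono κ {A} {A′} (toℕ i) A′⊑A)))
        ... | yes refl = begin
          2 * (moment κ A′ j * z) + (M j * z + 0) ≡⟨ solve 3 (λ a m z → con 2 :* (a :* z) :+ (m :* z :+ con 0) := con 2 :* a :* z :+ m :* z) refl (moment κ A′ j) (M j) z ⟩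
          2 * moment κ A′ j * z + M j * z         ≤⟨ +-monoˡ-≤ (M j * z) (*-monoˡ-≤ z halved) ⟩
          M j * z + M j * z                       ≡⟨ cong (M j * z +_) (sym (+-identityʳ _)) ⟩
          2 * (M j * z)                           ∎
          where z = Z ^ j
        drop : 2 * Ψ′ + F jᶠ ≤ 2 * Ψ
        drop = begin
          2 * Ψ′ + F jᶠ                                      ≡⟨ cong₂ _+_ (*-distribˡ-sum 2 F′) (sym (∑-pick jᶠ F)) ⟩
          sum (λ i → 2 * F′ i) + sum (λ i → 𝟙 (jᶠ == i) * F i) ≡⟨ sym (∑-distrib-+ (λ i → 2 * F′ i) (λ i → 𝟙 (jᶠ == i) * F i)) ⟩
          sum (λ i → 2 * F′ i + 𝟙 (jᶠ == i) * F i)           ≤⟨ ∑-mono each ⟩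
          sum (λ i → 2 * F i)                                ≡⟨ sym (*-distribˡ-sum 2 F) ⟩
          2 * Ψ                                              ∎
        -- The largest of `t + 1` terms is at least `Ψ` divided by `t + 1`, and it is halved while
        -- no other term grows.
        decay : suc (suc (2 * t)) * Ψ′ ≤ suc (2 * t) * Ψ
        decay = +-cancelʳ-≤ Ψ _ _ (begin
          suc (suc (2 * t)) * Ψ′ + Ψ                         ≤⟨ +-monoʳ-≤ (suc (suc (2 * t)) * Ψ′) Ψ≤ ⟩
          suc (suc (2 * t)) * Ψ′ + suc t * F jᶠ              ≡⟨ solve 3 (λ t x f → (con 2 :+ con 2 :* t) :* x :+ (con 1 :+ t) :* f := (con 1 :+ t) :* (con 2 :* x :+ f)) refl t Ψ′ (F jᶠ) ⟩
          suc t * (2 * Ψ′ + F jᶠ)                            ≤⟨ *-monoʳ-≤ (suc t) drop ⟩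
          suc t * (2 * Ψ)                                    ≡⟨ solve 2 (λ t x → (con 1 :+ t) :* (con 2 :* x) := (con 1 :+ con 2 :* t) :* x :+ x) refl t Ψ ⟩
          suc (2 * t) * Ψ + Ψ                                ∎)

    shrink : ∀ κ A → 2 * t ≤ κ → 1 ≤ card A → p ≤ card A → 4 * (p * κ) ≤ card A → card A ≤ 16 * (p * κ) → Shrink κ A
    shrink κ A 2t≤κ 1≤A p≤A κ≤A A≤κ = choose-level (argmax (term κ A))
      where
      choose-rate : ∀ jᶠ (best : ∀ i → term κ A i ≤ term κ A jᶠ) →
        (∃ λ D → D₀ ≤ D × c * p * D ^ toℕ jᶠ ≤ moment κ A (toℕ jᶠ) × moment κ A (toℕ jᶠ) < c * p * suc D ^ toℕ jᶠ) → Shrink κ A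
      choose-rate jᶠ best (zero  , D₀≤D , _) = ⊥-elim (<⇒≱ 1≤D₀ D₀≤D)
      choose-rate jᶠ best (suc d , D₀≤D , lo , hi) = record
        { j = toℕ jᶠ ; G = G ; j≤t = j≤t
        ; G-small = ≤-trans (*-monoˡ-≤ (card G) D₀≤D) G-small
        ; loss = loss ; decay = decay (prune κ (toℕ jᶠ) G A) (prune⊑ κ (toℕ jᶠ) G A) halved }
        where
        open Level κ A 2t≤κ 1≤A p≤A κ≤A A≤κ jᶠ best
        open Step (stepped d D₀≤D lo hi)
      choose-level : (∃ λ jᶠ → ∀ i → term κ A i ≤ term κ A jᶠ) → Shrink κ A
      choose-level (jᶠ , best) = choose-rate jᶠ best
        (integer-root (c * p) (moment κ A (toℕ jᶠ)) (toℕ jᶠ) D₀ (*-mono-≤ {1} {c} 1≤c 1≤p) 1≤j first)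
        where open Level κ A 2t≤κ 1≤A p≤A κ≤A A≤κ jᶠ best

    -- Keeps exactly the bounded data from which the set can be rebuilt without `Q`, so that all
    -- possible sets can be listed.
    data Reach : ℕ → Subset N → Set where
      start : Reach 0 full
      next  : ∀ {r A} κ j G → Reach r A → κ ≤ N → j ≤ t → D₀ * card G ≤ 3 * (t * p) → Reach (suc r) (prune κ j G A)

    record Container (r : ℕ) : Set where
      constructor container
      field
        A     : Subset N
        reach : Reach r A
        loss  : Z * lost A ≤ r * (6 * c * (t * t * p))

    potential-pos : ∀ κ A → 4 * (p * κ) ≤ card A → p ≤ card A → 1 ≤ card A → 1 ≤ potential κ A
    potential-pos κ A h₁ h₂ h₃ = ≤-trans
      (positive-factor 1≤p (subst (λ z → p * p ≤ 4 * z) (sym (moment-0 κ A)) (many-heavy κ A h₁ h₂ h₃)))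
      (≤-trans (≤-reflexive (sym (*-identityʳ (moment κ A 0)))) (∑-term (term κ A) zero))

    -- `κ` is fixed as long as `card A` stays above half of `a₀`, so that the potentials of
    -- successive rounds are comparable. A set of that size has potential at least 1, whereas `f`
    -- rounds of decay would bring it below 1.
    halve : ∀ a₀ κ → κ ≤ N → 2 * t ≤ κ → 8 * (p * κ) ≤ a₀ → a₀ ≤ 16 * (p * κ) → ∀ f r (K : Container r) →
      card (Container.A K) ≤ a₀ → potential κ (Container.A K) * suc (2 * t) ^ f < suc (suc (2 * t)) ^ f →
      ∃ λ r′ → r′ ≤ r + f × ∃ λ (K′ : Container r′) → 2 * card (Container.A K′) ≤ a₀
    halve a₀ κ κ≤N 2t≤κ lo hi f r K@(container A reach loss) A≤ small with 2 * card A ≤? a₀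
    ... | yes done = r , m≤m+n r f , K , done
    ... | no big = go f small
      where
      open ≤-Reasoning
      A> : a₀ ≤ 2 * card A
      A> = <⇒≤ (≰⇒> big)
      κ≤A : 4 * (p * κ) ≤ card A
      κ≤A = *-cancelˡ-≤ 2 (≤-trans (≤-reflexive (sym (*-assoc 2 4 (p * κ)))) (≤-trans lo A>))
      p≤A : p ≤ card A
      p≤A = begin
        p            ≡⟨ sym (*-identityʳ p) ⟩
        p * 1        ≤⟨ *-monoʳ-≤ p (≤-trans (*-mono-≤ (s≤s (z≤n {1})) 1≤t) 2t≤κ) ⟩
        p * κ        ≤⟨ m≤n*m (p * κ) 4 ⟩
        4 * (p * κ)  ≤⟨ κ≤A ⟩
        card A       ∎
      1≤A = ≤-trans 1≤p p≤A
      go : ∀ f → potential κ A * suc (2 * t) ^ f < suc (suc (2 * t)) ^ f →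
        ∃ λ r′ → r′ ≤ r + f × ∃ λ (K′ : Container r′) → 2 * card (Container.A K′) ≤ a₀
      go zero small = ⊥-elim (<⇒≱ small (≤-trans (potential-pos κ A κ≤A p≤A 1≤A) (≤-reflexive (sym (*-identityʳ _)))))
      go (suc f) small = let (r′ , r≤ , rest) = halve a₀ κ κ≤N 2t≤κ lo hi f (suc r)
                               (container (prune κ j G A) (next κ j G reach κ≤N j≤t G-small) loss′)
                               (≤-trans (card-mono {S = prune κ j G A} {T = A} (prune⊑ κ j G A)) A≤) small′
                         in r′ , ≤-trans r≤ (≤-reflexive (sym (+-suc r f))) , rest
        where
        open Shrink (shrink κ A 2t≤κ 1≤A p≤A κ≤A (≤-trans A≤ hi)) renaming (loss to step-loss)
        Ψ = potential κ A
        Ψ′ = potential κ (prune κ j G A)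
        u = suc (2 * t)
        loss′ : Z * lost (prune κ j G A) ≤ 6 * c * (t * t * p) + r * (6 * c * (t * t * p))
        loss′ = ≤-trans step-loss (≤-trans (+-monoˡ-≤ (6 * c * (t * t * p)) loss) (≤-reflexive (+-comm _ (6 * c * (t * t * p)))))
        small′ : Ψ′ * u ^ f < suc u ^ f
        small′ = *-cancelˡ-< (suc u) _ _ (begin-strict
          suc u * (Ψ′ * u ^ f)   ≡⟨ sym (*-assoc (suc u) Ψ′ (u ^ f)) ⟩
          suc u * Ψ′ * u ^ f     ≤⟨ *-monoˡ-≤ (u ^ f) decay ⟩
          u * Ψ * u ^ f          ≡⟨ solve 3 (λ u x e → u :* x :* e := x :* (u :* e)) refl u Ψ (u ^ f) ⟩
          Ψ * (u * u ^ f)        <⟨ small ⟩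
          suc u * suc u ^ f      ∎)

    -- Halving the current set A takes at most f steps, with κ ≈ |A| / 8p throughout.
    contain : ∀ f → (∀ κ A → potential κ A * suc (2 * t) ^ f < suc (suc (2 * t)) ^ f) → ∀ g r (K : Container r) →
      card (Container.A K) ≤ 2 ^ g * (16 * (t * p)) →
      ∃ λ r′ → r′ ≤ r + g * f × ∃ λ (K′ : Container r′) → card (Container.A K′) ≤ 16 * (t * p)
    contain f small zero r K h = r , m≤m+n r 0 , K , ≤-trans h (≤-reflexive (+-identityʳ _))
    contain f small (suc g) r K@(container A reach loss) h with card A ≤? 16 * (t * p)
    ... | yes done = r , m≤m+n r _ , K , done
    ... | no big =
      let (r₁ , r₁≤ , K₁ , h₁) = halve (card A) κ κ≤N 2t≤κ lo hi f r K ≤-refl (small κ A)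
          (r₂ , r₂≤ , K₂ , h₂) = contain f small g r₁ K₁ (*-cancelˡ-≤ 2 (≤-trans h₁ (≤-trans h (≤-reflexive (*-assoc 2 (2 ^ g) _)))))
      in r₂ , ≤-trans r₂≤ (≤-trans (+-monoˡ-≤ (g * f) r₁≤) (≤-reflexive (+-assoc r f (g * f)))) , K₂ , h₂
      where
      open ≤-Reasoning
      instance
        8p≢0 : NonZero (8 * p)
        8p≢0 = m*n≢0 8 p {{_}} {{>-nonZero 1≤p}}
      κ = card A / (8 * p)
      lo : 8 * (p * κ) ≤ card A
      lo = begin
        8 * (p * κ)    ≡⟨ trans (sym (*-assoc 8 p κ)) (*-comm (8 * p) κ) ⟩
        κ * (8 * p)    ≤⟨ m/n*n≤m (card A) (8 * p) ⟩
        card A         ∎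
      above : card A < 8 * p + 8 * p * κ
      above = begin-strict
        card A                            ≡⟨ m≡m%n+[m/n]*n (card A) (8 * p) ⟩
        card A % (8 * p) + κ * (8 * p)    <⟨ +-monoˡ-< (κ * (8 * p)) (m%n<n (card A) (8 * p)) ⟩
        8 * p + κ * (8 * p)               ≡⟨ cong (8 * p +_) (*-comm κ (8 * p)) ⟩
        8 * p + 8 * p * κ                 ∎
      -- The stopping size `16 * (t * p)` is what ensures this: on a rich line at most half of the
      -- required `κ` points belong to `Q`.
      2t≤κ : 2 * t ≤ κ
      2t≤κ = ≤-pred (*-cancelˡ-< (8 * p) _ _ (begin-strict
        8 * p * (2 * t)                   ≡⟨ solve 2 (λ p t → con 8 :* p :* (con 2 :* t) := con 16 :* (t :* p)) refl p t ⟩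
        16 * (t * p)                      <⟨ ≰⇒> big ⟩
        card A                            <⟨ above ⟩
        8 * p + 8 * p * κ                 ≡⟨ sym (*-suc (8 * p) κ) ⟩
        8 * p * suc κ                     ∎))
      hi : card A ≤ 16 * (p * κ)
      hi = begin
        card A                            ≤⟨ <⇒≤ above ⟩
        8 * p + 8 * p * κ                 ≤⟨ +-monoˡ-≤ (8 * p * κ) (≤-trans (≤-reflexive (sym (*-identityʳ (8 * p))))
                                               (*-monoʳ-≤ (8 * p) (≤-trans (*-mono-≤ (s≤s (z≤n {1})) 1≤t) 2t≤κ))) ⟩
        8 * p * κ + 8 * p * κ             ≡⟨ solve 2 (λ p k → con 8 :* p :* k :+ con 8 :* p :* k := con 16 :* (p :* k)) refl p κ ⟩
        16 * (p * κ)                      ∎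
      κ≤N : κ ≤ N
      κ≤N = ≤-trans (≤-trans (m≤n*m κ (8 * p)) (≤-trans (≤-reflexive (*-assoc 8 p κ)) lo)) (card≤n A)

-- Sums over lists.

lsum : {X : Set} → (X → ℕ) → List X → ℕ
lsum f []       = 0
lsum f (x ∷ xs) = f x + lsum f xs

lsum-mono : {X : Set} {f g : X → ℕ} → (∀ x → f x ≤ g x) → ∀ xs → lsum f xs ≤ lsum g xs
lsum-mono h []       = z≤n
lsum-mono h (x ∷ xs) = +-mono-≤ (h x) (lsum-mono h xs)

lsum-const : {X : Set} (c : ℕ) (xs : List X) → lsum (λ _ → c) xs ≡ length xs * c
lsum-const c []       = refl
lsum-const c (x ∷ xs) = cong (c +_) (lsum-const c xs)

lsum-++ : {X : Set} (f : X → ℕ) (xs ys : List X) → lsum f (xs ++ ys) ≡ lsum f xs + lsum f ys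
lsum-++ f []       ys = refl
lsum-++ f (x ∷ xs) ys = trans (cong (f x +_) (lsum-++ f xs ys)) (sym (+-assoc (f x) _ _))

lsum-map : {X Y : Set} (f : Y → ℕ) (g : X → Y) (xs : List X) → lsum f (map g xs) ≡ lsum (f ∘ g) xs
lsum-map f g []       = refl
lsum-map f g (x ∷ xs) = cong (f (g x) +_) (lsum-map f g xs)

lsum-tabulate : ∀ {n} {X : Set} (f : X → ℕ) (g : Fin n → X) → lsum f (tabulateₗ g) ≡ sum (f ∘ g)
lsum-tabulate {zero}  f g = refl
lsum-tabulate {suc n} f g = cong (f (g zero) +_) (lsum-tabulate f (g ∘ suc))

lsum-product : {X Y : Set} (f : X × Y → ℕ) (xs : List X) (ys : List Y) →
  lsum f (cartesianProduct xs ys) ≡ lsum (λ x → lsum (λ y → f (x , y)) ys) xs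
lsum-product f []       ys = refl
lsum-product f (x ∷ xs) ys = trans (lsum-++ f (map (x ,_) ys) (cartesianProduct xs ys))
  (cong₂ _+_ (lsum-map f (x ,_) ys) (lsum-product f xs ys))

lsum-filter : {X : Set} {P : X → Set} (P? : ∀ x → Dec (P x)) (f : X → ℕ) (xs : List X) → lsum f (filter P? xs) ≤ lsum f xs
lsum-filter P? f []       = z≤n
lsum-filter P? f (x ∷ xs) with P? x
... | yes _ = +-monoʳ-≤ (f x) (lsum-filter P? f xs)
... | no _  = ≤-trans (lsum-filter P? f xs) (m≤n+m _ (f x))

length-filter-lsum : {X : Set} {P : X → Set} (P? : ∀ x → Dec (P x)) (xs : List X) → length (filter P? xs) ≡ lsum (λ x → 𝟙 (does (P? x))) xs
length-filter-lsum P? []       = refl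
length-filter-lsum P? (x ∷ xs) with P? x
... | yes _ = cong suc (length-filter-lsum P? xs)
... | no _  = length-filter-lsum P? xs

lsum-bound : {X : Set} {f : X → ℕ} {c : ℕ} → (∀ x → f x ≤ c) → ∀ xs → lsum f xs ≤ length xs * c
lsum-bound {c = c} h xs = ≤-trans (lsum-mono h xs) (≤-reflexive (lsum-const c xs))

lsum-term : {X : Set} (f : X → ℕ) {x : X} {xs : List X} → x ∈ₗ xs → f x ≤ lsum f xs
lsum-term f (here refl) = m≤m+n _ _
lsum-term f (there h)   = ≤-trans (lsum-term f h) (m≤n+m _ _)

lsum-* : {X : Set} (c : ℕ) (f : X → ℕ) (xs : List X) → lsum (λ x → c * f x) xs ≡ c * lsum f xs
lsum-* c f []       = sym (*-zeroʳ c)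
lsum-* c f (x ∷ xs) = trans (cong (c * f x +_) (lsum-* c f xs)) (sym (*-distribˡ-+ c (f x) _))

wsum-lsum : ∀ d {n} {X : Set} (f : X → Subset n → ℕ) (xs : List X) → wsum d (λ S → lsum (λ x → f x S) xs) ≡ lsum (λ x → wsum d (f x)) xs
wsum-lsum d {n} f []       = trans (wsum-const d n 0) (*-zeroʳ (suc d ^ n))
wsum-lsum d f (x ∷ xs) = trans (wsum-+ d (f x) (λ S → lsum (λ x → f x S) xs)) (cong (wsum d (f x) +_) (wsum-lsum d f xs))

-- Degree conditions for Janson's inequality.

degree : ∀ {n} → List (Subset n) → Fin n → ℕ
degree Hs x = lsum (λ H → 𝟙 (lookup H x)) Hs

-- Each neighbour contains some point of `H` and so is counted at least once in the degrees along
-- `H`.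
neighbours≤ : ∀ {n} (H : Subset n) Hs → neighbours H Hs ≤ sum (λ x → 𝟙 (lookup H x) * degree Hs x)
neighbours≤ {n} H []        = z≤n
neighbours≤ {n} H (H′ ∷ Hs) = begin
  𝟙 (meets H H′) + neighbours H Hs
    ≤⟨ +-mono-≤ common (neighbours≤ H Hs) ⟩
  sum (λ x → 𝟙 (lookup H x) * 𝟙 (lookup H′ x)) + sum (λ x → 𝟙 (lookup H x) * degree Hs x)
    ≡⟨ sym (∑-distrib-+ (λ x → 𝟙 (lookup H x) * 𝟙 (lookup H′ x)) (λ x → 𝟙 (lookup H x) * degree Hs x)) ⟩
  sum (λ x → 𝟙 (lookup H x) * 𝟙 (lookup H′ x) + 𝟙 (lookup H x) * degree Hs x)
    ≡⟨ sum-cong-≗ (λ x → sym (*-distribˡ-+ (𝟙 (lookup H x)) (𝟙 (lookup H′ x)) (degree Hs x))) ⟩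
  sum (λ x → 𝟙 (lookup H x) * (𝟙 (lookup H′ x) + degree Hs x)) ∎
  where
  open ≤-Reasoning
  common : 𝟙 (meets H H′) ≤ sum (λ x → 𝟙 (lookup H x) * 𝟙 (lookup H′ x))
  common with bool-case (meets H H′)
  ... | inj₂ e = ≤-trans (≤-reflexive (cong 𝟙 e)) z≤n
  ... | inj₁ e = let (x , p , q) = meets-witness H H′ e in
    ≤-trans (≤-reflexive (trans (cong 𝟙 e) (sym (cong₂ (λ a b → 𝟙 a * 𝟙 b) p q)))) (∑-term (λ x → 𝟙 (lookup H x) * 𝟙 (lookup H′ x)) x)

spread : ∀ {n J D} (Hs : List (Subset n)) → All (λ H → card H ≡ J) Hs → (∀ x → degree Hs x ≤ D) → 4 * (J * D) ≤ 2 ^ J →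
  AllPairs (λ H H′ → J + J ≤ suc (card (H ∪ H′))) Hs → Spread J Hs
spread [] _ _ _ _ = []
spread {J = J} {D} (H ∷ Hs) (hJ ∷ all) deg small (far ∷ pairs) = add hJ few (All.lookup far) (spread Hs all deg′ small pairs)
  where
  open ≤-Reasoning
  deg′ : ∀ x → degree Hs x ≤ D
  deg′ x = ≤-trans (m≤n+m _ (𝟙 (lookup H x))) (deg x)
  few : 4 * neighbours H Hs ≤ 2 ^ J
  few = begin
    4 * neighbours H Hs                                  ≤⟨ *-monoʳ-≤ 4 (neighbours≤ H Hs) ⟩
    4 * sum (λ x → 𝟙 (lookup H x) * degree Hs x)         ≤⟨ *-monoʳ-≤ 4 (∑-mono (λ x → *-monoʳ-≤ (𝟙 (lookup H x)) (deg′ x))) ⟩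
    4 * sum (λ x → 𝟙 (lookup H x) * D)                   ≡⟨ cong (4 *_) (sym (*-distribʳ-sum D (λ x → 𝟙 (lookup H x)))) ⟩
    4 * (card H * D)                                     ≡⟨ cong (λ z → 4 * (z * D)) hJ ⟩
    4 * (J * D)                                          ≤⟨ small ⟩
    2 ^ J                                                ∎

card-∪ : ∀ {n} (S T : Subset n) → card S + card T ≡ card (S ∪ T) + card (S ∩ T)
card-∪ S T = trans (sym (∑-distrib-+ (λ x → 𝟙 (lookup S x)) (λ x → 𝟙 (lookup T x))))
  (trans (sum-cong-≗ each) (∑-distrib-+ (λ x → 𝟙 (lookup (S ∪ T) x)) (λ x → 𝟙 (lookup (S ∩ T) x))))
  where
  bits : ∀ a b → 𝟙 a + 𝟙 b ≡ 𝟙 (a ∨ b) + 𝟙 (a ∧ b)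
  bits true  b = refl
  bits false b = sym (+-identityʳ (𝟙 b))
  each : ∀ x → 𝟙 (lookup S x) + 𝟙 (lookup T x) ≡ 𝟙 (lookup (S ∪ T) x) + 𝟙 (lookup (S ∩ T) x)
  each x = trans (bits (lookup S x) (lookup T x)) (cong₂ (λ a b → 𝟙 a + 𝟙 b) (sym (lookup-∪ S T x)) (sym (lookup-∩ S T x)))

card≤1 : ∀ {n} (S : Subset n) → (∀ {x y} → lookup S x ≡ true → lookup S y ≡ true → x ≡ y) → card S ≤ 1
card≤1 S = ∑-unique≤1 (lookup S)

-- (1 - 1/X)^X ≤ 1/2 with X = suc e.
decay-half : ∀ e → 2 * e ^ suc e ≤ suc e ^ suc e
decay-half zero    = z≤n
decay-half e@(suc _) = ≤-trans (≤-reflexive (cong (e ^ suc e +_) (+-identityʳ (e ^ suc e)))) (≤-trans (+-monoʳ-≤ (e ^ suc e) (*-monoˡ-≤ (e ^ e) (n≤1+n e))) (two (suc e)))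
  where
  open ≤-Reasoning
  two : ∀ k → e ^ k + k * e ^ (k ∸ 1) ≤ suc e ^ k
  two zero    = ≤-refl
  two (suc zero) = ≤-reflexive (solve 1 (λ e → e :* con 1 :+ con 1 :* con 1 := (con 1 :+ e) :* con 1) refl e)
  two (suc k@(suc i)) = begin
    e * e ^ k + suc k * e ^ k               ≡⟨ solve 3 (λ e a k → e :* a :+ (con 1 :+ k) :* a := e :* a :+ k :* a :+ a) refl e (e ^ k) k ⟩
    e * e ^ k + k * (e * e ^ i) + e ^ k     ≡⟨ solve 4 (λ e a k b → e :* a :+ k :* (e :* b) :+ a := e :* (a :+ k :* b) :+ a) refl e (e ^ k) k (e ^ i) ⟩
    e * (e ^ k + k * e ^ i) + e ^ k         ≤⟨ +-mono-≤ (*-monoʳ-≤ e (two k)) (≤-trans (m≤m+n _ _) (two k)) ⟩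
    e * suc e ^ k + suc e ^ k               ≡⟨ +-comm (e * suc e ^ k) _ ⟩
    suc e * suc e ^ k                       ∎

-- The exponent contains `q` blocks of length `suc e`, each worth a factor 1/2 by `decay-half`; what
-- remains is at most 1.
decay-power : ∀ e q r → q * suc e ≤ r → e ^ r * 2 ^ q ≤ suc e ^ r
decay-power e q r h = subst (λ r → e ^ r * 2 ^ q ≤ suc e ^ r) (m+[n∸m]≡n h) (begin
  e ^ (q * X + s) * 2 ^ q               ≡⟨ cong (_* 2 ^ q) (trans (^-distribˡ-+-* e (q * X) s) (cong (_* e ^ s) (trans (cong (e ^_) (*-comm q X)) (sym (^-*-assoc e X q))))) ⟩
  (e ^ X) ^ q * e ^ s * 2 ^ q           ≡⟨ solve 3 (λ a b c → a :* b :* c := c :* a :* b) refl ((e ^ X) ^ q) (e ^ s) (2 ^ q) ⟩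
  2 ^ q * (e ^ X) ^ q * e ^ s           ≡⟨ cong (_* e ^ s) (sym (dist q)) ⟩
  (2 * e ^ X) ^ q * e ^ s               ≤⟨ *-mono-≤ (^-monoˡ-≤ q (decay-half e)) (^-monoˡ-≤ s (n≤1+n e)) ⟩
  (X ^ X) ^ q * X ^ s                   ≡⟨ cong (_* X ^ s) (trans (^-*-assoc X X q) (cong (X ^_) (*-comm X q))) ⟩
  X ^ (q * X) * X ^ s                   ≡⟨ sym (^-distribˡ-+-* X (q * X) s) ⟩
  X ^ (q * X + s)                       ∎)
  where
  open ≤-Reasoning
  X = suc e
  s = r ∸ q * X
  dist : ∀ k → (2 * e ^ X) ^ k ≡ 2 ^ k * (e ^ X) ^ k
  dist zero    = refl
  dist (suc k) = trans (cong (2 * e ^ X *_) (dist k))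
    (solve 3 (λ a b c → con 2 :* a :* (b :* c) := con 2 :* b :* (a :* c)) refl (e ^ X) (2 ^ k) ((e ^ X) ^ k))

-- The rare event attached to one pair (A , E).

module Family {p N : ℕ} (ln : Fin p → Fin N → Fin p)
  (meet : ∀ {a a′ x y} → x ≢ y → ln a x ≡ ln a y → ln a′ x ≡ ln a′ y → a ≡ a′)
  (size : ∀ a b → card (Net.line ln meet a b) ≡ p)
  (A E : Subset N) (t J v w : ℕ) (J≡ : J ≡ v + w) (1≤t : 1 ≤ t) (64t≤J : 64 * t ≤ J) (J≤p : J ≤ p) (2^w≤p : 2 ^ w ≤ p) (4J≤ : 4 * J ≤ 2 ^ v)
  (A≤ : card A ≤ 16 * (t * p)) (E≤ : 4 * card E ≤ p) where

  open Net ln meet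

  -- On such a line a transversal covered by `A` and `E` must use a point of `A`, and it has at most
  -- `J` of them to choose from.
  Good : Fin p × Fin p → Set
  Good (a , b) = load A a b ≤ J × load E a b ≡ 0

  good? : ∀ ab → Dec (Good ab)
  good? (a , b) = (load A a b ≤? J) ×-dec (load E a b ≟ 0)

  padded : ∀ a b → load A a b ≤ J → ∃ λ H → (A ∩ line a b) ⊑ H × H ⊑ line a b × card H ≡ J
  padded a b h = interpolate (A ∩ line a b) (line a b) J (∩⊑ʳ A (line a b)) h (≤-trans J≤p (≤-reflexive (sym (size a b))))

  -- Enlarging the trace of `A` only makes it easier to meet, and it gives all members the same
  -- size. The whole line is a filler value where the trace is already too large.
  pad : Fin p × Fin p → Subset N
  pad (a , b) with load A a b ≤? J
  ... | yes h = proj₁ (padded a b h)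
  ... | no _  = line a b

  pad⊑line : ∀ a b → pad (a , b) ⊑ line a b
  pad⊑line a b with load A a b ≤? J
  ... | yes h = proj₁ (proj₂ (proj₂ (padded a b h)))
  ... | no _  = λ x e → e

  ⊑pad : ∀ a b → Good (a , b) → (A ∩ line a b) ⊑ pad (a , b)
  ⊑pad a b (h , _) with load A a b ≤? J
  ... | yes h′ = proj₁ (proj₂ (padded a b h′))
  ... | no ¬h  = ⊥-elim (¬h h)

  card-pad : ∀ ab → Good ab → card (pad ab) ≡ J
  card-pad (a , b) (h , _) with load A a b ≤? J
  ... | yes h′ = proj₂ (proj₂ (proj₂ (padded a b h′)))
  ... | no ¬h  = ⊥-elim (¬h h)

  -- With `2 ^ w` classes a point lies in at most `2 ^ w` members, few enough compared with `2 ^ J`.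
  -- The exponent obtained from Janson's inequality, about `2 ^ w * p` over `2 ^ J`, depends on `v`
  -- alone and does not suffer.
  classes : List (Fin p)
  classes = take (2 ^ w) (allFin p)

  lines : List (Fin p × Fin p)
  lines = filter good? (cartesianProduct classes (allFin p))

  family : List (Subset N)
  family = map pad lines

  length-classes : length classes ≡ 2 ^ w
  length-classes = trans (length-take (2 ^ w) (allFin p)) (trans (cong (2 ^ w ⊓_) (length-tabulate {n = p} id)) (m≤n⇒m⊓n≡m 2^w≤p))

  on : ∀ {a b x} → lookup (pad (a , b)) x ≡ true → ln a x ≡ b
  on {a} {b} {x} h = does-true (ln a x ≟ᶠ b) (trans (sym (on-line a b x)) (pad⊑line a b x h))

  pads-meet : ∀ {ab ab′} → Good ab → Good ab′ → ab ≢ ab′ → J + J ≤ suc (card (pad ab ∪ pad ab′))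
  pads-meet {ab@(a , b)} {ab′@(a′ , b′)} g g′ ne = begin
    J + J                                           ≡⟨ sym (cong₂ _+_ (card-pad ab g) (card-pad ab′ g′)) ⟩
    card (pad ab) + card (pad ab′)                  ≡⟨ card-∪ (pad ab) (pad ab′) ⟩
    card (pad ab ∪ pad ab′) + card (pad ab ∩ pad ab′) ≤⟨ +-monoʳ-≤ (card (pad ab ∪ pad ab′)) (card≤1 (pad ab ∩ pad ab′) same) ⟩
    card (pad ab ∪ pad ab′) + 1                     ≡⟨ +-comm _ 1 ⟩
    suc (card (pad ab ∪ pad ab′))                   ∎
    where
    open ≤-Reasoning
    same : ∀ {x y} → lookup (pad ab ∩ pad ab′) x ≡ true → lookup (pad ab ∩ pad ab′) y ≡ true → x ≡ y
    same {x} {y} hx hy with x ≟ᶠ y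
    ... | yes x≡y = x≡y
    ... | no x≢y = ⊥-elim (ne (cong₂ _,_ a≡a′ b≡b′))
      where
      x₁ = on {a} {b} (∩⊑ˡ (pad ab) (pad ab′) x hx)
      x₂ = on {a′} {b′} (∩⊑ʳ (pad ab) (pad ab′) x hx)
      y₁ = on {a} {b} (∩⊑ˡ (pad ab) (pad ab′) y hy)
      y₂ = on {a′} {b′} (∩⊑ʳ (pad ab) (pad ab′) y hy)
      a≡a′ : a ≡ a′
      a≡a′ = meet x≢y (trans x₁ (sym y₁)) (trans x₂ (sym y₂))
      b≡b′ : b ≡ b′
      b≡b′ = trans (sym x₁) (trans (cong (λ c → ln c x) a≡a′) x₂)

  degree≤ : ∀ x → degree family x ≤ 2 ^ w
  degree≤ x = begin
    degree family x
      ≡⟨ lsum-map (λ H → 𝟙 (lookup H x)) pad lines ⟩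
    lsum (λ ab → 𝟙 (lookup (pad ab) x)) lines
      ≤⟨ lsum-filter good? (λ ab → 𝟙 (lookup (pad ab) x)) (cartesianProduct classes (allFin p)) ⟩
    lsum (λ ab → 𝟙 (lookup (pad ab) x)) (cartesianProduct classes (allFin p))
      ≡⟨ lsum-product (λ ab → 𝟙 (lookup (pad ab) x)) classes (allFin p) ⟩
    lsum (λ a → lsum (λ b → 𝟙 (lookup (pad (a , b)) x)) (allFin p)) classes
      ≤⟨ lsum-bound class-degree classes ⟩
    length classes * 1
      ≡⟨ trans (*-identityʳ _) length-classes ⟩
    2 ^ w ∎
    where
    open ≤-Reasoning
    class-degree : ∀ a → lsum (λ b → 𝟙 (lookup (pad (a , b)) x)) (allFin p) ≤ 1
    class-degree a = ≤-trans (≤-reflexive (lsum-tabulate (λ b → 𝟙 (lookup (pad (a , b)) x)) id))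
      (∑-unique≤1 (λ b → lookup (pad (a , b)) x) (λ h h′ → trans (sym (on h)) (on h′)))

  pairwise : ∀ xs → All Good xs → Unique xs → AllPairs (λ H H′ → J + J ≤ suc (card (H ∪ H′))) (map pad xs)
  pairwise [] _ _ = []
  pairwise (x ∷ xs) (g ∷ gs) (u ∷ us) = apart xs gs u ∷ pairwise xs gs us
    where
    apart : ∀ ys → All Good ys → All (x ≢_) ys → All (λ H′ → J + J ≤ suc (card (pad x ∪ H′))) (map pad ys)
    apart [] _ _ = []
    apart (y ∷ ys) (h ∷ hs) (ne ∷ nes) = pads-meet g h ne ∷ apart ys hs nes

  cards : ∀ xs → All Good xs → All (λ H → card H ≡ J) (map pad xs)
  cards [] _ = []
  cards (x ∷ xs) (g ∷ gs) = card-pad x g ∷ cards xs gs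

  family-spread : Spread J family
  family-spread = spread family (cards lines all-good) degree≤ small
    (pairwise lines all-good (Unique.filter⁺ good? (Unique.cartesianProduct⁺ (Unique.take⁺ (2 ^ w) (Unique.allFin⁺ p)) (Unique.allFin⁺ p))))
    where
    all-good : All Good lines
    all-good = all-filter good? (cartesianProduct classes (allFin p))
    open ≤-Reasoning
    small : 4 * (J * 2 ^ w) ≤ 2 ^ J
    small = begin
      4 * (J * 2 ^ w)   ≡⟨ sym (*-assoc 4 J (2 ^ w)) ⟩
      4 * J * 2 ^ w     ≤⟨ *-monoˡ-≤ (2 ^ w) 4J≤ ⟩
      2 ^ v * 2 ^ w     ≡⟨ sym (^-distribˡ-+-* 2 v w) ⟩
      2 ^ (v + w)       ≡⟨ cong (2 ^_) (sym J≡) ⟩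
      2 ^ J             ∎

  -- In each class at most a quarter of the lines has more than `J` points of `A`, as
  -- `card A ≤ 16 * (t * p)` and `64 * t ≤ J`. At most another quarter meets `E`, because lines of
  -- one class are disjoint and `4 * card E ≤ p`.
  length-family : 2 ^ w * p ≤ 2 * length family
  length-family = begin
    2 ^ w * p                                     ≡⟨ cong (_* p) (sym length-classes) ⟩
    length classes * p                            ≡⟨ sym (lsum-const p classes) ⟩
    lsum (λ _ → p) classes                        ≤⟨ lsum-mono half classes ⟩
    lsum (λ a → 2 * lsum (λ b → 𝟙 (does (good? (a , b)))) (allFin p)) classes
      ≡⟨ lsum-* 2 (λ a → lsum (λ b → 𝟙 (does (good? (a , b)))) (allFin p)) classes ⟩
    2 * lsum (λ a → lsum (λ b → 𝟙 (does (good? (a , b)))) (allFin p)) classes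
      ≡⟨ cong (2 *_) (sym (lsum-product (λ ab → 𝟙 (does (good? ab))) classes (allFin p))) ⟩
    2 * lsum (λ ab → 𝟙 (does (good? ab))) (cartesianProduct classes (allFin p))
      ≡⟨ cong (2 *_) (sym (length-filter-lsum good? (cartesianProduct classes (allFin p)))) ⟩
    2 * length lines                              ≡⟨ cong (2 *_) (sym (length-map pad lines)) ⟩
    2 * length family                             ∎
    where
    open ≤-Reasoning
    half : ∀ a → p ≤ 2 * lsum (λ b → 𝟙 (does (good? (a , b)))) (allFin p)
    half a = *-cancelˡ-≤ 2 (+-cancelʳ-≤ (2 * p) _ _ (begin
      2 * p + 2 * p                                ≡⟨ solve 1 (λ p → con 2 :* p :+ con 2 :* p := con 4 :* p) refl p ⟩
      4 * p                                        ≤⟨ *-monoʳ-≤ 4 count ⟩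
      4 * (g + (o + card E))                       ≡⟨ solve 3 (λ g o e → con 4 :* (g :+ (o :+ e)) := con 4 :* g :+ (con 4 :* o :+ con 4 :* e)) refl g o (card E) ⟩
      4 * g + (4 * o + 4 * card E)                 ≤⟨ +-monoʳ-≤ (4 * g) (+-mono-≤ over E≤) ⟩
      4 * g + (p + p)                              ≡⟨ solve 2 (λ g p → con 4 :* g :+ (p :+ p) := con 2 :* (con 2 :* g) :+ con 2 :* p) refl g p ⟩
      2 * (2 * g) + 2 * p                          ≡⟨ cong (λ z → 2 * (2 * z) + 2 * p) (sym (lsum-tabulate (λ b → 𝟙 (does (good? (a , b)))) id)) ⟩
      2 * (2 * lsum (λ b → 𝟙 (does (good? (a , b)))) (allFin p)) + 2 * p ∎))
      where
      heavyA : Fin p → ℕ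
      heavyA b = 𝟙 (suc J ≤ᵇ load A a b)
      g = sum (λ b → 𝟙 (does (good? (a , b))))
      o = sum heavyA
      each : ∀ b → 1 ≤ 𝟙 (does (good? (a , b))) + (heavyA b + load E a b)
      each b with load A a b ≤? J | load E a b ≟ 0
      ... | no ¬h | _      = ≤-trans (≤-reflexive (cong 𝟙 (sym (does-yes (suc J ≤? load A a b) (≰⇒> ¬h)))))
                              (≤-trans (m≤m+n (heavyA b) (load E a b)) (m≤n+m (heavyA b + load E a b) (𝟙 (does (good? (a , b))))))
      ... | yes h | yes e₀ = ≤-trans (≤-reflexive (cong 𝟙 (sym (does-yes (good? (a , b)) (h , e₀))))) (m≤m+n (𝟙 (does (good? (a , b)))) (heavyA b + load E a b))
      ... | yes _ | no ¬e  = ≤-trans (n≢0⇒n>0 ¬e) (≤-trans (m≤n+m (load E a b) (heavyA b)) (m≤n+m (heavyA b + load E a b) (𝟙 (does (good? (a , b))))))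
      count : p ≤ g + (o + card E)
      count = begin
        p                                          ≡⟨ sym (*-identityʳ p) ⟩
        p * 1                                      ≡⟨ sym (∑-const p 1) ⟩
        sum {p} (λ _ → 1)                          ≤⟨ ∑-mono each ⟩
        sum (λ b → 𝟙 (does (good? (a , b))) + (heavyA b + load E a b))
          ≡⟨ trans (∑-distrib-+ (λ b → 𝟙 (does (good? (a , b)))) (λ b → heavyA b + load E a b))
               (cong (g +_) (∑-distrib-+ heavyA (load E a))) ⟩
        g + (o + sum (load E a))                   ≡⟨ cong (λ z → g + (o + z)) (class-total E a) ⟩
        g + (o + card E)                           ∎
      over : 4 * o ≤ p
      over = *-cancelˡ-≤ (16 * t) {{m*n≢0 16 t {{_}} {{>-nonZero 1≤t}}}} (begin
        16 * t * (4 * o)                           ≡⟨ solve 3 (λ s t o → s :* t :* (con 4 :* o) := s :* con 4 :* t :* o) refl 16 t o ⟩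
        64 * t * o                                 ≤⟨ *-monoˡ-≤ o 64t≤J ⟩
        J * o                                      ≡⟨ *-distribˡ-sum J heavyA ⟩
        sum (λ b → J * heavyA b)                   ≤⟨ ∑-mono (λ b → ≤-trans (≤-reflexive (*-comm J (heavyA b)))
                                                       (𝟙-*-≤ (suc J ≤ᵇ load A a b) (λ e → <⇒≤ (does-true (suc J ≤? load A a b) e)))) ⟩
        sum (load A a)                             ≡⟨ class-total A a ⟩
        card A                                     ≤⟨ A≤ ⟩
        16 * (t * p)                               ≡⟨ sym (*-assoc 16 t p) ⟩
        16 * t * p                                 ∎)

  -- By `hits-weight` each member contributes a factor 1 - 1/X, where X is `2 * 2 ^ J`, and there
  -- are at least `q` times X members.
  family-rare : ∀ q → q * 2 ^ (2 + v) ≤ p → wsum 1 (hits family) * 2 ^ q ≤ 2 ^ N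
  family-rare q q≤ = *-cancelʳ-≤ _ _ (X ^ r) {{m^n≢0 X r}} (begin
    W * 2 ^ q * X ^ r         ≡⟨ solve 3 (λ w q x → w :* q :* x := w :* x :* q) refl W (2 ^ q) (X ^ r) ⟩
    W * X ^ r * 2 ^ q         ≤⟨ *-monoˡ-≤ (2 ^ q) (hits-weight e X≡ family-spread) ⟩
    2 ^ N * e ^ r * 2 ^ q     ≡⟨ *-assoc (2 ^ N) (e ^ r) (2 ^ q) ⟩
    2 ^ N * (e ^ r * 2 ^ q)   ≤⟨ *-monoʳ-≤ (2 ^ N) (decay-power e q r many) ⟩
    2 ^ N * X ^ r             ∎)
    where
    open ≤-Reasoning
    e = pred (2 * 2 ^ J)
    X = suc e
    X≡ : X ≡ 2 * 2 ^ J
    X≡ = suc-pred (2 * 2 ^ J) {{m^n≢0 2 (suc J)}}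
    r = length family
    W = wsum 1 (hits family)
    many : q * X ≤ r
    many = *-cancelˡ-≤ 2 (begin
      2 * (q * X)                   ≡⟨ cong (λ z → 2 * (q * z)) X≡ ⟩
      2 * (q * (2 * 2 ^ J))         ≡⟨ cong (λ z → 2 * (q * (2 * z))) (trans (cong (2 ^_) J≡) (^-distribˡ-+-* 2 v w)) ⟩
      2 * (q * (2 * (2 ^ v * 2 ^ w))) ≡⟨ solve 3 (λ q v w → con 2 :* (q :* (con 2 :* (v :* w))) := w :* (q :* (con 2 :* (con 2 :* v)))) refl q (2 ^ v) (2 ^ w) ⟩
      2 ^ w * (q * 2 ^ (2 + v))     ≤⟨ *-monoʳ-≤ (2 ^ w) q≤ ⟩
      2 ^ w * p                     ≤⟨ length-family ⟩
      2 * r                         ∎)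

  transversal-hits : ∀ (Q S : Subset N) → Q ⊑ S → (∀ x → lookup Q x ≡ true → lookup A x ≡ true ⊎ lookup E x ≡ true) →
    (∀ a b → 1 ≤ load Q a b) → 1 ≤ hits family S
  transversal-hits Q S Q⊑S cover blocked = go lines (all-filter good? (cartesianProduct classes (allFin p)))
    where
    one : ∀ a b → Good (a , b) → meets (pad (a , b)) S ≡ true
    one a b g@(_ , E0) with card-inhabited (Q ∩ line a b) (blocked a b)
    ... | x , h with cover x (∩⊑ˡ Q (line a b) x h)
    ...   | inj₁ xA = meets-true (pad (a , b)) S x (⊑pad a b g x (∩-join A (line a b) x xA (∩⊑ʳ Q (line a b) x h))) (Q⊑S x (∩⊑ˡ Q (line a b) x h))
    ...   | inj₂ xE = ⊥-elim (<⇒≱ (card-pos (E ∩ line a b) (∩-join E (line a b) x xE (∩⊑ʳ Q (line a b) x h))) (≤-reflexive E0))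
    go : ∀ xs → All Good xs → 1 ≤ hits (map pad xs) S
    go [] _ = ≤-refl
    go ((a , b) ∷ xs) (g ∷ gs) = *-mono-≤ {1} {𝟙 (meets (pad (a , b)) S)} (≤-reflexive (sym (cong 𝟙 (one a b g)))) (go xs gs)

-- Listing small subsets.

smallSubsets : ∀ n → ℕ → List (Subset n)
smallSubsets zero    m       = [] ∷ []
smallSubsets (suc n) zero    = map (false ∷_) (smallSubsets n zero)
smallSubsets (suc n) (suc m) = map (true ∷_) (smallSubsets n m) ++ map (false ∷_) (smallSubsets n (suc m))

length-smallSubsets : ∀ n m → length (smallSubsets n m) ≤ suc n ^ m
length-smallSubsets zero    m       = ≤-reflexive (sym (^-zeroˡ m))
length-smallSubsets (suc n) zero    = ≤-trans (≤-reflexive (length-map (false ∷_) (smallSubsets n zero))) (length-smallSubsets n zero)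
length-smallSubsets (suc n) (suc m) = begin
  length (map (true ∷_) (smallSubsets n m) ++ map (false ∷_) (smallSubsets n (suc m)))
    ≡⟨ trans (length-++ (map (true ∷_) (smallSubsets n m)))
         (cong₂ _+_ (length-map (true ∷_) (smallSubsets n m)) (length-map (false ∷_) (smallSubsets n (suc m)))) ⟩
  length (smallSubsets n m) + length (smallSubsets n (suc m))
    ≤⟨ +-mono-≤ (length-smallSubsets n m) (length-smallSubsets n (suc m)) ⟩
  suc n ^ m + suc n * suc n ^ m
    ≤⟨ *-monoʳ-≤ (suc (suc n)) (^-monoˡ-≤ m (n≤1+n (suc n))) ⟩
  suc (suc n) * suc (suc n) ^ m ∎
  where open ≤-Reasoning

∈-smallSubsets : ∀ {n} (G : Subset n) m → card G ≤ m → G ∈ₗ smallSubsets n m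
∈-smallSubsets []          m       h       = here refl
∈-smallSubsets (true ∷ G)  (suc m) (s≤s h) = ∈-++⁺ˡ (∈-map⁺ (true ∷_) (∈-smallSubsets G m h))
∈-smallSubsets (false ∷ G) zero    h       = ∈-map⁺ (false ∷_) (∈-smallSubsets G zero h)
∈-smallSubsets {suc n} (false ∷ G) (suc m) h =
  ∈-++⁺ʳ (map (true ∷_) (smallSubsets n m)) (∈-map⁺ (false ∷_) (∈-smallSubsets G (suc m) h))

∈-bind : {X Y : Set} {f : X → List Y} {x : X} {y : Y} {xs : List X} → x ∈ₗ xs → y ∈ₗ f x → y ∈ₗ concatMap f xs
∈-bind {f = f} x∈ y∈ = ∈-concatMap⁺ f (Any.map (λ { refl → y∈ }) x∈)

length-bind : {X Y : Set} {f : X → List Y} {c : ℕ} → (∀ x → length (f x) ≤ c) → ∀ xs → length (concatMap f xs) ≤ length xs * c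
length-bind h [] = z≤n
length-bind {f = f} h (x ∷ xs) = ≤-trans (≤-reflexive (length-++ (f x))) (+-mono-≤ (h x) (length-bind h xs))

length-product : {X Y : Set} (xs : List X) (ys : List Y) → length (cartesianProduct xs ys) ≡ length xs * length ys
length-product []       ys = refl
length-product (x ∷ xs) ys = trans (length-++ (map (x ,_) ys)) (cong₂ _+_ (length-map (x ,_) ys) (length-product xs ys))

m<n*[1+k]⇒≤k : ∀ {n x k m} → n * x ≤ m → m < n * suc k → x ≤ k
m<n*[1+k]⇒≤k {n} {x} {k} h h′ = ≤-pred (*-cancelˡ-< n x (suc k) (≤-<-trans h h′))

-- Union bound over all containers.

module Union {p N : ℕ} (ln : Fin p → Fin N → Fin p)
  (meet : ∀ {a a′ x y} → x ≢ y → ln a x ≡ ln a y → ln a′ x ≡ ln a′ y → a ≡ a′)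
  (size : ∀ a b → card (Net.line ln meet a b) ≡ p)
  (t c Z D₀ f g m₁ m₂ J v w q : ℕ)
  (1≤p : 1 ≤ p) (1≤t : 1 ≤ t) (c≥ : 4 * (6 * 16) ≤ c) (4t≤Z : 4 * t ≤ Z) (2t≤D₀ : 2 * t ≤ D₀) (room : 4 * c * (D₀ * Z) ^ t ≤ p)
  (fuel : suc t * (p * (p * 2 ^ t) * Z ^ t) * suc (2 * t) ^ f < suc (suc (2 * t)) ^ f)
  (doublings : N ≤ 2 ^ g * (16 * (t * p)))
  (m₁-bound : 3 * (t * p) < D₀ * suc m₁) (m₂-bound : g * f * (6 * c * (t * t * p)) < Z * suc m₂) (4m₂≤p : 4 * m₂ ≤ p)
  (J≡ : J ≡ v + w) (64t≤J : 64 * t ≤ J) (J≤p : J ≤ p) (2^w≤p : 2 ^ w ≤ p) (4J≤ : 4 * J ≤ 2 ^ v) (q≤ : q * 2 ^ (2 + v) ≤ p)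
  where

  open Net ln meet
  open Pruning ln meet

  refinements : Subset N → List (Subset N)
  refinements A = concatMap (λ κ → concatMap (λ j → map (λ G → prune κ j G A) (smallSubsets N m₁)) (upTo (suc t))) (upTo (suc N))

  reached : ℕ → List (Subset N)
  reached zero    = full ∷ []
  reached (suc r) = concatMap refinements (reached r)

  -- One round is described by `κ ≤ N`, a level `j ≤ t` and a sample of at most `m₁` points.
  choices : ℕ
  choices = suc N * (suc t * suc N ^ m₁)

  length-reached : ∀ r → length (reached r) ≤ choices ^ r
  length-reached zero    = ≤-refl
  length-reached (suc r) = begin
    length (concatMap refinements (reached r))  ≤⟨ length-bind one (reached r) ⟩
    length (reached r) * choices                ≤⟨ *-monoˡ-≤ choices (length-reached r) ⟩
    choices ^ r * choices                       ≡⟨ *-comm (choices ^ r) choices ⟩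
    choices * choices ^ r                       ∎
    where
    open ≤-Reasoning
    one : ∀ A → length (refinements A) ≤ choices
    one A = ≤-trans (length-bind {f = λ κ → concatMap (λ j → map (λ G → prune κ j G A) (smallSubsets N m₁)) (upTo (suc t))}
        (λ κ → ≤-trans (length-bind {f = λ j → map (λ G → prune κ j G A) (smallSubsets N m₁)}
            (λ j → ≤-trans (≤-reflexive (length-map (λ G → prune κ j G A) (smallSubsets N m₁))) (length-smallSubsets N m₁)) (upTo (suc t)))
          (*-monoˡ-≤ (suc N ^ m₁) (≤-reflexive (length-upTo (suc t))))) (upTo (suc N)))
      (*-monoˡ-≤ (suc t * suc N ^ m₁) (≤-reflexive (length-upTo (suc N))))

  R : ℕ
  R = g * f

  codes : List (Subset N × Subset N)
  codes = cartesianProduct (concatMap reached (upTo (suc R))) (smallSubsets N m₂)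

  codes-bound : ℕ
  codes-bound = suc R * choices ^ R * suc N ^ m₂

  length-codes : length codes ≤ codes-bound
  length-codes = ≤-trans (≤-reflexive (length-product (concatMap reached (upTo (suc R))) (smallSubsets N m₂)))
    (*-mono-≤ (≤-trans (bounded-bind (upTo (suc R)) (λ r∈ → ≤-pred (∈-upTo⁻ r∈))) (*-monoˡ-≤ (choices ^ R) (≤-reflexive (length-upTo (suc R)))))
      (length-smallSubsets N m₂))
    where
    open import Data.List.Membership.Propositional.Properties using (∈-upTo⁻)
    1≤choices : NonZero choices
    1≤choices = m*n≢0 (suc N) (suc t * suc N ^ m₁) {{_}} {{m*n≢0 (suc t) (suc N ^ m₁) {{_}} {{m^n≢0 (suc N) m₁}}}}
    bounded-bind : ∀ rs → (∀ {r} → r ∈ₗ rs → r ≤ R) → length (concatMap reached rs) ≤ length rs * choices ^ R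
    bounded-bind []       h = z≤n
    bounded-bind (r ∷ rs) h = ≤-trans (≤-reflexive (length-++ (reached r)))
      (+-mono-≤ (≤-trans (length-reached r) (^-monoʳ-≤ choices {{1≤choices}} (h (here refl)))) (bounded-bind rs (h ∘ there)))

  -- The family is defined only within the size limits. The default 0 elsewhere is harmless, since
  -- the pairs that arise from an actual `Q` respect the limits.
  weigh : ∀ A E → Dec (card A ≤ 16 * (t * p)) → Dec (4 * card E ≤ p) → Subset N → ℕ
  weigh A E (yes A≤) (yes E≤) S = hits (Family.family ln meet size A E t J v w J≡ 1≤t 64t≤J J≤p 2^w≤p 4J≤ A≤ E≤) S
  weigh A E (yes _)  (no _)   S = 0
  weigh A E (no _)   _        S = 0

  weight : Subset N × Subset N → Subset N → ℕ
  weight (A , E) = weigh A E (card A ≤? 16 * (t * p)) (4 * card E ≤? p)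

  weight-rare : ∀ AE → 2 ^ q * wsum 1 (weight AE) ≤ 2 ^ N
  weight-rare (A , E) with card A ≤? 16 * (t * p) | 4 * card E ≤? p
  ... | yes A≤ | yes E≤ = ≤-trans (≤-reflexive (*-comm (2 ^ q) _)) (Family.family-rare ln meet size A E t J v w J≡ 1≤t 64t≤J J≤p 2^w≤p 4J≤ A≤ E≤ q q≤)
  ... | yes _  | no _   = ≤-trans (≤-reflexive (trans (cong (2 ^ q *_) (trans (wsum-const 1 N 0) (*-zeroʳ (2 ^ N)))) (*-zeroʳ (2 ^ q)))) z≤n
  ... | no _   | _      = ≤-trans (≤-reflexive (trans (cong (2 ^ q *_) (trans (wsum-const 1 N 0) (*-zeroʳ (2 ^ N)))) (*-zeroʳ (2 ^ q)))) z≤n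

  -- If `bad S` vanishes, then `S` contains no set meeting every line in 1 to `t` points; this is
  -- `bad-complete`.
  bad : Subset N → ℕ
  bad S = lsum (λ AE → weight AE S) codes

  bad-rare : 2 ^ q * wsum 1 bad ≤ codes-bound * 2 ^ N
  bad-rare = begin
    2 ^ q * wsum 1 bad                              ≡⟨ cong (2 ^ q *_) (wsum-lsum 1 weight codes) ⟩
    2 ^ q * lsum (λ AE → wsum 1 (weight AE)) codes  ≡⟨ sym (lsum-* (2 ^ q) (λ AE → wsum 1 (weight AE)) codes) ⟩
    lsum (λ AE → 2 ^ q * wsum 1 (weight AE)) codes  ≤⟨ lsum-bound weight-rare codes ⟩
    length codes * 2 ^ N                            ≤⟨ *-monoˡ-≤ (2 ^ N) length-codes ⟩
    codes-bound * 2 ^ N                             ∎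
    where open ≤-Reasoning

  module _ (Q : Subset N) (blocked : ∀ a b → 1 ≤ load Q a b) (bounded : ∀ a b → load Q a b ≤ t) where
    open Containers ln meet Q t c c≥ 1≤p blocked bounded using (lost; moment≤; module Rounds)
    open Rounds Z D₀ 4t≤Z 2t≤D₀ room

    reached-complete : ∀ {r A} → Reach r A → A ∈ₗ reached r
    reached-complete start = here refl
    reached-complete (next κ j G reach κ≤N j≤t small) = ∈-bind {f = refinements} (reached-complete reach)
      (∈-bind (∈-upTo⁺ (s≤s κ≤N)) (∈-bind (∈-upTo⁺ (s≤s j≤t)) (∈-map⁺ _ (∈-smallSubsets G m₁ (m<n*[1+k]⇒≤k {D₀} small m₁-bound)))))

    potential≤ : ∀ κ A → potential κ A * suc (2 * t) ^ f < suc (suc (2 * t)) ^ f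
    potential≤ κ A = ≤-<-trans (*-monoˡ-≤ (suc (2 * t) ^ f) (∑-bound {f = term κ A} {p * (p * 2 ^ t) * Z ^ t} (λ i →
      *-mono-≤ (moment≤ κ A (toℕ i)) (^-monoʳ-≤ Z {{>-nonZero (≤-trans 1≤t (≤-trans (m≤n*m t 4) 4t≤Z))}} (≤-pred (toℕ<n i)))))) fuel

    contained : ∃ λ r → r ≤ R × ∃ λ (K : Container r) → card (Container.A K) ≤ 16 * (t * p)
    contained = contain f potential≤ g 0 (container full start (≤-trans (≤-reflexive (trans (cong (Z *_) lost-full) (*-zeroʳ Z))) z≤n))
      (≤-trans (card≤n full) doublings)
      where
      lost-full : lost full ≡ 0
      lost-full = ∑-zero (λ x → trans (cong (λ b → 𝟙 (lookup Q x) * 𝟙 (not b)) (lookup∘tabulate (λ _ → true) x)) (*-zeroʳ (𝟙 (lookup Q x))))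

    bad-complete : ∀ S → Q ⊑ S → 1 ≤ bad S
    bad-complete S Q⊑S with contained
    ... | r , r≤R , container A reach loss , A≤ = ≤-trans heavy-code (lsum-term (λ AE → weight AE S) {A , E} {codes}
            (∈-cartesianProduct⁺ (∈-bind {f = reached} (∈-upTo⁺ (s≤s r≤R)) (reached-complete reach)) (∈-smallSubsets E m₂ E≤)))
      where
      E = tabulate (λ x → lookup Q x ∧ not (lookup A x))
      E-lookup : ∀ x → lookup E x ≡ (lookup Q x ∧ not (lookup A x))
      E-lookup = lookup∘tabulate (λ x → lookup Q x ∧ not (lookup A x))
      E≤ : card E ≤ m₂
      E≤ = m<n*[1+k]⇒≤k {Z} (≤-trans (≤-reflexive (cong (Z *_)
             (sum-cong-≗ (λ x → trans (cong 𝟙 (E-lookup x)) (𝟙-∧ (lookup Q x) (not (lookup A x)))))))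
             (≤-trans loss (*-monoˡ-≤ (6 * c * (t * t * p)) r≤R))) m₂-bound
      cover : ∀ x → lookup Q x ≡ true → lookup A x ≡ true ⊎ lookup E x ≡ true
      cover x h with bool-case (lookup A x)
      ... | inj₁ e = inj₁ e
      ... | inj₂ e = inj₂ (trans (E-lookup x) (∧-join h (cong not e)))
      heavy-code : 1 ≤ weight (A , E) S
      heavy-code with card A ≤? 16 * (t * p) | 4 * card E ≤? p
      ... | yes A≤′ | yes E≤′ = Family.transversal-hits ln meet size A E t J v w J≡ 1≤t 64t≤J J≤p 2^w≤p 4J≤ A≤′ E≤′ Q S Q⊑S cover blocked
      ... | no ¬A≤  | _       = ⊥-elim (¬A≤ A≤)
      ... | yes _   | no ¬E≤  = ⊥-elim (¬E≤ (≤-trans (*-monoʳ-≤ 4 E≤) 4m₂≤p))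

-- Chernoff bounds

^-cancelˡ-≤ : ∀ k {m n} → m ^ suc k ≤ n ^ suc k → m ≤ n
^-cancelˡ-≤ k {m} {n} h with m ≤? n
... | yes m≤n = m≤n
... | no m≰n = ⊥-elim (<⇒≱ (^-monoˡ-< (suc k) (≰⇒> m≰n)) h)

wsum-∁ : ∀ {n} (f : Subset n → ℕ) → wsum 1 (f ∘ ∁) ≡ wsum 1 f
wsum-∁ {zero}  f = refl
wsum-∁ {suc n} f = trans (cong₂ (λ a b → a + 1 * b) (wsum-∁ (f ∘ (false ∷_))) (wsum-∁ (f ∘ (true ∷_))))
  (solve 2 (λ a b → a :+ con 1 :* b := b :+ con 1 :* a) refl (wsum 1 (f ∘ (false ∷_))) (wsum 1 (f ∘ (true ∷_))))

-- The threshold 9/20 is close enough to 1/2 for the factor 0.6 and far enough from it for an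
-- exponentially small probability.
low : ∀ {n} → Subset n → Subset n → Bool
low B S = card (S ∩ B) ≤ᵇ 9 * card B / 20

module Tilted (x y z : ℕ) (x≤y : x ≤ y) (x+y : x + y ≡ 2 * z) where

  -- An exponential moment with integer bases: each point of `B` contributes `x` if chosen and `y`
  -- if not, hence `z` on average.
  tilt : ∀ {n} → Subset n → Subset n → ℕ
  tilt []          []          = 1
  tilt (false ∷ B) (_ ∷ S)     = tilt B S
  tilt (true ∷ B)  (true ∷ S)  = x * tilt B S
  tilt (true ∷ B)  (false ∷ S) = y * tilt B S

  tilt-weight : ∀ {n} (B : Subset n) → wsum 1 (tilt B) ≡ z ^ card B * 2 ^ n
  tilt-weight [] = refl
  tilt-weight {suc n} (false ∷ B) = trans (cong (λ a → a + 1 * a) (tilt-weight B))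
    (solve 2 (λ a b → a :* b :+ con 1 :* (a :* b) := a :* (con 2 :* b)) refl (z ^ card B) (2 ^ n))
  tilt-weight {suc n} (true ∷ B) = begin
    wsum 1 (λ S → x * tilt B S) + 1 * wsum 1 (λ S → y * tilt B S)
      ≡⟨ cong₂ (λ a b → a + 1 * b) (wsum-* 1 x (tilt B)) (wsum-* 1 y (tilt B)) ⟩
    x * W + 1 * (y * W)                ≡⟨ solve 3 (λ x y w → x :* w :+ con 1 :* (y :* w) := (x :+ y) :* w) refl x y W ⟩
    (x + y) * W                        ≡⟨ cong₂ _*_ x+y (tilt-weight B) ⟩
    2 * z * (z ^ card B * 2 ^ n)       ≡⟨ solve 3 (λ z a b → con 2 :* z :* (a :* b) := z :* a :* (con 2 :* b)) refl z (z ^ card B) (2 ^ n) ⟩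
    z * z ^ card B * (2 * 2 ^ n)       ∎
    where
    open ≡-Reasoning
    W = wsum 1 (tilt B)

  -- As `x ≤ y`, the product is smallest when as many points are chosen as the bound `s` permits.
  tilt≥ : ∀ {n} (B S : Subset n) s r → s + r ≡ card B → card (S ∩ B) ≤ s → x ^ s * y ^ r ≤ tilt B S
  tilt≥ [] [] zero zero _ _ = ≤-refl
  tilt≥ (false ∷ B) (true ∷ S) s r e h = tilt≥ B S s r e h
  tilt≥ (false ∷ B) (false ∷ S) s r e h = tilt≥ B S s r e h
  tilt≥ (true ∷ B) (true ∷ S) (suc s) r e (s≤s h) =
    ≤-trans (≤-reflexive (*-assoc x (x ^ s) (y ^ r))) (*-monoʳ-≤ x (tilt≥ B S s r (suc-injective e) h))
  tilt≥ (true ∷ B) (false ∷ S) s (suc r) e h = begin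
    x ^ s * (y * y ^ r)     ≡⟨ solve 3 (λ a y b → a :* (y :* b) := y :* (a :* b)) refl (x ^ s) y (y ^ r) ⟩
    y * (x ^ s * y ^ r)     ≤⟨ *-monoʳ-≤ y (tilt≥ B S s r (suc-injective (trans (sym (+-suc s r)) e)) h) ⟩
    y * tilt B S            ∎
    where open ≤-Reasoning
  tilt≥ (true ∷ B) (false ∷ S) (suc s) zero e h = begin
    x * x ^ s * 1           ≡⟨ *-assoc x (x ^ s) 1 ⟩
    x * (x ^ s * 1)         ≤⟨ *-mono-≤ x≤y (tilt≥ B S s zero (suc-injective e) (≤-trans (card-mono {S = S ∩ B} {T = B} (∩⊑ʳ S B)) (≤-reflexive (sym (trans (sym (+-identityʳ s)) (suc-injective e)))))) ⟩
    y * tilt B S            ∎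
    where open ≤-Reasoning

  -- Markov's inequality for `tilt`. The 20th power clears the denominators of 9/20 and 11/20;
  -- rounding `s` down only moves exponent from `x` to the larger `y`.
  low-tail : ∀ {n} (B : Subset n) → wsum 1 (λ S → 𝟙 (low B S)) ^ 20 * (x ^ 9 * y ^ 11) ^ card B ≤ (z ^ 20) ^ card B * (2 ^ n) ^ 20
  low-tail {n} B = begin
    c ^ 20 * (x ^ 9 * y ^ 11) ^ b         ≤⟨ *-monoʳ-≤ (c ^ 20) exponents ⟩
    c ^ 20 * (x ^ s * y ^ r) ^ 20         ≡⟨ sym (^-distrib-* c (x ^ s * y ^ r) 20) ⟩
    (c * (x ^ s * y ^ r)) ^ 20            ≤⟨ ^-monoˡ-≤ 20 first ⟩
    (z ^ b * 2 ^ n) ^ 20                  ≡⟨ ^-distrib-* (z ^ b) (2 ^ n) 20 ⟩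
    (z ^ b) ^ 20 * (2 ^ n) ^ 20           ≡⟨ cong (_* (2 ^ n) ^ 20) (trans (^-*-assoc z b 20) (trans (cong (z ^_) (*-comm b 20)) (sym (^-*-assoc z 20 b)))) ⟩
    (z ^ 20) ^ b * (2 ^ n) ^ 20           ∎
    where
    open ≤-Reasoning
    b = card B
    s = 9 * b / 20
    20s≤ : s * 20 ≤ 9 * b
    20s≤ = m/n*n≤m (9 * b) 20
    s≤b : s ≤ b
    s≤b = *-cancelʳ-≤ s b 20 (≤-trans 20s≤ (≤-trans (*-monoˡ-≤ b (≤ᵇ⇒≤ 9 20 tt)) (≤-reflexive (*-comm 20 b))))
    r = b ∸ s
    s+r : s + r ≡ b
    s+r = m+[n∸m]≡n s≤b
    c = wsum 1 (λ S → 𝟙 (low B S))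
    first : c * (x ^ s * y ^ r) ≤ z ^ b * 2 ^ n
    first = begin
      c * (x ^ s * y ^ r)                 ≡⟨ *-comm c _ ⟩
      (x ^ s * y ^ r) * c                 ≡⟨ sym (wsum-* 1 (x ^ s * y ^ r) (λ S → 𝟙 (low B S))) ⟩
      wsum 1 (λ S → (x ^ s * y ^ r) * 𝟙 (low B S)) ≤⟨ wsum-mono 1 (λ S → ≤-trans (≤-reflexive (*-comm (x ^ s * y ^ r) _))
                                              (𝟙-*-≤ (low B S) (λ e → tilt≥ B S s r s+r (does-true (card (S ∩ B) ≤? s) e)))) ⟩
      wsum 1 (tilt B)                     ≡⟨ tilt-weight B ⟩
      z ^ b * 2 ^ n                       ∎
    k = 9 * b ∸ s * 20
    k≡ : s * 20 + k ≡ 9 * b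
    k≡ = m+[n∸m]≡n 20s≤
    r≡ : r * 20 ≡ k + 11 * b
    r≡ = +-cancelˡ-≡ (s * 20) _ _ (≡-Reasoning.begin
      s * 20 + r * 20        ≡-Reasoning.≡⟨ trans (sym (*-distribʳ-+ 20 s r)) (cong (_* 20) s+r) ⟩
      b * 20                 ≡-Reasoning.≡⟨ solve 1 (λ b → b :* con 20 := con 9 :* b :+ con 11 :* b) refl b ⟩
      9 * b + 11 * b         ≡-Reasoning.≡⟨ cong (_+ 11 * b) (sym k≡) ⟩
      s * 20 + k + 11 * b    ≡-Reasoning.≡⟨ +-assoc (s * 20) k (11 * b) ⟩
      s * 20 + (k + 11 * b)  ≡-Reasoning.∎)
    exponents : (x ^ 9 * y ^ 11) ^ b ≤ (x ^ s * y ^ r) ^ 20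
    exponents = begin
      (x ^ 9 * y ^ 11) ^ b                ≡⟨ trans (^-distrib-* (x ^ 9) (y ^ 11) b) (cong₂ _*_ (^-*-assoc x 9 b) (^-*-assoc y 11 b)) ⟩
      x ^ (9 * b) * y ^ (11 * b)          ≡⟨ cong (λ e → x ^ e * y ^ (11 * b)) (sym k≡) ⟩
      x ^ (s * 20 + k) * y ^ (11 * b)     ≡⟨ cong (_* y ^ (11 * b)) (^-distribˡ-+-* x (s * 20) k) ⟩
      x ^ (s * 20) * x ^ k * y ^ (11 * b) ≤⟨ *-monoˡ-≤ (y ^ (11 * b)) (*-monoʳ-≤ (x ^ (s * 20)) (^-monoˡ-≤ k x≤y)) ⟩
      x ^ (s * 20) * y ^ k * y ^ (11 * b) ≡⟨ *-assoc (x ^ (s * 20)) (y ^ k) _ ⟩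
      x ^ (s * 20) * (y ^ k * y ^ (11 * b)) ≡⟨ cong (x ^ (s * 20) *_) (trans (sym (^-distribˡ-+-* y k (11 * b))) (cong (y ^_) (sym r≡))) ⟩
      x ^ (s * 20) * y ^ (r * 20)         ≡⟨ cong₂ _*_ (sym (^-*-assoc x s 20)) (sym (^-*-assoc y r 20)) ⟩
      (x ^ s) ^ 20 * (y ^ r) ^ 20         ≡⟨ sym (^-distrib-* (x ^ s) (y ^ r) 20) ⟩
      (x ^ s * y ^ r) ^ 20                ∎

-- The ratio of `t` to `P` is at most v / u, and eight factors v / u are worth 1/2. Undoing the 20th
-- power gives 160 = 8 · 20.
tail-compare : ∀ u v P t c q b k → 1 ≤ v → 1 ≤ P → v ≤ u → u * t ≤ v * P → v ^ 8 * 2 ≤ u ^ 8 → 160 * k ≤ b →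
  c ^ 20 * P ^ b ≤ t ^ b * q ^ 20 → 2 ^ k * c ≤ q
tail-compare u v P t c q b k 1≤v 1≤P v≤u ut≤vP 2v⁸≤u⁸ k≤ tail = ^-cancelˡ-≤ 19 (*-cancelʳ-≤ _ _ ((v * P) ^ b) {{m^n≢0 (v * P) b {{>-nonZero (*-mono-≤ 1≤v 1≤P)}}}} (begin
  (2 ^ k * c) ^ 20 * (v * P) ^ b             ≡⟨ cong₂ _*_ (trans (^-distrib-* (2 ^ k) c 20) (cong (_* c ^ 20) (^-*-assoc 2 k 20))) (^-distrib-* v P b) ⟩
  2 ^ (k * 20) * c ^ 20 * (v ^ b * P ^ b)    ≡⟨ solve 4 (λ a b c d → a :* b :* (c :* d) := c :* a :* (b :* d)) refl (2 ^ (k * 20)) (c ^ 20) (v ^ b) (P ^ b) ⟩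
  v ^ b * 2 ^ (k * 20) * (c ^ 20 * P ^ b)    ≤⟨ *-mono-≤ powers tail ⟩
  u ^ b * (t ^ b * q ^ 20)                   ≡⟨ trans (sym (*-assoc (u ^ b) (t ^ b) _)) (cong (_* q ^ 20) (sym (^-distrib-* u t b))) ⟩
  (u * t) ^ b * q ^ 20                       ≤⟨ *-monoˡ-≤ (q ^ 20) (^-monoˡ-≤ b ut≤vP) ⟩
  (v * P) ^ b * q ^ 20                       ≡⟨ *-comm ((v * P) ^ b) (q ^ 20) ⟩
  q ^ 20 * (v * P) ^ b                       ∎))
  where
  open ≤-Reasoning
  m = k * 20
  e = b ∸ 8 * m
  8m≤b : 8 * m ≤ b
  8m≤b = ≤-trans (≤-reflexive (solve 1 (λ k → con 8 :* (k :* con 20) := con 160 :* k) refl k)) k≤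
  powers : v ^ b * 2 ^ m ≤ u ^ b
  powers = subst (λ b → v ^ b * 2 ^ m ≤ u ^ b) (m+[n∸m]≡n 8m≤b) (begin
    v ^ (8 * m + e) * 2 ^ m        ≡⟨ cong (_* 2 ^ m) (trans (^-distribˡ-+-* v (8 * m) e) (cong (_* v ^ e) (sym (^-*-assoc v 8 m)))) ⟩
    (v ^ 8) ^ m * v ^ e * 2 ^ m    ≡⟨ solve 3 (λ a b c → a :* b :* c := a :* c :* b) refl ((v ^ 8) ^ m) (v ^ e) (2 ^ m) ⟩
    (v ^ 8) ^ m * 2 ^ m * v ^ e    ≡⟨ cong (_* v ^ e) (sym (^-distrib-* (v ^ 8) 2 m)) ⟩
    (v ^ 8 * 2) ^ m * v ^ e        ≤⟨ *-mono-≤ (^-monoˡ-≤ m 2v⁸≤u⁸) (^-monoˡ-≤ e v≤u) ⟩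
    (u ^ 8) ^ m * u ^ e            ≡⟨ trans (cong (_* u ^ e) (^-*-assoc u 8 m)) (sym (^-distribˡ-+-* u (8 * m) e)) ⟩
    u ^ (8 * m + e)                ∎)

-- The tilt 9 : 11 is the optimal one for the threshold 9/20. Numerically, 10^20 is at most 10/11 of
-- 9^9 · 11^11, and (10/11)^8 is below 1/2.
low-rare : ∀ {n} (B : Subset n) k → 160 * k ≤ card B → 2 ^ k * wsum 1 (λ S → 𝟙 (low B S)) ≤ 2 ^ n
low-rare {n} B k h = tail-compare 11 10 (9 ^ 9 * 11 ^ 11) (10 ^ 20) (wsum 1 (λ S → 𝟙 (low B S))) (2 ^ n) (card B) k
  (s≤s z≤n) (≤ᵇ⇒≤ _ _ tt) (≤ᵇ⇒≤ _ _ tt) (≤ᵇ⇒≤ _ _ tt) (≤ᵇ⇒≤ _ _ tt) h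
  (Tilted.low-tail 9 11 10 (≤ᵇ⇒≤ _ _ tt) refl B)

high-rare : ∀ {n} (B : Subset n) k → 160 * k ≤ card B → 2 ^ k * wsum 1 (λ S → 𝟙 (low B (∁ S))) ≤ 2 ^ n
high-rare B k h = ≤-trans (≤-reflexive (cong (2 ^ k *_) (wsum-∁ (λ S → 𝟙 (low B S))))) (low-rare B k h)

-- Choice of the parameters.

m<n*suc[m/n] : ∀ m n .{{_ : NonZero n}} → m < n * suc (m / n)
m<n*suc[m/n] m n = begin-strict
  m                    ≡⟨ m≡m%n+[m/n]*n m n ⟩
  m % n + m / n * n    <⟨ +-monoˡ-< (m / n * n) (m%n<n m n) ⟩
  n + m / n * n        ≡⟨ *-comm (suc (m / n)) n ⟩
  n * suc (m / n)      ∎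
  where open ≤-Reasoning

log-bracket : ∀ b n → 1 ≤ n → ∃ λ e → suc (suc b) ^ e ≤ n × n < suc (suc b) ^ suc e
log-bracket b n 1≤n = search n 0 1≤n (n<b^n n)
  where
  B = suc (suc b)
  n<b^n : ∀ n → n < B ^ n
  n<b^n zero    = s≤s z≤n
  n<b^n (suc n) = ≤-trans (s≤s (n<b^n n)) (≤-trans (+-monoˡ-≤ (B ^ n) (m^n>0 B n)) (+-monoʳ-≤ (B ^ n) (m≤m+n (B ^ n) _)))
  search : ∀ f e → B ^ e ≤ n → n < B ^ (e + f) → ∃ λ e → B ^ e ≤ n × n < B ^ suc e
  search zero e lo hi = ⊥-elim (<⇒≱ hi (subst (λ z → B ^ z ≤ n) (sym (+-identityʳ e)) lo))
  search (suc f) e lo hi with B ^ suc e ≤? n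
  ... | yes h = search f (suc e) h (subst (λ z → n < B ^ z) (+-suc e f) hi)
  ... | no h  = e , lo , ≰⇒> h

^-cancelʳ-< : ∀ b {m n} → suc b ^ m < suc b ^ n → m < n
^-cancelʳ-< b {m} {n} h with m <? n
... | yes m<n = m<n
... | no m≮n = ⊥-elim (<⇒≱ h (^-monoʳ-≤ (suc b) (≮⇒≥ m≮n)))

50k≤3^k : ∀ k → 50 * (6 + k) ≤ 3 ^ (6 + k)
50k≤3^k zero    = ≤ᵇ⇒≤ 300 729 tt
50k≤3^k (suc k) = begin
  50 * (6 + suc k)      ≡⟨ trans (cong (50 *_) (+-suc 6 k)) (*-suc 50 (6 + k)) ⟩
  50 + 50 * (6 + k)     ≤⟨ +-mono-≤ (≤-trans (m≤m*n 50 (6 + k)) (50k≤3^k k)) (50k≤3^k k) ⟩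
  X + X                 ≤⟨ +-monoʳ-≤ X (m≤m+n X (X + 0)) ⟩
  X + (X + (X + 0))     ≡⟨ cong (3 ^_) (sym (+-suc 6 k)) ⟩
  3 ^ (6 + suc k)       ∎
  where
  open ≤-Reasoning
  X = 3 ^ (6 + k)

record Scales (p ℓ k : ℕ) : Set where
  field
    t c Z D₀ f g m₁ m₂ J v w q : ℕ
    1≤p : 1 ≤ p
    1≤t : 1 ≤ t
    c≥ : 4 * (6 * 16) ≤ c
    4t≤Z : 4 * t ≤ Z
    2t≤D₀ : 2 * t ≤ D₀
    room : 4 * c * (D₀ * Z) ^ t ≤ p
    fuel : suc t * (p * (p * 2 ^ t) * Z ^ t) * suc (2 * t) ^ f < suc (suc (2 * t)) ^ f
    doublings : p * p ≤ 2 ^ g * (16 * (t * p))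
    m₁-bound : 3 * (t * p) < D₀ * suc m₁
    m₂-bound : g * f * (6 * c * (t * t * p)) < Z * suc m₂
    4m₂≤p : 4 * m₂ ≤ p
    J≡ : J ≡ v + w
    64t≤J : 64 * t ≤ J
    J≤p : J ≤ p
    2^w≤p : 2 ^ w ≤ p
    4J≤2^v : 4 * J ≤ 2 ^ v
    q≤ : q * 2 ^ (2 + v) ≤ p
    codes-small : 4 * (suc (g * f) * (suc (p * p) * (suc t * suc (p * p) ^ m₁)) ^ (g * f) * suc (p * p) ^ m₂) ≤ 2 ^ q
    lines≤2^g : suc p * p ≤ 2 ^ g
    N≤2^g : suc (p * p) ≤ 2 ^ g
    160[3+g]≤p : 160 * (3 + g) ≤ p
    g≡ : g ≡ 2 * suc ℓ
    threshold : g ≤ suc t * (100 * k)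

module Parameters (p ℓ k : ℕ) (20≤k : 20 ≤ k) (2^ℓ≤p : 2 ^ ℓ ≤ p) (p<2^ℓ+1 : p < 2 ^ suc ℓ) (3^k≤ℓ : 3 ^ k ≤ ℓ) (ℓ<B : ℓ < 3 ^ suc k) where

  open ≤-Reasoning

  -- ℓ < B ≤ 3 ℓ, so that B is log p up to a constant factor.
  B : ℕ
  B = 3 ^ suc k

  instance
    B≢0 : NonZero B
    B≢0 = m^n≢0 3 (suc k)
    k≢0 : NonZero k
    k≢0 = >-nonZero (≤-trans (s≤s z≤n) 20≤k)
    100k≢0 : NonZero (100 * k)
    100k≢0 = m*n≢0 100 k

  -- Rounded down: sets meeting every line in at most `t` points are excluded, so some block
  -- receives `t + 1` points, and that is at least the required quotient.
  t : ℕ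
  t = 2 * suc ℓ / (100 * k)

  2187≤B : 3 ^ 7 ≤ B
  2187≤B = ^-monoʳ-≤ 3 (≤-trans (≤ᵇ⇒≤ 7 21 tt) (s≤s 20≤k))

  small≤B : ∀ x → x ≤ 3 ^ 7 → x ≤ B
  small≤B x h = ≤-trans h 2187≤B

  50k≤ℓ : 50 * k ≤ ℓ
  50k≤ℓ = ≤-trans (subst (λ z → 50 * z ≤ 3 ^ z) (m+[n∸m]≡n (≤-trans (≤ᵇ⇒≤ 6 20 tt) 20≤k)) (50k≤3^k (k ∸ 6))) 3^k≤ℓ

  50kt≤ : 50 * (k * t) ≤ suc ℓ
  50kt≤ = *-cancelˡ-≤ 2 (begin
    2 * (50 * (k * t))      ≡⟨ solve 2 (λ k t → con 2 :* (con 50 :* (k :* t)) := t :* (con 100 :* k)) refl k t ⟩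
    t * (100 * k)           ≤⟨ m/n*n≤m (2 * suc ℓ) (100 * k) ⟩
    2 * suc ℓ               ∎)

  1≤t : 1 ≤ t
  1≤t = n≢0⇒n>0 λ t≡0 → <⇒≱ (m<n*suc[m/n] (2 * suc ℓ) (100 * k)) (begin
    100 * k * suc t         ≡⟨ cong (λ z → 100 * k * suc z) t≡0 ⟩
    100 * k * 1             ≡⟨ *-identityʳ (100 * k) ⟩
    100 * k                 ≡⟨ *-assoc 2 50 k ⟩
    2 * (50 * k)            ≤⟨ *-monoʳ-≤ 2 (m≤n⇒m≤1+n 50k≤ℓ) ⟩
    2 * suc ℓ               ∎)

  1000t≤ℓ : 50 * (20 * t) ≤ suc ℓ
  1000t≤ℓ = ≤-trans (*-monoʳ-≤ 50 (*-monoˡ-≤ t 20≤k)) 50kt≤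

  1000t≤B : 50 * (20 * t) ≤ B
  1000t≤B = ≤-trans 1000t≤ℓ ℓ<B

  xt≤B : ∀ x → x ≤ 1000 → x * t ≤ B
  xt≤B x h = ≤-trans (≤-trans (*-monoˡ-≤ t h) (≤-reflexive (*-assoc 50 20 t))) 1000t≤B

  t≤ℓ : t ≤ ℓ
  t≤ℓ = ≤-pred (≤-trans (+-mono-≤ 1≤t (≤-reflexive (sym (+-identityʳ t)))) (≤-trans (*-monoˡ-≤ t (≤ᵇ⇒≤ 2 1000 tt)) (≤-trans (≤-reflexive (*-assoc 50 20 t)) 1000t≤ℓ)))

  -- There are at most `B ^ 4` rounds. With `D₀ = B ^ 8` a sample has at most p / B^7 points, and
  -- with `Z = B ^ 10` at most p / B^3 points of `Q` are lost in all; coding both takes O(p / B²)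
  -- bits, less than `q`. The initial potential is below `2 ^ h`, and `2 * t + 2` rounds halve it,
  -- whence `f`.
  c Z D₀ h f g m₁ m₂ : ℕ
  c = B
  D₀ = B ^ 8
  Z = B ^ 10
  h = 5 * suc ℓ
  f = h * suc (suc (2 * t))
  g = 2 * suc ℓ
  m₁ = _/_ (3 * (t * p)) D₀ {{m^n≢0 B 8}}
  m₂ = _/_ (g * f * (6 * c * (t * t * p))) Z {{m^n≢0 B 10}}

  -- 2 (ℓ + 1) bounds log n and k bounds log log n.
  threshold : g ≤ suc t * (100 * k)
  threshold = ≤-trans (<⇒≤ (m<n*suc[m/n] (2 * suc ℓ) (100 * k))) (≤-reflexive (*-comm (100 * k) (suc t)))

  1≤p : 1 ≤ p
  1≤p = ≤-trans (m^n>0 2 ℓ) 2^ℓ≤p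

  c≥ : 4 * (6 * 16) ≤ c
  c≥ = small≤B (4 * (6 * 16)) (≤ᵇ⇒≤ _ _ tt)

  B≤B^ : ∀ n → B ≤ B ^ suc n
  B≤B^ n = ≤-trans (≤-reflexive (sym (*-identityʳ B))) (*-monoʳ-≤ B (m^n>0 B n))

  4t≤Z : 4 * t ≤ Z
  4t≤Z = ≤-trans (xt≤B 4 (≤ᵇ⇒≤ _ _ tt)) (B≤B^ 9)

  2t≤D₀ : 2 * t ≤ D₀
  2t≤D₀ = ≤-trans (xt≤B 2 (≤ᵇ⇒≤ _ _ tt)) (B≤B^ 7)

  B^≤2^ : ∀ n → B ^ n ≤ 2 ^ (2 * (suc k * n))
  B^≤2^ n = begin
    (3 ^ suc k) ^ n         ≡⟨ ^-*-assoc 3 (suc k) n ⟩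
    3 ^ (suc k * n)         ≤⟨ ^-monoˡ-≤ (suc k * n) (≤ᵇ⇒≤ 3 4 tt) ⟩
    4 ^ (suc k * n)         ≡⟨ ^-*-assoc 2 2 (suc k * n) ⟩
    2 ^ (2 * (suc k * n))   ∎

  50[k+1]≤ : 20 * suc k ≤ 21 * k
  50[k+1]≤ = ≤-trans (≤-reflexive (*-suc 20 k)) (+-monoˡ-≤ (20 * k) 20≤k)

  -- Here the 100 of the theorem is used: the main term is 36 k t, while `50 * (k * t) ≤ suc ℓ`. The
  -- slack, with `20 ≤ k`, absorbs the passage from `k` to `suc k` and the lower-order terms.
  exponent : 2 * (suc k * (2 + 18 * t)) ≤ ℓ
  exponent = *-cancelˡ-≤ 250 (begin
    250 * (2 * (suc k * (2 + 18 * t)))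
      ≡⟨ solve 2 (λ k t → con 250 :* (con 2 :* ((con 1 :+ k) :* (con 2 :+ con 18 :* t))) := con 50 :* (con 20 :* (con 1 :+ k)) :+ con 450 :* ((con 20 :* (con 1 :+ k)) :* t)) refl k t ⟩
    50 * (20 * suc k) + 450 * (20 * suc k * t)
      ≤⟨ +-mono-≤ (*-monoʳ-≤ 50 50[k+1]≤) (*-monoʳ-≤ 450 (*-monoˡ-≤ t 50[k+1]≤)) ⟩
    50 * (21 * k) + 450 * (21 * k * t)
      ≡⟨ solve 2 (λ k t → con 50 :* (con 21 :* k) :+ con 450 :* (con 21 :* k :* t) := con 21 :* (con 50 :* k) :+ con 189 :* (con 50 :* (k :* t))) refl k t ⟩
    21 * (50 * k) + 189 * (50 * (k * t))
      ≤⟨ +-mono-≤ (*-monoʳ-≤ 21 50k≤ℓ) (*-monoʳ-≤ 189 50kt≤) ⟩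
    21 * ℓ + 189 * suc ℓ
      ≡⟨ solve 1 (λ l → con 21 :* l :+ con 189 :* (con 1 :+ l) := con 189 :+ con 210 :* l) refl ℓ ⟩
    189 + 210 * ℓ
      ≤⟨ +-monoˡ-≤ (210 * ℓ) (≤-trans (≤ᵇ⇒≤ 189 1000 tt) (≤-trans (*-monoʳ-≤ 50 20≤k) (≤-trans 50k≤ℓ (m≤n*m ℓ 40)))) ⟩
    40 * ℓ + 210 * ℓ
      ≡⟨ solve 1 (λ l → con 40 :* l :+ con 210 :* l := con 250 :* l) refl ℓ ⟩
    250 * ℓ ∎)

  B^[2+18t]≤p : B ^ (2 + 18 * t) ≤ p
  B^[2+18t]≤p = ≤-trans (B^≤2^ (2 + 18 * t)) (≤-trans (^-monoʳ-≤ 2 exponent) 2^ℓ≤p)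

  D₀Z : (D₀ * Z) ^ t ≡ B ^ (18 * t)
  D₀Z = trans (cong (_^ t) (sym (^-distribˡ-+-* B 8 10))) (^-*-assoc B 18 t)

  room : 4 * c * (D₀ * Z) ^ t ≤ p
  room = begin
    4 * B * (D₀ * Z) ^ t    ≤⟨ *-mono-≤ (*-monoˡ-≤ B (small≤B 4 (≤ᵇ⇒≤ _ _ tt))) (≤-reflexive D₀Z) ⟩
    B * B * B ^ (18 * t)    ≡⟨ *-assoc B B (B ^ (18 * t)) ⟩
    B ^ (2 + 18 * t)        ≤⟨ B^[2+18t]≤p ⟩
    p                       ∎

  B^≤p : ∀ n → n ≤ 20 → B ^ n ≤ p
  B^≤p n n≤ = ≤-trans (^-monoʳ-≤ B (≤-trans n≤ (+-monoʳ-≤ 2 (*-monoʳ-≤ 18 1≤t)))) B^[2+18t]≤p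

  -- Five factors, `suc t`, `p`, `p`, `2 ^ t` and `Z ^ t`, each at most `2 ^ suc ℓ`; this is the 5
  -- in `h`.
  potential-bound : suc t * (p * (p * 2 ^ t) * Z ^ t) < 2 ^ h
  potential-bound = begin-strict
    suc t * (p * (p * 2 ^ t) * Z ^ t)
      ≤⟨ *-mono-≤ (n<2^n t) (*-mono-≤ (*-mono-≤ (<⇒≤ p<2^ℓ+1) (*-mono-≤ (<⇒≤ p<2^ℓ+1) (^-monoʳ-≤ 2 t≤ℓ))) Z^t≤p) ⟩
    2 ^ t * (P * (P * 2 ^ ℓ) * p)
      ≤⟨ *-monoˡ-≤ _ (^-monoʳ-≤ 2 t≤ℓ) ⟩
    2 ^ ℓ * (P * (P * 2 ^ ℓ) * p)
      <⟨ *-monoʳ-< (2 ^ ℓ) {{m^n≢0 2 ℓ}} (*-monoʳ-< (P * (P * 2 ^ ℓ)) {{m*n≢0 P (P * 2 ^ ℓ) {{m^n≢0 2 (suc ℓ)}} {{m*n≢0 P (2 ^ ℓ) {{m^n≢0 2 (suc ℓ)}} {{m^n≢0 2 ℓ}}}}}} p<2^ℓ+1) ⟩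
    2 ^ ℓ * (P * (P * 2 ^ ℓ) * P)
      ≤⟨ *-mono-≤ (^-monoʳ-≤ 2 (n≤1+n ℓ)) (*-monoˡ-≤ P (*-monoʳ-≤ P (*-monoʳ-≤ P (^-monoʳ-≤ 2 (n≤1+n ℓ))))) ⟩
    P * (P * (P * P) * P)
      ≡⟨ solve 1 (λ x → x :* (x :* (x :* x) :* x) := x :* (x :* (x :* (x :* (x :* con 1))))) refl P ⟩
    P ^ 5
      ≡⟨ trans (^-*-assoc 2 (suc ℓ) 5) (cong (2 ^_) (*-comm (suc ℓ) 5)) ⟩
    2 ^ h ∎
    where
    P = 2 ^ suc ℓ
    n<2^n : ∀ n → n < 2 ^ n
    n<2^n zero    = s≤s z≤n
    n<2^n (suc n) = ≤-trans (s≤s (n<2^n n)) (≤-trans (+-monoˡ-≤ (2 ^ n) (m^n>0 2 n)) (+-monoʳ-≤ (2 ^ n) (m≤m+n (2 ^ n) 0)))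
    Z^t≤p : Z ^ t ≤ p
    Z^t≤p = ≤-trans (≤-reflexive (^-*-assoc B 10 t)) (≤-trans (^-monoʳ-≤ B (≤-trans (*-monoˡ-≤ t (≤ᵇ⇒≤ 10 18 tt)) (m≤n+m (18 * t) 2))) B^[2+18t]≤p)

  fuel : suc t * (p * (p * 2 ^ t) * Z ^ t) * suc (2 * t) ^ f < suc (suc (2 * t)) ^ f
  fuel = begin-strict
    suc t * (p * (p * 2 ^ t) * Z ^ t) * e ^ f  <⟨ *-monoˡ-< (e ^ f) {{m^n≢0 e f}} potential-bound ⟩
    2 ^ h * e ^ f                              ≡⟨ *-comm (2 ^ h) (e ^ f) ⟩
    e ^ f * 2 ^ h                              ≤⟨ decay-power e h f ≤-refl ⟩
    suc e ^ f                                  ∎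
    where e = suc (2 * t)

  lines≤2^g : suc p * p ≤ 2 ^ g
  lines≤2^g = begin
    suc p * p               ≤⟨ *-mono-≤ p<2^ℓ+1 (<⇒≤ p<2^ℓ+1) ⟩
    2 ^ suc ℓ * 2 ^ suc ℓ   ≡⟨ sym (^-distribˡ-+-* 2 (suc ℓ) (suc ℓ)) ⟩
    2 ^ (suc ℓ + suc ℓ)     ≡⟨ cong (2 ^_) (cong (suc ℓ +_) (sym (+-identityʳ (suc ℓ)))) ⟩
    2 ^ g                   ∎

  N≤2^g : suc (p * p) ≤ 2 ^ g
  N≤2^g = ≤-trans (+-monoˡ-≤ (p * p) 1≤p) lines≤2^g

  doublings : p * p ≤ 2 ^ g * (16 * (t * p))
  doublings = ≤-trans (≤-trans (n≤1+n _) N≤2^g) (m≤m*n (2 ^ g) (16 * (t * p)) {{m*n≢0 16 (t * p) {{_}} {{m*n≢0 t p {{>-nonZero 1≤t}} {{>-nonZero 1≤p}}}}}})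

  m₁-bound : 3 * (t * p) < D₀ * suc m₁
  m₁-bound = m<n*suc[m/n] (3 * (t * p)) D₀ {{m^n≢0 B 8}}

  m₂-bound : g * f * (6 * c * (t * t * p)) < Z * suc m₂
  m₂-bound = m<n*suc[m/n] (g * f * (6 * c * (t * t * p))) Z {{m^n≢0 B 10}}

  2^v-bracket : ∃ λ v → 2 ^ v ≤ B × B < 2 ^ suc v
  2^v-bracket = log-bracket 0 B (m^n>0 3 (suc k))

  -- `2 ^ v` lies between `B` and `2 * B`, so that `q` is p / B up to a constant; it is still large
  -- enough for `4 * J ≤ 2 ^ v`, since `J` is at most a quarter of `B`.
  v w J q : ℕ
  v = suc (proj₁ 2^v-bracket)
  w = 64 * t
  J = v + w
  q = _/_ p (2 ^ (2 + v)) {{m^n≢0 2 (2 + v)}}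

  J≡ : J ≡ v + w
  J≡ = refl

  B≤2^v : B ≤ 2 ^ v
  B≤2^v = <⇒≤ (proj₂ (proj₂ 2^v-bracket))

  2^v≤2B : 2 ^ v ≤ 2 * B
  2^v≤2B = *-monoʳ-≤ 2 (proj₁ (proj₂ 2^v-bracket))

  m₁B⁷≤p : m₁ * B ^ 7 ≤ p
  m₁B⁷≤p = *-cancelʳ-≤ _ _ B (begin
    m₁ * B ^ 7 * B          ≡⟨ trans (*-assoc m₁ (B ^ 7) B) (cong (m₁ *_) (*-comm (B ^ 7) B)) ⟩
    m₁ * D₀                 ≤⟨ m/n*n≤m (3 * (t * p)) D₀ {{m^n≢0 B 8}} ⟩
    3 * (t * p)             ≡⟨ sym (*-assoc 3 t p) ⟩
    3 * t * p               ≤⟨ *-monoˡ-≤ p (xt≤B 3 (≤ᵇ⇒≤ _ _ tt)) ⟩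
    B * p                   ≡⟨ *-comm B p ⟩
    p * B                   ∎)

  2t+2≤B : suc (suc (2 * t)) ≤ B
  2t+2≤B = ≤-trans (+-monoˡ-≤ (2 * t) (≤-trans (*-monoʳ-≤ 2 1≤t) ≤-refl)) (≤-trans (≤-reflexive (solve 1 (λ t → con 2 :* t :+ con 2 :* t := con 4 :* t) refl t)) (xt≤B 4 (≤ᵇ⇒≤ _ _ tt)))

  gf≤B⁴ : (g * f) ≤ B ^ 4
  gf≤B⁴ = begin
    2 * suc ℓ * (5 * suc ℓ * suc (suc (2 * t)))  ≤⟨ *-mono-≤ (*-monoʳ-≤ 2 ℓ<B) (*-mono-≤ (*-monoʳ-≤ 5 ℓ<B) 2t+2≤B) ⟩
    2 * B * (5 * B * B)                          ≡⟨ solve 1 (λ b → con 2 :* b :* (con 5 :* b :* b) := con 10 :* (b :* (b :* (b :* con 1)))) refl B ⟩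
    10 * B ^ 3                                   ≤⟨ *-monoˡ-≤ (B ^ 3) (small≤B 10 (≤ᵇ⇒≤ _ _ tt)) ⟩
    B ^ 4                                        ∎

  m₂B³≤p : m₂ * B ^ 3 ≤ p
  m₂B³≤p = *-cancelʳ-≤ _ _ (B ^ 7) {{m^n≢0 B 7}} (begin
    m₂ * B ^ 3 * B ^ 7                ≡⟨ trans (*-assoc m₂ (B ^ 3) (B ^ 7)) (cong (m₂ *_) (sym (^-distribˡ-+-* B 3 7))) ⟩
    m₂ * Z                            ≤⟨ m/n*n≤m (g * f * (6 * c * (t * t * p))) Z {{m^n≢0 B 10}} ⟩
    g * f * (6 * B * (t * t * p))         ≤⟨ *-monoˡ-≤ (6 * B * (t * t * p)) gf≤B⁴ ⟩
    B ^ 4 * (6 * B * (t * t * p))     ≡⟨ solve 4 (λ r b t p → r :* (con 6 :* b :* (t :* t :* p)) := r :* (b :* ((con 6 :* t) :* t)) :* p) refl (B ^ 4) B t p ⟩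
    B ^ 4 * (B * (6 * t * t)) * p     ≤⟨ *-monoˡ-≤ p (*-monoʳ-≤ (B ^ 4) (*-monoʳ-≤ B (*-mono-≤ (xt≤B 6 (≤ᵇ⇒≤ _ _ tt)) (≤-trans (m≤n*m t 1) (xt≤B 1 (≤ᵇ⇒≤ _ _ tt)))))) ⟩
    B ^ 4 * (B * (B * B)) * p         ≡⟨ cong (_* p) (trans (cong (λ z → B ^ 4 * (B * (B * z))) (sym (*-identityʳ B))) (sym (^-distribˡ-+-* B 4 3))) ⟩
    B ^ 7 * p                         ≡⟨ *-comm (B ^ 7) p ⟩
    p * B ^ 7                         ∎)

  4m₂≤p : 4 * m₂ ≤ p
  4m₂≤p = ≤-trans (≤-trans (≤-reflexive (*-comm 4 m₂)) (*-monoʳ-≤ m₂ (≤-trans (small≤B 4 (≤ᵇ⇒≤ _ _ tt)) (B≤B^ 2)))) m₂B³≤p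

  v≤ : 16 * v ≤ B
  v≤ = ≤-trans (*-monoʳ-≤ 16 (≤-trans v≤2k+4 (m≤n*m _ 1))) (≤-trans bound (≤-trans 3^k≤ℓ (<⇒≤ ℓ<B)))
    where
    v≤2k+4 : v ≤ suc (2 * suc k)
    v≤2k+4 = ^-cancelʳ-< 1 (≤-<-trans (proj₁ (proj₂ 2^v-bracket)) B<)
      where
      B< : B < 2 ^ suc (2 * suc k)
      B< = ≤-<-trans (≤-trans (≤-reflexive (sym (*-identityʳ B))) (≤-trans (B^≤2^ 1) (≤-reflexive (cong (λ z → 2 ^ (2 * z)) (*-identityʳ (suc k))))))
             (^-monoʳ-< 2 (s≤s (s≤s z≤n)) (n<1+n (2 * suc k)))
    bound : 16 * (1 * suc (2 * suc k)) ≤ 3 ^ k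
    bound = begin
      16 * (1 * suc (2 * suc k))  ≡⟨ solve 1 (λ k → con 16 :* (con 1 :* (con 1 :+ con 2 :* (con 1 :+ k))) := con 48 :+ con 32 :* k) refl k ⟩
      48 + 32 * k                 ≤⟨ +-monoˡ-≤ (32 * k) (≤-trans (≤ᵇ⇒≤ 48 360 tt) (*-monoʳ-≤ 18 20≤k)) ⟩
      18 * k + 32 * k             ≡⟨ solve 1 (λ k → con 18 :* k :+ con 32 :* k := con 50 :* k) refl k ⟩
      50 * k                      ≤⟨ subst (λ z → 50 * z ≤ 3 ^ z) (m+[n∸m]≡n (≤-trans (≤ᵇ⇒≤ 6 20 tt) 20≤k)) (50k≤3^k (k ∸ 6)) ⟩
      3 ^ k                       ∎

  4J≤B : 4 * J ≤ B
  4J≤B = *-cancelˡ-≤ 4 (begin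
    4 * (4 * (v + 64 * t))        ≡⟨ solve 2 (λ v t → con 4 :* (con 4 :* (v :+ con 64 :* t)) := con 16 :* v :+ con 2 :* (con 512 :* t)) refl v t ⟩
    16 * v + 2 * (512 * t)        ≤⟨ +-mono-≤ v≤ (*-monoʳ-≤ 2 (xt≤B 512 (≤ᵇ⇒≤ _ _ tt))) ⟩
    B + 2 * B                     ≤⟨ *-monoˡ-≤ B (≤ᵇ⇒≤ 3 4 tt) ⟩
    4 * B                         ∎)

  64t≤J : 64 * t ≤ J
  64t≤J = m≤n+m (64 * t) v

  4J≤2^v : 4 * J ≤ 2 ^ v
  4J≤2^v = ≤-trans 4J≤B B≤2^v

  J≤p : J ≤ p
  J≤p = ≤-trans (m≤n*m J 4) (≤-trans 4J≤B (≤-trans (≤-reflexive (sym (*-identityʳ B))) (B^≤p 1 (≤ᵇ⇒≤ 1 20 tt))))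

  2^w≤p : 2 ^ w ≤ p
  2^w≤p = ≤-trans (^-monoʳ-≤ 2 64t≤ℓ) 2^ℓ≤p
    where
    64t≤ℓ : 64 * t ≤ ℓ
    64t≤ℓ = ≤-pred (≤-trans (+-monoˡ-≤ (64 * t) 1≤t) (≤-trans (*-monoˡ-≤ t (≤ᵇ⇒≤ 65 1000 tt)) (≤-trans (≤-reflexive (*-assoc 50 20 t)) 1000t≤ℓ)))

  q≤ : q * 2 ^ (2 + v) ≤ p
  q≤ = m/n*n≤m p (2 ^ (2 + v)) {{m^n≢0 2 (2 + v)}}

  -- Length over an alphabet of `suc (p * p)` letters: one letter for the number of rounds, `2 + m₁`
  -- for each round (threshold, level, sample) and `m₂` for E.
  code-length : ℕ
  code-length = 1 + (g * f * (2 + m₁) + m₂)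

  bits≤q : g * code-length + 2 ≤ q
  bits≤q = ≤-pred (*-cancelˡ-< (2 ^ (2 + v)) _ _ (≤-<-trans (begin
    2 ^ (2 + v) * (g * code-length + 2)
      ≤⟨ *-mono-≤ (≤-trans (≤-reflexive (^-distribˡ-+-* 2 2 v)) (*-monoʳ-≤ 4 2^v≤2B)) (+-monoˡ-≤ 2 (*-mono-≤ (*-monoʳ-≤ 2 ℓ<B) (+-monoʳ-≤ 1 (+-monoˡ-≤ m₂ (*-monoˡ-≤ (2 + m₁) gf≤B⁴))))) ⟩
    4 * (2 * B) * (2 * B * (1 + (B ^ 4 * (2 + m₁) + m₂)) + 2)
      ≡⟨ solve 4 (λ b r x y → con 4 :* (con 2 :* b) :* (con 2 :* b :* (con 1 :+ (r :* (con 2 :+ x) :+ y)) :+ con 2)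
           := con 16 :* (x :* (b :* (b :* r)) :+ y :* (b :* b)) :+ con 16 :* (b :* b :+ con 2 :* (b :* (b :* r)) :+ b)) refl B (B ^ 4) m₁ m₂ ⟩
    16 * (m₁ * B ^ 6 + m₂ * (B * B)) + 16 * (B * B + 2 * B ^ 6 + B)
      ≤⟨ *-cancelˡ-≤ B final ⟩
    p ∎) (m<n*suc[m/n] p (2 ^ (2 + v)) {{m^n≢0 2 (2 + v)}})))
    where
    B≤B⁶ = B≤B^ 5
    B²≤B⁶ : B * B ≤ B ^ 6
    B²≤B⁶ = *-monoʳ-≤ B (B≤B^ 4)
    -- After multiplication by `B` every term is a constant times `p`; the constants add up to 96,
    -- which is below `B`.
    final : B * (16 * (m₁ * B ^ 6 + m₂ * (B * B)) + 16 * (B * B + 2 * B ^ 6 + B)) ≤ B * p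
    final = begin
      B * (16 * (m₁ * B ^ 6 + m₂ * (B * B)) + 16 * (B * B + 2 * B ^ 6 + B))
        ≤⟨ *-monoʳ-≤ B (+-monoʳ-≤ (16 * (m₁ * B ^ 6 + m₂ * (B * B))) (*-monoʳ-≤ 16 (+-mono-≤ (+-monoˡ-≤ (2 * B ^ 6) B²≤B⁶) B≤B⁶))) ⟩
      B * (16 * (m₁ * B ^ 6 + m₂ * (B * B)) + 16 * (B ^ 6 + 2 * B ^ 6 + B ^ 6))
        ≡⟨ solve 4 (λ b s x y → b :* (con 16 :* (x :* s :+ y :* (b :* b)) :+ con 16 :* (s :+ con 2 :* s :+ s))
             := con 16 :* (x :* (b :* s)) :+ con 16 :* (y :* (b :* (b :* (b :* con 1)))) :+ con 64 :* (b :* s)) refl B (B ^ 6) m₁ m₂ ⟩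
      16 * (m₁ * B ^ 7) + 16 * (m₂ * B ^ 3) + 64 * B ^ 7
        ≤⟨ +-mono-≤ (+-mono-≤ (*-monoʳ-≤ 16 m₁B⁷≤p) (*-monoʳ-≤ 16 m₂B³≤p)) (*-monoʳ-≤ 64 (B^≤p 7 (≤ᵇ⇒≤ 7 20 tt))) ⟩
      16 * p + 16 * p + 64 * p
        ≡⟨ solve 1 (λ p → con 16 :* p :+ con 16 :* p :+ con 64 :* p := con 96 :* p) refl p ⟩
      96 * p
        ≤⟨ *-monoˡ-≤ p (small≤B 96 (≤ᵇ⇒≤ _ _ tt)) ⟩
      B * p ∎

  codes-small : 4 * (suc (g * f) * (suc (p * p) * (suc t * suc (p * p) ^ m₁)) ^ (g * f) * suc (p * p) ^ m₂) ≤ 2 ^ q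
  codes-small = begin
    4 * (suc (g * f) * (M * (suc t * M ^ m₁)) ^ (g * f) * M ^ m₂)
      ≤⟨ *-monoʳ-≤ 4 (*-monoˡ-≤ (M ^ m₂) (*-mono-≤ gf≤M (^-monoˡ-≤ (g * f) (*-monoʳ-≤ M (*-monoˡ-≤ (M ^ m₁) t≤M))))) ⟩
    4 * (M * (M ^ (2 + m₁)) ^ (g * f) * M ^ m₂)
      ≡⟨ cong (4 *_) (trans (cong (λ z → M * z * M ^ m₂) (trans (^-*-assoc M (2 + m₁) (g * f)) (cong (M ^_) (*-comm (2 + m₁) (g * f)))))
           (trans (*-assoc M (M ^ (g * f * (2 + m₁))) (M ^ m₂)) (cong (M *_) (sym (^-distribˡ-+-* M (g * f * (2 + m₁)) m₂))))) ⟩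
    4 * M ^ code-length
      ≤⟨ *-monoʳ-≤ 4 (^-monoˡ-≤ code-length N≤2^g) ⟩
    4 * (2 ^ g) ^ code-length
      ≡⟨ trans (cong (4 *_) (^-*-assoc 2 g code-length)) (trans (*-comm 4 (2 ^ (g * code-length))) (sym (^-distribˡ-+-* 2 (g * code-length) 2))) ⟩
    2 ^ (g * code-length + 2)
      ≤⟨ ^-monoʳ-≤ 2 bits≤q ⟩
    2 ^ q ∎
    where
    M = suc (p * p)
    p≤M : p ≤ p * p
    p≤M = m≤m*n p p {{>-nonZero 1≤p}}
    gf≤M : suc (g * f) ≤ M
    gf≤M = s≤s (≤-trans gf≤B⁴ (≤-trans (B^≤p 4 (≤ᵇ⇒≤ 4 20 tt)) p≤M))
    t≤M : suc t ≤ M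
    t≤M = s≤s (≤-trans (≤-trans (m≤n*m t 1) (xt≤B 1 (≤ᵇ⇒≤ _ _ tt))) (≤-trans (≤-reflexive (sym (*-identityʳ B))) (≤-trans (B^≤p 1 (≤ᵇ⇒≤ 1 20 tt)) p≤M)))

  160[3+g]≤p : 160 * (3 + g) ≤ p
  160[3+g]≤p = begin
    160 * (3 + 2 * suc ℓ)          ≤⟨ *-monoʳ-≤ 160 (+-mono-≤ (small≤B 3 (≤ᵇ⇒≤ _ _ tt)) (*-monoʳ-≤ 2 ℓ<B)) ⟩
    160 * (B + 2 * B)              ≡⟨ solve 1 (λ b → con 160 :* (b :+ con 2 :* b) := con 480 :* b) refl B ⟩
    480 * B                        ≤⟨ *-monoˡ-≤ B (small≤B 480 (≤ᵇ⇒≤ _ _ tt)) ⟩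
    B * B                          ≡⟨ cong (B *_) (sym (*-identityʳ B)) ⟩
    B ^ 2                          ≤⟨ B^≤p 2 (≤ᵇ⇒≤ 2 20 tt) ⟩
    p                              ∎

  scales : Scales p ℓ k
  scales = record
    { t = t ; c = c ; Z = Z ; D₀ = D₀ ; f = f ; g = g
    ; m₁ = m₁ ; m₂ = m₂ ; J = J ; v = v ; w = w ; q = q
    ; 1≤p = 1≤p ; 1≤t = 1≤t ; c≥ = c≥ ; 4t≤Z = 4t≤Z ; 2t≤D₀ = 2t≤D₀ ; room = room
    ; fuel = fuel ; doublings = doublings ; m₁-bound = m₁-bound ; m₂-bound = m₂-bound ; 4m₂≤p = 4m₂≤p ; J≡ = J≡
    ; 64t≤J = 64t≤J ; J≤p = J≤p ; 2^w≤p = 2^w≤p ; 4J≤2^v = 4J≤2^v ; q≤ = q≤ ; codes-small = codes-small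
    ; lines≤2^g = lines≤2^g ; N≤2^g = N≤2^g ; 160[3+g]≤p = 160[3+g]≤p
    ; g≡ = refl ; threshold = threshold
    }

open import Data.Integer as ℤ using (ℤ; +_; -[1+_])
open import Data.Integer.Divisibility.Signed as ℤ∣ using (divides; ∣ᵤ⇒∣; ∣⇒∣ᵤ) renaming (_∣_ to _∣ᶻ_)
import Data.Integer.Properties as ℤ
import Data.Rational as ℚ

-- When the totals agree there is no room for a strict inequality in any term. In the plane this
-- upgrades easy upper bounds to equalities.
∑-rigid : ∀ {n} {f g : Fin n → ℕ} → (∀ i → f i ≤ g i) → sum g ≤ sum f → ∀ i → g i ≤ f i
∑-rigid {suc n} {f} {g} h s zero    = +-cancelʳ-≤ (sum (f ∘ suc)) _ _ (≤-trans (+-monoʳ-≤ (g zero) (∑-mono (h ∘ suc))) s)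
∑-rigid {suc n} {f} {g} h s (suc i) = ∑-rigid {f = f ∘ suc} {g ∘ suc} (h ∘ suc)
  (+-cancelˡ-≤ (f zero) _ _ (≤-trans (+-monoˡ-≤ (sum (g ∘ suc)) (h zero)) s)) i

∑-+ : ∀ m {n} (f : Fin (m + n) → ℕ) → sum f ≡ sum (λ i → f (i ↑ˡ n)) + sum (λ j → f (m ↑ʳ j))
∑-+ zero    f = refl
∑-+ (suc m) f = trans (cong (λ z → f zero + z) (∑-+ m (f ∘ suc))) (sym (+-assoc (f zero) _ _))

∑-* : ∀ m {n} (f : Fin (m * n) → ℕ) → sum f ≡ sum (λ i → sum (λ j → f (combine {m} {n} i j)))
∑-* zero    f = refl
∑-* (suc m) {n} f = trans (∑-+ n f) (cong (λ z → sum (λ j → f (j ↑ˡ (m * n))) + z) (∑-* m (λ k → f (n ↑ʳ k))))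

-- The affine plane over Z/p

module AffinePlane (p : ℕ) (prime : Prime p) where

  instance
    p≢0 : NonZero p
    p≢0 = prime⇒nonZero prime

  N : ℕ
  N = p * p

  absc ordi : Fin N → Fin p
  absc i = proj₁ (remQuot {p} p i)
  ordi i = proj₂ (remQuot {p} p i)

  -- Class 0 consists of the vertical lines, class a + 1 of the lines y + a x = b.
  ln : Fin (suc p) → Fin N → Fin p
  ln zero    i = absc i
  ln (suc a) i = (toℕ (ordi i) + toℕ a * toℕ (absc i)) mod p

  point-≡ : ∀ {i j} → absc i ≡ absc j → ordi i ≡ ordi j → i ≡ j
  point-≡ {i} {j} e e′ = trans (sym (combine-remQuot {p} p i)) (trans (cong₂ combine e e′) (combine-remQuot {p} p j))

  _≋_ : ℕ → ℕ → Set
  m ≋ n = + p ∣ᶻ + m ℤ.- + n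

  mod-≡ : ∀ {m n} → m mod p ≡ n mod p → m % p ≡ n % p
  mod-≡ {m} {n} e = trans (sym (toℕ-mod m)) (trans (cong toℕ e) (toℕ-mod n))
    where
    open import Data.Fin.Properties using (toℕ-fromℕ<)
    toℕ-mod : ∀ m → toℕ (m mod p) ≡ m % p
    toℕ-mod m = toℕ-fromℕ< (m%n<n m p)

  ≡⇒≋ : ∀ {m n} → m mod p ≡ n mod p → m ≋ n
  ≡⇒≋ {m} {n} e = divides (+ (m / p) ℤ.- + (n / p)) (begin
    + m ℤ.- + n
      ≡⟨ cong₂ ℤ._-_ (expand m) (expand n) ⟩
    (+ (m % p) ℤ.+ + (m / p) ℤ.* + p) ℤ.- (+ (n % p) ℤ.+ + (n / p) ℤ.* + p)
      ≡⟨ cong (λ r → (+ r ℤ.+ + (m / p) ℤ.* + p) ℤ.- (+ (n % p) ℤ.+ + (n / p) ℤ.* + p)) (mod-≡ e) ⟩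
    (+ (n % p) ℤ.+ + (m / p) ℤ.* + p) ℤ.- (+ (n % p) ℤ.+ + (n / p) ℤ.* + p)
      ≡⟨ cancel-remainder (+ (n % p)) (+ (m / p)) (+ (n / p)) (+ p) ⟩
    (+ (m / p) ℤ.- + (n / p)) ℤ.* + p ∎)
    where
    open ≡-Reasoning
    expand : ∀ m → + m ≡ + (m % p) ℤ.+ + (m / p) ℤ.* + p
    expand m = trans (cong +_ (m≡m%n+[m/n]*n m p)) (trans (ℤ.pos-+ (m % p) (m / p * p)) (cong (λ z → + (m % p) ℤ.+ z) (ℤ.pos-* (m / p) p)))

  small-≋ : ∀ (x y : Fin p) → toℕ x ≋ toℕ y → x ≡ y
  small-≋ x y h = toℕ-injective (close ℤ.∣ pos-x ℤ.- pos-y ∣ refl (∣⇒∣ᵤ h))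
    where
    m = toℕ x
    n = toℕ y
    pos-x = + m
    pos-y = + n
    close : ∀ k → ℤ.∣ pos-x ℤ.- pos-y ∣ ≡ k → p ∣ k → m ≡ n
    close zero    e d = ℤ.+-injective (ℤ.i-j≡0⇒i≡j pos-x pos-y (ℤ.∣i∣≡0⇒i≡0 e))
    close (suc k) e d = ⊥-elim (<⇒≱ (≤-<-trans (≤-reflexive (trans (sym e) (cong ℤ.∣_∣ (ℤ.m-n≡m⊖n m n))))
      (≤-<-trans (ℤ.∣m⊝n∣≤m⊔n m n) (⊔-lub (toℕ<n x) (toℕ<n y)))) (∣⇒≤ d))

  vertical-meet : ∀ {x y} a → absc x ≡ absc y → ln (suc a) x ≡ ln (suc a) y → x ≡ y
  vertical-meet {x} {y} a e h = point-≡ e (small-≋ (ordi x) (ordi y) (subst (+ p ∣ᶻ_) same (≡⇒≋ {toℕ (ordi x) + toℕ a * toℕ (absc x)} {toℕ (ordi y) + toℕ a * toℕ (absc y)} h)))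
    where
    same : + (toℕ (ordi x) + toℕ a * toℕ (absc x)) ℤ.- + (toℕ (ordi y) + toℕ a * toℕ (absc y)) ≡ + toℕ (ordi x) ℤ.- + toℕ (ordi y)
    same = trans (cong (λ z → + (toℕ (ordi x) + toℕ a * toℕ z) ℤ.- + (toℕ (ordi y) + toℕ a * toℕ (absc y))) e)
      (trans (cong₂ ℤ._-_ (ℤ.pos-+ (toℕ (ordi x)) c) (ℤ.pos-+ (toℕ (ordi y)) c))
        (cancel-common (+ toℕ (ordi x)) (+ toℕ (ordi y)) (+ c)))
      where c = toℕ a * toℕ (absc y)

  -- Subtracting the two congruences shows that `p` divides (a - a′)(x₁ - y₁). So the slopes agree
  -- or the points share a column, and two points of one column on a common oblique line coincide.
  meet : ∀ {a a′ x y} → x ≢ y → ln a x ≡ ln a y → ln a′ x ≡ ln a′ y → a ≡ a′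
  meet {zero}  {zero}   ne _ _ = refl
  meet {zero}  {suc a′} ne h h′ = ⊥-elim (ne (vertical-meet a′ h h′))
  meet {suc a} {zero}   ne h h′ = ⊥-elim (ne (vertical-meet a h′ h))
  meet {suc a} {suc a′} {x} {y} ne h h′ = choose
    (euclidsLemma ℤ.∣ α ℤ.- α′ ∣ ℤ.∣ + x₁ ℤ.- + y₁ ∣ prime (subst (p ∣_) (ℤ.abs-* (α ℤ.- α′) (+ x₁ ℤ.- + y₁)) (∣⇒∣ᵤ product)))
    where
    α = + toℕ a
    α′ = + toℕ a′
    x₁ = toℕ (absc x)
    y₁ = toℕ (absc y)
    x₂ = toℕ (ordi x)
    y₂ = toℕ (ordi y)
    lin : ∀ u k v → + (u + k * v) ≡ + u ℤ.+ + k ℤ.* + v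
    lin u k v = trans (ℤ.pos-+ u (k * v)) (cong (λ z → + u ℤ.+ z) (ℤ.pos-* k v))
    product : + p ∣ᶻ (α ℤ.- α′) ℤ.* (+ x₁ ℤ.- + y₁)
    product = subst (+ p ∣ᶻ_)
      (trans (cong₂ ℤ._-_ (cong₂ ℤ._-_ (lin x₂ (toℕ a) x₁) (lin y₂ (toℕ a) y₁)) (cong₂ ℤ._-_ (lin x₂ (toℕ a′) x₁) (lin y₂ (toℕ a′) y₁)))
        (slope-difference (+ x₁) (+ x₂) (+ y₁) (+ y₂) α α′))
      (ℤ∣.∣m∣n⇒∣m-n (≡⇒≋ {x₂ + toℕ a * x₁} {y₂ + toℕ a * y₁} h) (≡⇒≋ {x₂ + toℕ a′ * x₁} {y₂ + toℕ a′ * y₁} h′))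
    choose : p ∣ ℤ.∣ α ℤ.- α′ ∣ ⊎ p ∣ ℤ.∣ + x₁ ℤ.- + y₁ ∣ → suc a ≡ suc a′
    choose (inj₁ d) = cong suc (small-≋ a a′ (∣ᵤ⇒∣ d))
    choose (inj₂ d) = ⊥-elim (ne (vertical-meet {x} {y} a (small-≋ (absc x) (absc y) (∣ᵤ⇒∣ d)) h))

  class-column : ∀ a b (x : Fin p) → sum (λ y → 𝟙 (ln (suc a) (combine {p} {p} x y) == b)) ≤ 1
  class-column a b x = ∑-unique≤1 (λ y → ln (suc a) (combine {p} {p} x y) == b) λ {y} {y′} h h′ →
    trans (sym (ordi-combine y)) (trans (cong ordi (vertical-meet a (trans (absc-combine y) (sym (absc-combine y′)))
      (trans (does-true (ln (suc a) (combine {p} {p} x y) ≟ᶠ b) h) (sym (does-true (ln (suc a) (combine {p} {p} x y′) ≟ᶠ b) h′))))) (ordi-combine y′))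
    where
    absc-combine : ∀ y → absc (combine {p} {p} x y) ≡ x
    absc-combine y = cong proj₁ (remQuot-combine {p} {p} x y)
    ordi-combine : ∀ y → ordi (combine {p} {p} x y) ≡ y
    ordi-combine y = cong proj₂ (remQuot-combine {p} {p} x y)

  line-size≤ : ∀ a b → sum (λ x → 𝟙 (ln a x == b)) ≤ p
  line-size≤ zero b = ≤-reflexive (begin
    sum (λ i → 𝟙 (absc i == b))                         ≡⟨ ∑-* p (λ i → 𝟙 (absc i == b)) ⟩
    sum (λ x → sum (λ y → 𝟙 (absc (combine {p} {p} x y) == b))) ≡⟨ sum-cong-≗ (λ x → sum-cong-≗ (λ y → cong (λ z → 𝟙 (z == b)) (cong proj₁ (remQuot-combine {p} {p} x y)))) ⟩
    sum {p} (λ x → sum {p} (λ _ → 𝟙 (x == b)))    ≡⟨ sum-cong-≗ (λ x → trans (∑-const p (𝟙 (x == b))) (trans (*-comm p _) (cong (λ z → 𝟙 z * p) (==-sym x b)))) ⟩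
    sum (λ x → 𝟙 (b == x) * p)                          ≡⟨ ∑-pick b (λ _ → p) ⟩
    p                                                   ∎)
    where
    open ≡-Reasoning
    ==-sym : ∀ (x y : Fin p) → (x == y) ≡ (y == x)
    ==-sym x y with x ≟ᶠ y | y ≟ᶠ x
    ... | yes _ | yes _ = refl
    ... | no _  | no _  = refl
    ... | yes e | no n  = ⊥-elim (n (sym e))
    ... | no n  | yes e = ⊥-elim (n (sym e))
  line-size≤ (suc a) b = ≤-trans (≤-reflexive (∑-* p (λ i → 𝟙 (ln (suc a) i == b))))
    (≤-trans (∑-bound (class-column a b)) (≤-reflexive (*-identityʳ p)))

  class-size : ∀ a → sum (λ b → sum (λ x → 𝟙 (ln a x == b))) ≡ N
  class-size a = begin
    sum (λ b → sum (λ x → 𝟙 (ln a x == b)))     ≡⟨ ∑-comm (λ b x → 𝟙 (ln a x == b)) ⟩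
    sum (λ x → sum (λ b → 𝟙 (ln a x == b)))     ≡⟨ sum-cong-≗ (λ x → trans (sum-cong-≗ (λ b → sym (*-identityʳ (𝟙 (ln a x == b))))) (∑-pick (ln a x) (λ _ → 1))) ⟩
    sum {N} (λ _ → 1)                           ≡⟨ trans (∑-const N 1) (*-identityʳ N) ⟩
    N                                           ∎
    where open ≡-Reasoning

  -- The `p` lines of a class have at most `p` points each but p² together. Thus no congruence has
  -- to be solved to exhibit the points of an oblique line.
  line-size : ∀ a b → sum (λ x → 𝟙 (ln a x == b)) ≡ p
  line-size a b = ≤-antisym (line-size≤ a b) (∑-rigid (line-size≤ a) (≤-reflexive (trans (∑-const p p) (sym (class-size a)))) b)

  -- Counting the points collinear with x in two ways: no two points can fail to be joined.
  join : ∀ {x y} → x ≢ y → ∃ λ a → ln a x ≡ ln a y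
  join {x} {y} ne = find (any-witness (λ a → ln a y == ln a x) positive)
    where
    joins : Fin N → ℕ
    joins z = sum (λ a → 𝟙 (ln a z == ln a x))
    joins≤ : ∀ z → joins z ≤ 𝟙 (x == z) * p + 1
    joins≤ z with x ≟ᶠ z
    ... | yes refl = ≤-trans (∑-bound {suc p} {c = 1} (λ a → 𝟙≤1 (ln a x == ln a x)))
                       (≤-reflexive (trans (*-identityʳ (suc p)) (trans (+-comm 1 p) (cong (λ z → z + 1) (sym (+-identityʳ p))))))
    ... | no x≢z = ∑-unique≤1 (λ a → ln a z == ln a x) (λ {a} {a′} e e′ → meet (λ q → x≢z (sym q))
                     (does-true (ln a z ≟ᶠ ln a x) e) (does-true (ln a′ z ≟ᶠ ln a′ x) e′))
    total : sum (λ z → 𝟙 (x == z) * p + 1) ≡ sum joins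
    total = begin
      sum (λ z → 𝟙 (x == z) * p + 1)            ≡⟨ ∑-distrib-+ (λ z → 𝟙 (x == z) * p) (λ _ → 1) ⟩
      sum (λ z → 𝟙 (x == z) * p) + sum {N} (λ _ → 1) ≡⟨ cong₂ _+_ (∑-pick x (λ _ → p)) (trans (∑-const N 1) (*-identityʳ N)) ⟩
      p + N                                     ≡⟨ sym (∑-const (suc p) p) ⟩
      sum {suc p} (λ _ → p)                     ≡⟨ sum-cong-≗ (λ a → sym (line-size a (ln a x))) ⟩
      sum (λ a → sum (λ z → 𝟙 (ln a z == ln a x))) ≡⟨ ∑-comm (λ a z → 𝟙 (ln a z == ln a x)) ⟩
      sum joins                                 ∎
      where open ≡-Reasoning
    positive : any (λ a → ln a y == ln a x) ≡ true
    positive with bool-case (any (λ a → ln a y == ln a x))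
    ... | inj₁ e = e
    ... | inj₂ e = ⊥-elim (<⇒≱ (≤-trans (m≤n+m 1 (𝟙 (x == y) * p)) (∑-rigid joins≤ (≤-reflexive total) y))
                     (≤-reflexive (∑-zero {suc p} {λ a → 𝟙 (ln a y == ln a x)} (λ a → cong 𝟙 (off a)))))
      where
      off : ∀ a → (ln a y == ln a x) ≡ false
      off a with bool-case (ln a y == ln a x)
      ... | inj₂ e′ = e′
      ... | inj₁ e′ = ⊥-elim (true≢false (any-true (λ a → ln a y == ln a x) a e′) e)
    find : (∃ λ a → (ln a y == ln a x) ≡ true) → ∃ λ a → ln a x ≡ ln a y
    find (a , e) = a , sym (does-true (ln a y ≟ᶠ ln a x) e)

open import Data.Fin.Subset using (∣_∣)
open import Defs using (BlockDesign; Transversal; fromℕ; √_; _·_; _<ℝ_; _≥ℝ_; ln/100lnln)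

-- Large primes and relabelling of a point set.

prime-above : ∀ m → ∃ λ p → m < p × Prime p
-- Euclid: a prime factor of `m ! + 1` cannot divide `m !`.
prime-above m = extract (factorise (suc (m !)))
  where
  extract : PrimeFactorisation (suc (m !)) → ∃ λ p → m < p × Prime p
  extract record { factors = [] ; isFactorisation = e } = ⊥-elim (<⇒≢ (n≢0⇒n>0 (≢-nonZero⁻¹ (m !) {{m !≢0}})) (sym (suc-injective e)))
  extract record { factors = p ∷ ps ; isFactorisation = e ; factorsPrime = isPrime ∷ _ } = p , ≰⇒> p≰m , isPrime
    where
    p≰m : p ≰ m
    p≰m p≤m = nonTrivial⇒≢1 {{prime⇒nonTrivial isPrime}} (∣1⇒≡1 (∣m+n∣m⇒∣n
      (subst (p ∣_) (trans (sym e) (+-comm 1 (m !))) (m∣m*n _))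
      (∣-trans (p∣p! p {{prime⇒nonZero isPrime}}) (m≤n⇒m!∣n! p≤m))))
      where
      p∣p! : ∀ p .{{_ : NonZero p}} → p ∣ p !
      p∣p! (suc p) = m∣m*n (p !)

-- Together with `restrict` and `extend` this identifies the points of `S` with `Fin (card S)`, the
-- form in which a block design needs them.
embed : ∀ {n} (S : Subset n) → Fin (card S) → Fin n
embed (true ∷ S)  zero    = zero
embed (true ∷ S)  (suc i) = suc (embed S i)
embed (false ∷ S) i       = suc (embed S i)

restrict : ∀ {n} (S B : Subset n) → Subset (card S)
restrict []          []      = []
restrict (true ∷ S)  (b ∷ B) = b ∷ restrict S B
restrict (false ∷ S) (b ∷ B) = restrict S B

extend : ∀ {n} (S : Subset n) → Subset (card S) → Subset n
extend []          []      = []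
extend (true ∷ S)  (b ∷ Q) = b ∷ extend S Q
extend (false ∷ S) Q       = false ∷ extend S Q

embed-injective : ∀ {n} (S : Subset n) {i j} → embed S i ≡ embed S j → i ≡ j
embed-injective (true ∷ S)  {zero}  {zero}  e = refl
embed-injective (true ∷ S)  {suc i} {suc j} e = cong suc (embed-injective S (sucᶠ-injective e))
embed-injective (false ∷ S) e = embed-injective S (sucᶠ-injective e)

lookup-restrict : ∀ {n} (S B : Subset n) i → lookup (restrict S B) i ≡ lookup B (embed S i)
lookup-restrict (true ∷ S)  (b ∷ B) zero    = refl
lookup-restrict (true ∷ S)  (b ∷ B) (suc i) = lookup-restrict S B i
lookup-restrict (false ∷ S) (b ∷ B) i       = lookup-restrict S B i

card-restrict : ∀ {n} (S B : Subset n) → card (restrict S B) ≡ card (S ∩ B)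
card-restrict []          []      = refl
card-restrict (true ∷ S)  (b ∷ B) = cong (λ z → 𝟙 b + z) (card-restrict S B)
card-restrict (false ∷ S) (b ∷ B) = card-restrict S B

card-∩-restrict : ∀ {n} (S B : Subset n) Q → card (Q ∩ restrict S B) ≡ card (extend S Q ∩ B)
card-∩-restrict []          []      []      = refl
card-∩-restrict (true ∷ S)  (b ∷ B) (q ∷ Q) = cong (λ z → 𝟙 (q ∧ b) + z) (card-∩-restrict S B Q)
card-∩-restrict (false ∷ S) (b ∷ B) Q       = card-∩-restrict S B Q

extend⊑ : ∀ {n} (S : Subset n) Q → extend S Q ⊑ S
extend⊑ (true ∷ S)  (q ∷ Q) zero    h = refl
extend⊑ (true ∷ S)  (q ∷ Q) (suc x) h = extend⊑ S Q x h
extend⊑ (false ∷ S) Q       (suc x) h = extend⊑ S Q x h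

∣∣≡card : ∀ {n} (S : Subset n) → ∣ S ∣ ≡ card S
∣∣≡card []          = refl
∣∣≡card (true ∷ S)  = cong suc (∣∣≡card S)
∣∣≡card (false ∷ S) = ∣∣≡card S

card-full : ∀ n → card (full {n}) ≡ n
card-full n = trans (card-tabulate {n} (λ _ → true)) (trans (∑-const n 1) (*-identityʳ n))

card-∁ : ∀ {n} (S : Subset n) → card S + card (∁ S ∩ full) ≡ n
card-∁ {n} S = trans (sym (∑-distrib-+ (λ x → 𝟙 (lookup S x)) (λ x → 𝟙 (lookup (∁ S ∩ full) x))))
  (trans (sum-cong-≗ each) (trans (∑-const n 1) (*-identityʳ n)))
  where
  bits : ∀ b → 𝟙 b + 𝟙 (not b ∧ true) ≡ 1
  bits true  = refl
  bits false = refl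
  each : ∀ x → 𝟙 (lookup S x) + 𝟙 (lookup (∁ S ∩ full) x) ≡ 1
  each x = trans (cong (λ b → 𝟙 (lookup S x) + 𝟙 b) (trans (lookup-∩ (∁ S) full x)
    (cong₂ _∧_ (lookup-map x not S) (lookup∘tabulate (λ _ → true) x)))) (bits (lookup S x))

not-low : ∀ {n} (B S : Subset n) → low B S ≡ false → 9 * card B ≤ 20 * card (S ∩ B)
not-low B S h = ≤-trans (<⇒≤ (m<n*suc[m/n] (9 * card B) 20)) (*-monoʳ-≤ 20 (≰⇒> (does-false (card (S ∩ B) ≤? _) h)))

𝟙<1 : ∀ {b} → 𝟙 b < 1 → b ≡ false
𝟙<1 {false} _ = refl
𝟙<1 {true} (s≤s ())

-- The design on a random point set.

module Construction (p ℓ k : ℕ) (prime : Prime p) (20≤k : 20 ≤ k) (2^ℓ≤p : 2 ^ ℓ ≤ p) (3^k≤ℓ : 3 ^ k ≤ ℓ) (50k≤ℓ : 50 * k ≤ ℓ)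
  (scaling : Scales p ℓ k) where

  open Scales scaling
  open AffinePlane p prime using (N; ln; meet; join; line-size)

  instance
    k≢0 : NonZero k
    k≢0 = >-nonZero (≤-trans (s≤s z≤n) 20≤k)

  -- The oblique classes suffice for the union bound.
  oblique : Fin p → Fin N → Fin p
  oblique a = ln (suc a)

  oblique-meet : ∀ {a a′ x y} → x ≢ y → oblique a x ≡ oblique a y → oblique a′ x ≡ oblique a′ y → a ≡ a′
  oblique-meet ne e e′ = sucᶠ-injective (meet ne e e′)

  open Lines ln using (line; load; on-line; class-total)

  card-line : ∀ a b → card (line a b) ≡ p
  card-line a b = trans (card-tabulate (λ x → ln a x == b)) (line-size a b)

  open Union oblique oblique-meet (λ a b → card-line (suc a) b) t c Z D₀ f g m₁ m₂ J v w q 1≤p 1≤t c≥ 4t≤Z 2t≤D₀ room fuel doublings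
    m₁-bound m₂-bound 4m₂≤p J≡ 64t≤J J≤p 2^w≤p 4J≤2^v q≤ using (bad; bad-rare; bad-complete; codes-bound)

  2^tail : 2 ^ (3 + g) ≡ 8 * 2 ^ g
  2^tail = ^-distribˡ-+-* 2 3 g

  unbalanced : Subset N → ℕ
  unbalanced S = sum (λ a → sum (λ b → 𝟙 (low (line a b) S)))

  -- Too many points in `S` means too few in its complement, so the lower tail serves for both
  -- directions.
  oversized : Subset N → ℕ
  oversized S = 𝟙 (low (full {N}) (∁ S))

  bad-weight : 4 * wsum 1 bad ≤ 2 ^ N
  bad-weight = *-cancelˡ-≤ (2 ^ q) {{m^n≢0 2 q}} (begin
    2 ^ q * (4 * wsum 1 bad)     ≡⟨ solve 2 (λ a b → a :* (con 4 :* b) := con 4 :* (a :* b)) refl (2 ^ q) (wsum 1 bad) ⟩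
    4 * (2 ^ q * wsum 1 bad)     ≤⟨ *-monoʳ-≤ 4 bad-rare ⟩
    4 * (codes-bound * 2 ^ N)    ≡⟨ sym (*-assoc 4 codes-bound (2 ^ N)) ⟩
    4 * codes-bound * 2 ^ N      ≤⟨ *-monoˡ-≤ (2 ^ N) codes-small ⟩
    2 ^ q * 2 ^ N                ∎)
    where open ≤-Reasoning

  unbalanced-weight : 8 * wsum 1 unbalanced ≤ 2 ^ N
  unbalanced-weight = *-cancelˡ-≤ (2 ^ g) {{m^n≢0 2 g}} (begin
    2 ^ g * (8 * wsum 1 unbalanced)
      ≡⟨ trans (solve 2 (λ a b → a :* (con 8 :* b) := con 8 :* a :* b) refl (2 ^ g) (wsum 1 unbalanced))
           (cong (_* wsum 1 unbalanced) (sym 2^tail)) ⟩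
    2 ^ (3 + g) * wsum 1 unbalanced
      ≡⟨ cong (2 ^ (3 + g) *_) (trans (wsum-∑ 1 (λ a S → sum (λ b → 𝟙 (low (line a b) S))))
           (sum-cong-≗ (λ a → wsum-∑ 1 (λ b S → 𝟙 (low (line a b) S))))) ⟩
    2 ^ (3 + g) * sum (λ a → sum (λ b → wsum 1 (λ S → 𝟙 (low (line a b) S))))
      ≡⟨ trans (*-distribˡ-sum (2 ^ (3 + g)) (λ a → sum (λ b → wsum 1 (λ S → 𝟙 (low (line a b) S)))))
           (sum-cong-≗ (λ a → *-distribˡ-sum (2 ^ (3 + g)) (λ b → wsum 1 (λ S → 𝟙 (low (line a b) S))))) ⟩
    sum (λ a → sum (λ b → 2 ^ (3 + g) * wsum 1 (λ S → 𝟙 (low (line a b) S))))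
      ≤⟨ ∑-bound {suc p} (λ a → ∑-bound {p} (λ b → low-rare (line a b) (3 + g) (≤-trans 160[3+g]≤p (≤-reflexive (sym (card-line a b)))))) ⟩
    suc p * (p * 2 ^ N)          ≡⟨ sym (*-assoc (suc p) p (2 ^ N)) ⟩
    suc p * p * 2 ^ N            ≤⟨ *-monoˡ-≤ (2 ^ N) lines≤2^g ⟩
    2 ^ g * 2 ^ N                ∎)
    where
    open ≤-Reasoning

  oversized-weight : 8 * wsum 1 oversized ≤ 2 ^ N
  oversized-weight = ≤-trans (*-monoˡ-≤ (wsum 1 oversized) (≤-trans (m≤m*n 8 (2 ^ g) {{m^n≢0 2 g}}) (≤-reflexive (sym 2^tail))))
    (high-rare (full {N}) (3 + g) (≤-trans 160[3+g]≤p (≤-trans (m≤m*n p p {{>-nonZero 1≤p}}) (≤-reflexive (sym (card-full N))))))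

  abstract
    -- The three expectations are at most 1/4, 1/8 and 1/8, so their sum is below 1 and some set
    -- makes all three quantities vanish.
    sample : ∃ λ S → bad S + unbalanced S + oversized S < 1
    sample = wsum-witness 1 {N} {λ S → bad S + unbalanced S + oversized S} {λ _ → 1} (*-cancelˡ-< 8 _ _ (begin-strict
      8 * wsum 1 (λ S → bad S + unbalanced S + oversized S)
        ≡⟨ cong (8 *_) (trans (wsum-+ 1 (λ S → bad S + unbalanced S) oversized) (cong (_+ wsum 1 oversized) (wsum-+ 1 bad unbalanced))) ⟩
      8 * (wsum 1 bad + wsum 1 unbalanced + wsum 1 oversized)
        ≡⟨ solve 3 (λ a b c → con 8 :* (a :+ b :+ c) := con 2 :* (con 4 :* a) :+ con 8 :* b :+ con 8 :* c) refl (wsum 1 bad) (wsum 1 unbalanced) (wsum 1 oversized) ⟩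
      2 * (4 * wsum 1 bad) + 8 * wsum 1 unbalanced + 8 * wsum 1 oversized
        ≤⟨ +-mono-≤ (+-mono-≤ (*-monoʳ-≤ 2 bad-weight) unbalanced-weight) oversized-weight ⟩
      2 * 2 ^ N + 2 ^ N + 2 ^ N
        ≡⟨ solve 1 (λ x → con 2 :* x :+ x :+ x := con 4 :* x) refl (2 ^ N) ⟩
      4 * 2 ^ N
        <⟨ *-monoˡ-< (2 ^ N) {{m^n≢0 2 N}} (≤ᵇ⇒≤ 5 8 tt) ⟩
      8 * 2 ^ N
        ≡⟨ cong (8 *_) (sym (trans (wsum-const 1 N 1) (*-identityʳ (2 ^ N)))) ⟩
      8 * wsum 1 {N} (λ _ → 1) ∎))
      where open ≤-Reasoning

  S : Subset N
  S = proj₁ sample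

  n : ℕ
  n = card S

  S-bad : bad S < 1
  S-bad = ≤-<-trans (≤-trans (m≤m+n (bad S) (unbalanced S)) (m≤m+n _ (oversized S))) (proj₂ sample)

  S-load : ∀ a b → 9 * p ≤ 20 * load S a b
  S-load a b = subst (λ z → 9 * z ≤ 20 * load S a b) (card-line a b) (not-low (line a b) S (𝟙<1
    (≤-<-trans (≤-trans (≤-trans (∑-term (λ b → 𝟙 (low (line a b) S)) b) (∑-term (λ a → sum (λ b → 𝟙 (low (line a b) S))) a))
      (≤-trans (m≤n+m (unbalanced S) (bad S)) (m≤m+n _ (oversized S)))) (proj₂ sample))))

  n≤ : 20 * n ≤ 11 * (p * p)
  n≤ = +-cancelʳ-≤ (9 * N) _ _ (begin
    20 * n + 9 * N                             ≡⟨ cong (λ z → 20 * n + 9 * z) (sym (card-full N)) ⟩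
    20 * n + 9 * card (full {N})               ≤⟨ +-monoʳ-≤ (20 * n) (not-low full (∁ S) (𝟙<1 (≤-<-trans (m≤n+m (oversized S) (bad S + unbalanced S)) (proj₂ sample)))) ⟩
    20 * n + 20 * card (∁ S ∩ full)            ≡⟨ sym (*-distribˡ-+ 20 n (card (∁ S ∩ full))) ⟩
    20 * (n + card (∁ S ∩ full))               ≡⟨ cong (20 *_) (card-∁ S) ⟩
    20 * N                                     ≡⟨ solve 1 (λ x → con 20 :* x := con 11 :* x :+ con 9 :* x) refl N ⟩
    11 * N + 9 * N                             ∎)
    where open ≤-Reasoning

  -- The vertical lines partition `S`, and each of them already has at least 9 p / 20 points of it.
  ≤n : 9 * (p * p) ≤ 20 * n
  ≤n = begin
    9 * (p * p)                                ≡⟨ solve 1 (λ p → con 9 :* (p :* p) := p :* (con 9 :* p)) refl p ⟩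
    p * (9 * p)                                ≡⟨ sym (∑-const p (9 * p)) ⟩
    sum {p} (λ _ → 9 * p)                      ≤⟨ ∑-mono (S-load zero) ⟩
    sum (λ b → 20 * load S zero b)             ≡⟨ sym (*-distribˡ-sum 20 (load S zero)) ⟩
    20 * sum (load S zero)                     ≡⟨ cong (20 *_) (class-total S zero) ⟩
    20 * n                                     ∎
    where
    open ≤-Reasoning

  -- Otherwise `Q` meets every oblique line in 1 to `t` points and forces `bad S` to be positive.
  overloaded : ∀ Q → Q ⊑ S → (∀ a b → 1 ≤ load Q (suc a) b) → ∃ λ a → ∃ λ b → suc t ≤ load Q (suc a) b
  overloaded Q Q⊑S blocked with bool-case (any (λ a → any (λ b → suc t ≤ᵇ load Q (suc a) b)))
  ... | inj₁ e = let (a , e₁) = any-witness (λ a → any (λ b → suc t ≤ᵇ load Q (suc a) b)) e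
                     (b , e₂) = any-witness (λ b → suc t ≤ᵇ load Q (suc a) b) e₁
                 in a , b , does-true (suc t ≤? load Q (suc a) b) e₂
  ... | inj₂ e = ⊥-elim (<⇒≱ S-bad (bad-complete Q blocked bounded S Q⊑S))
    where
    bounded : ∀ a b → load Q (suc a) b ≤ t
    bounded a b with bool-case (suc t ≤ᵇ load Q (suc a) b)
    ... | inj₂ e′ = ≮⇒≥ (does-false (suc t ≤? load Q (suc a) b) e′)
    ... | inj₁ e′ = ⊥-elim (true≢false (any-true (λ a → any (λ b → suc t ≤ᵇ load Q (suc a) b)) a (any-true (λ b → suc t ≤ᵇ load Q (suc a) b) b e′)) e)

  m : ℕ
  m = suc p * p

  blockOf : Fin (suc p) → Fin p → Subset n
  blockOf a b = restrict S (line a b)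

  ∈-blockOf : ∀ x a b → ln a (embed S x) ≡ b → x ∈ blockOf a b
  ∈-blockOf x a b e = lookup⇒[]= x (blockOf a b) (trans (lookup-restrict S (line a b) x)
    (trans (on-line a b (embed S x)) (does-yes (ln a (embed S x) ≟ᶠ b) e)))

  blockOf-∈ : ∀ x a b → x ∈ blockOf a b → ln a (embed S x) ≡ b
  blockOf-∈ x a b h = does-true (ln a (embed S x) ≟ᶠ b) (trans (sym (on-line a b (embed S x)))
    (trans (sym (lookup-restrict S (line a b) x)) ([]=⇒lookup h)))

  design : BlockDesign n m
  design = record
    { block = λ i → blockOf (proj₁ (remQuot {suc p} p i)) (proj₂ (remQuot {suc p} p i))
    ; balanced = balanced
    }
    where
    block : Fin m → Subset n
    block i = blockOf (proj₁ (remQuot {suc p} p i)) (proj₂ (remQuot {suc p} p i))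
    balanced : ∀ {x y} → x ≢ y → ∃! _≡_ λ i → x ∈ block i × y ∈ block i
    balanced {x} {y} x≢y = joined (join (λ e → x≢y (embed-injective S e)))
      where
      joined : (∃ λ a → ln a (embed S x) ≡ ln a (embed S y)) → ∃! _≡_ λ i → x ∈ block i × y ∈ block i
      joined (a , e) = combine a b ,
        (subst (λ ab → x ∈ blockOf (proj₁ ab) (proj₂ ab)) (sym (remQuot-combine a b)) (∈-blockOf x a b refl) ,
         subst (λ ab → y ∈ blockOf (proj₁ ab) (proj₂ ab)) (sym (remQuot-combine a b)) (∈-blockOf y a b (sym e))) ,
        unique
        where
        b = ln a (embed S x)
        unique : ∀ {i} → x ∈ block i × y ∈ block i → combine a b ≡ i
        unique {i} (x∈ , y∈) = trans (cong₂ combine a≡ (trans (cong (λ c → ln c (embed S x)) a≡) (blockOf-∈ x a′ b′ x∈))) (combine-remQuot {suc p} p i)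
          where
          a′ = proj₁ (remQuot {suc p} p i)
          b′ = proj₂ (remQuot {suc p} p i)
          a≡ : a ≡ a′
          a≡ = meet {x = embed S x} {embed S y} (λ e′ → x≢y (embed-injective S e′)) e (trans (blockOf-∈ x a′ b′ x∈) (sym (blockOf-∈ y a′ b′ y∈)))

  ∣blockOf∣ : ∀ a b → ∣ blockOf a b ∣ ≡ load S a b
  ∣blockOf∣ a b = trans (∣∣≡card (blockOf a b)) (card-restrict S (line a b))

  ∣Q∩blockOf∣ : ∀ Q a b → ∣ Q ∩ blockOf a b ∣ ≡ load (extend S Q) a b
  ∣Q∩blockOf∣ Q a b = trans (∣∣≡card (Q ∩ blockOf a b)) (card-∩-restrict S (line a b) Q)

  transversal-overloaded : ∀ Q → Transversal design Q → ∃ λ i → suc t ≤ ∣ Q ∩ BlockDesign.block design i ∣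
  transversal-overloaded Q trans-Q = found (overloaded (extend S Q) (extend⊑ S Q) blocked)
    where
    blocked : ∀ a b → 1 ≤ load (extend S Q) (suc a) b
    blocked a b = let (x , h) = trans-Q (combine (suc a) b) in
      subst (1 ≤_) (card-∩-restrict S (line (suc a) b) Q) (card-pos (Q ∩ blockOf (suc a) b)
        (trans (cong (λ ab → lookup (Q ∩ blockOf (proj₁ ab) (proj₂ ab)) x) (sym (remQuot-combine {suc p} (suc a) b))) ([]=⇒lookup h)))
    found : (∃ λ a → ∃ λ b → suc t ≤ load (extend S Q) (suc a) b) → ∃ λ i → suc t ≤ ∣ Q ∩ BlockDesign.block design i ∣
    found (a , b , h) = combine (suc a) b , subst (λ ab → suc t ≤ ∣ Q ∩ blockOf (proj₁ ab) (proj₂ ab) ∣) (sym (remQuot-combine {suc p} (suc a) b))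
      (≤-trans h (≤-reflexive (sym (∣Q∩blockOf∣ Q (suc a) b))))

  20≤ℓ : 20 ≤ ℓ
  20≤ℓ = ≤-trans 20≤k (≤-trans (m≤n*m k 50) 50k≤ℓ)

  -- `n` is at least 9/20 of `4 ^ ℓ`, and 20 · 3^ℓ < 9 · 4^ℓ from `ℓ = 3` on. As `3 ^ k ≤ ℓ`, this
  -- yields log log n > k.
  3^ℓ<n : 3 ^ ℓ < n
  3^ℓ<n = *-cancelˡ-< 20 _ _ (begin-strict
    20 * 3 ^ ℓ               <⟨ fourth-power ℓ (≤-trans (≤ᵇ⇒≤ 3 20 tt) 20≤ℓ) ⟩
    9 * 4 ^ ℓ                ≡⟨ cong (9 *_) (trans (^-*-assoc 2 2 ℓ) (trans (cong (2 ^_) (cong (λ z → ℓ + z) (+-identityʳ ℓ))) (^-distribˡ-+-* 2 ℓ ℓ))) ⟩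
    9 * (2 ^ ℓ * 2 ^ ℓ)      ≤⟨ *-monoʳ-≤ 9 (*-mono-≤ 2^ℓ≤p 2^ℓ≤p) ⟩
    9 * (p * p)              ≤⟨ ≤n ⟩
    20 * n                   ∎)
    where
    open ≤-Reasoning
    fourth-power : ∀ ℓ → 3 ≤ ℓ → 20 * 3 ^ ℓ < 9 * 4 ^ ℓ
    fourth-power ℓ h = subst (λ ℓ → 20 * 3 ^ ℓ < 9 * 4 ^ ℓ) (m+[n∸m]≡n h) (begin-strict
      20 * 3 ^ (3 + e)       ≡⟨ trans (cong (20 *_) (^-distribˡ-+-* 3 3 e)) (sym (*-assoc 20 (3 ^ 3) (3 ^ e))) ⟩
      20 * 3 ^ 3 * 3 ^ e     <⟨ *-monoˡ-< (3 ^ e) {{m^n≢0 3 e}} (≤ᵇ⇒≤ 541 576 tt) ⟩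
      9 * 4 ^ 3 * 3 ^ e      ≤⟨ *-monoʳ-≤ (9 * 4 ^ 3) (^-monoˡ-≤ e (≤ᵇ⇒≤ 3 4 tt)) ⟩
      9 * 4 ^ 3 * 4 ^ e      ≡⟨ trans (*-assoc 9 (4 ^ 3) (4 ^ e)) (cong (9 *_) (sym (^-distribˡ-+-* 4 3 e))) ⟩
      9 * 4 ^ (3 + e)        ∎)
      where e = ℓ ∸ 3

  n<2^ : n < 2 ^ g
  n<2^ = ≤-trans (s≤s (card≤n S)) N≤2^g

  g-suc : suc (pred g) ≡ g
  g-suc = suc-pred g {{subst NonZero (sym g≡) (m*n≢0 2 (suc ℓ))}}

  k≤n : k ≤ n
  k≤n = ≤-trans (≤-trans (m≤n*m k 50) 50k≤ℓ) (<⇒≤ (≤-<-trans (<⇒≤ (m<3^m ℓ)) 3^ℓ<n))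
    where
    m<3^m : ∀ m → m < 3 ^ m
    m<3^m zero    = s≤s z≤n
    m<3^m (suc m) = ≤-trans (s≤s (m<3^m m)) (≤-trans (+-monoˡ-≤ (3 ^ m) (m^n>0 3 m)) (+-monoʳ-≤ (3 ^ m) (m≤m+n (3 ^ m) _)))

  3≤n : 3 ≤ n
  3≤n = ≤-trans (≤-trans (≤ᵇ⇒≤ 3 20 tt) 20≤k) k≤n

  blocks-large : ∀ i → (+ 6 ℚ./ 10) · (√ n) <ℝ fromℕ ∣ BlockDesign.block design i ∣
  blocks-large i = block-size-bound n ∣ blockOf a b ∣ p 1≤p n≤ (≤-trans (S-load a b) (≤-reflexive (cong (20 *_) (sym (∣blockOf∣ a b)))))
    where
    a = proj₁ (remQuot {suc p} p i)
    b = proj₂ (remQuot {suc p} p i)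

  k≡ : suc (pred k) ≡ k
  k≡ = suc-pred k

  -- log n is below `g` because `n < 2 ^ g`, and log log n is above `k`; `threshold` compares their
  -- quotient with `suc t`.
  large-intersection : ∀ Q → Transversal design Q → Σ[ i ∈ Fin m ] fromℕ ∣ Q ∩ BlockDesign.block design i ∣ ≥ℝ ln/100lnln n 3≤n
  large-intersection Q trans-Q = let (i , h) = transversal-overloaded Q trans-Q in
    i , ln/100lnln-bound n 3≤n (pred k) (pred g) (suc t) ∣ Q ∩ BlockDesign.block design i ∣
      (≤-<-trans (^-monoʳ-≤ 3 (≤-trans (≤-reflexive (cong (3 ^_) k≡)) 3^k≤ℓ)) 3^ℓ<n) (subst (λ e → n < 2 ^ e) (sym g-suc) n<2^)
      (≤-trans (≤-reflexive g-suc) (≤-trans threshold (≤-reflexive (cong (λ z → suc t * (100 * z)) (sym k≡))))) h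

-- Designs with arbitrarily many points.

DenseDesign : (ℕ → Set) → Set
DenseDesign P = Σ[ n ∈ ℕ ] Σ[ m ∈ ℕ ] Σ[ D ∈ BlockDesign n m ] Σ[ 3≤n ∈ 3 ≤ n ]
  P n
  × (∀ i → (+ 6 ℚ./ 10) · (√ n) <ℝ fromℕ ∣ BlockDesign.block D i ∣)
  × (∀ (Q : Subset n) → Transversal D Q → Σ[ i ∈ Fin m ] fromℕ ∣ Q ∩ BlockDesign.block D i ∣ ≥ℝ ln/100lnln n 3≤n)

weaken : ∀ {P R : ℕ → Set} → (∀ {n} → P n → R n) → DenseDesign P → DenseDesign R
weaken P⇒R (n , m , D , 3≤n , h , rest) = n , m , D , 3≤n , P⇒R h , rest

design-at-scale : ∀ p ℓ k → Prime p → 20 ≤ k → 2 ^ ℓ ≤ p → 3 ^ k ≤ ℓ → 50 * k ≤ ℓ → Scales p ℓ k → DenseDesign (k ≤_)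
design-at-scale p ℓ k isPrime 20≤k 2^ℓ≤p 3^k≤ℓ 50k≤ℓ scaling = n , m , design , 3≤n , k≤n , blocks-large , large-intersection
  where open Construction p ℓ k isPrime 20≤k 2^ℓ≤p 3^k≤ℓ 50k≤ℓ scaling

large-design : ∀ K → 20 ≤ K → DenseDesign (K ≤_)
-- This size of `p` makes its binary logarithm `ℓ` at least `3 ^ K`, and then the ternary logarithm
-- `k` of `ℓ` at least `K`; the crude bound `k ≤ n` is enough to reach any prescribed size.
large-design K 20≤K = at-p (prime-above (2 ^ (3 ^ K)))
  where
  at-p : (∃ λ p → 2 ^ (3 ^ K) < p × Prime p) → DenseDesign (K ≤_)
  at-p (p , large , isPrime) = at-ℓ (log-bracket 0 p (≤-trans (s≤s z≤n) large))
    where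
    at-ℓ : (∃ λ ℓ → 2 ^ ℓ ≤ p × p < 2 ^ suc ℓ) → DenseDesign (K ≤_)
    at-ℓ (ℓ , 2^ℓ≤p , p<) = at-k (log-bracket 1 ℓ (≤-trans (m^n>0 3 K) 3^K≤ℓ))
      where
      3^K≤ℓ : 3 ^ K ≤ ℓ
      3^K≤ℓ = ≤-pred (^-cancelʳ-< 1 (<-trans large p<))
      at-k : (∃ λ k → 3 ^ k ≤ ℓ × ℓ < 3 ^ suc k) → DenseDesign (K ≤_)
      at-k (k , 3^k≤ℓ , ℓ<) = weaken (≤-trans K≤k) (design-at-scale p ℓ k isPrime 20≤k 2^ℓ≤p 3^k≤ℓ
        (Parameters.50k≤ℓ p ℓ k 20≤k 2^ℓ≤p p< 3^k≤ℓ ℓ<) (Parameters.scales p ℓ k 20≤k 2^ℓ≤p p< 3^k≤ℓ ℓ<))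
        where
        K≤k : K ≤ k
        K≤k = ≤-pred (^-cancelʳ-< 2 (≤-<-trans 3^K≤ℓ ℓ<))
        20≤k : 20 ≤ k
        20≤k = ≤-trans 20≤K K≤k

theorem1p2 : ∀ (n₀ : ℤ) →
    Σ[ n ∈ ℕ ] Σ[ m ∈ ℕ ] Σ[ D ∈ BlockDesign n m ] Σ[ 3≤n ∈ 3 ≤ n ]
    (+ n) ℤ.≥ n₀
    × (∀ i → (+ 6 ℚ./ 10) · (√ n) <ℝ fromℕ ∣ BlockDesign.block D i ∣)
    × (∀ (Q : Subset n) → Transversal D Q →
    Σ[ i ∈ Fin m ] fromℕ ∣ Q ∩ BlockDesign.block D i ∣ ≥ℝ ln/100lnln n 3≤n)
theorem1p2 n₀ = weaken (λ K≤n → ℤ.≤-trans (≤+∣∣ n₀) (ℤ.+≤+ (≤-trans (m≤n+m ℤ.∣ n₀ ∣ 20) K≤n)))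
  -- 20 is the least `k` for which the parameters are set up.
  (large-design (20 + ℤ.∣ n₀ ∣) (m≤m+n 20 ℤ.∣ n₀ ∣))
  where
  ≤+∣∣ : ∀ z → z ℤ.≤ + ℤ.∣ z ∣
  ≤+∣∣ (+ n)    = ℤ.+≤+ ≤-refl
  ≤+∣∣ -[1+ n ] = ℤ.-≤+
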